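{- Let $(F_k)_{k\ge 0}$ be the Fibonacci sequence. Consider the inequality $$|F_n + F_m - 2^a| < 2^{a/2}$$ in positive integers $n, m, a$ with $n \ge m$. It has exactly $52$ solutions $(n,m,a)$, all satisfying $n \le 42$ and $a \le 28$. Namely, the solutions are exactly the triples $(1,1,1)$, $(2,1,1)$, $(2,2,1)$, $(3,1,1)$, $(3,2,1)$, $(3,1,2)$, $(3,2,2)$, $(3,3,2)$, $(4,1,2)$, $(4,2,2)$, $(4,3,2)$, $(4,4,3)$, $(5,1,3)$, $(5,2,3)$, $(5,3,3)$, $(5,4,3)$, $(5,5,3)$, $(6,1,3)$, $(6,2,3)$, $(6,3,3)$, $(6,5,4)$, $(6,6,4)$, $(7,1,4)$, $(7,2,4)$, $(7,3,4)$, $(7,4,4)$, $(7,5,4)$, $(8,6,5)$, $(8,7,5)$, $(9,1,5)$, $(9,2,5)$, $(9,3,5)$, $(9,4,5)$, $(9,9,6)$, $(10,3,6)$, $(10,4,6)$, $(10,5,6)$, $(10,6,6)$, $(10,7,6)$, $(11,9,7)$, $(13,6,8)$, $(13,7,8)$, $(13,8,8)$, $(13,9,8)$, $(14,12,9)$, $(16,6,10)$, $(16,7,10)$, $(16,8,10)$, $(16,9,10)$, $(16,10,10)$, $(23,19,15)$, $(42,29,28)$.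
   Context: The Fibonacci sequence is defined by $F_0 = 0$, $F_1 = 1$ and $F_{k+2} = F_{k+1} + F_k$ for all $k \ge 0$ (so $F_1=F_2=1$, $F_3=2$, $F_4=3$, $F_5=5$, \dots). -}

module Defs where

open import Data.Nat using (ℕ; zero; suc; _+_; _*_; _^_; _<_; ∣_-_∣)
open import Data.Product using (_×_; _,_)
open import Data.List using (List; []; _∷_)

F : ℕ → ℕ
F zero = zero
F (suc zero) = suc zero
F (suc (suc k)) = F (suc k) + F k

-- |F n + F m - 2^a| < 2^(a/2), stated over ℕ without reals:
-- with d = |F n + F m - 2^a| ≥ 0, d < 2^(a/2) ⇔ d * d < 2^a.
Ineq : ℕ → ℕ → ℕ → Set
Ineq n m a = let d = ∣ F n + F m - 2 ^ a ∣ in d * d < 2 ^ a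

solutions : List (ℕ × ℕ × ℕ)
solutions =
  (1 , 1 , 1) ∷ (2 , 1 , 1) ∷ (2 , 2 , 1) ∷ (3 , 1 , 1) ∷ (3 , 2 , 1) ∷
  (3 , 1 , 2) ∷ (3 , 2 , 2) ∷ (3 , 3 , 2) ∷ (4 , 1 , 2) ∷ (4 , 2 , 2) ∷
  (4 , 3 , 2) ∷ (4 , 4 , 3) ∷ (5 , 1 , 3) ∷ (5 , 2 , 3) ∷ (5 , 3 , 3) ∷
  (5 , 4 , 3) ∷ (5 , 5 , 3) ∷ (6 , 1 , 3) ∷ (6 , 2 , 3) ∷ (6 , 3 , 3) ∷
  (6 , 5 , 4) ∷ (6 , 6 , 4) ∷ (7 , 1 , 4) ∷ (7 , 2 , 4) ∷ (7 , 3 , 4) ∷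
  (7 , 4 , 4) ∷ (7 , 5 , 4) ∷ (8 , 6 , 5) ∷ (8 , 7 , 5) ∷ (9 , 1 , 5) ∷
  (9 , 2 , 5) ∷ (9 , 3 , 5) ∷ (9 , 4 , 5) ∷ (9 , 9 , 6) ∷ (10 , 3 , 6) ∷
  (10 , 4 , 6) ∷ (10 , 5 , 6) ∷ (10 , 6 , 6) ∷ (10 , 7 , 6) ∷ (11 , 9 , 7) ∷
  (13 , 6 , 8) ∷ (13 , 7 , 8) ∷ (13 , 8 , 8) ∷ (13 , 9 , 8) ∷ (14 , 12 , 9) ∷
  (16 , 6 , 10) ∷ (16 , 7 , 10) ∷ (16 , 8 , 10) ∷ (16 , 9 , 10) ∷ (16 , 10 , 10) ∷
  (23 , 19 , 15) ∷ (42 , 29 , 28) ∷ []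

{-# OPTIONS --safe #-}
module Submission where

-- Let d = n - m. A solution satisfies |φᵐ G - √5 2ᵃ| = O(2^(a/2)) with G = φᵈ + 1, and also |φⁿ - √5 2ᵃ| = O(2ᵃ φ⁻ᵈ).
--
-- Lower bounds for such quantities |φᴺ G - √5 2ᵃ| come from an interpolation argument in ℤ[φ]. Choose 2ᵖ ≤ φ^q ≤ 2ᵖ (1 + 2^-Λ)
-- and write N = q r + n₀, a = p r + s. If φᴺ G is too close to √5 2ᵃ, then λ = φ^q / 2ᵖ and √5 2ˢ / (φ^n₀ G) behave like λ
-- and λʳ, so that products of their powers behave like λᶻ with z = i + r j. A zero estimate for P(z) + Q(z) λᶻ (Newton
-- polynomials P, Q) provides a nonsingular square interpolation matrix, and Siegel's lemma a small integral combination
-- of its columns that annihilates all polynomials of low degree. Since λ - 1 is tiny, Taylor expansion makes this combination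
-- very small on each C(z, τ) λᶻ; by Liouville's inequality it vanishes there, which contradicts nonsingularity.
-- With G = 1 this shows that d is a tiny fraction of n when n is huge, and then G = φᵈ + 1 bounds n.
--
-- The bounds are reduced by raising φᴺ G ≈ √5 2ᵃ to a power Q with φ^Q ≈ 2ᴾ: then (G / √5)^Q would be close to a power of 2,
-- which interval arithmetic refutes for G = 1 and for all small d. The exceptions d = 2 and d = 6, where G / √5 = 2^μ φ^κ, force
-- P (N + κ) = (a - μ) Q, which is excluded by coprimality. A finite search remains.

open import Defs
open import Data.Nat as ℕ using (ℕ; zero; suc; pred; NonZero; _≤_; _<_; z≤n; s≤s; _+_; _*_; _^_; _∸_; _≡ᵇ_; _≤ᵇ_; _<ᵇ_; _!)
open import Data.Nat.Properties as ℕ using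
  (*-cancelʳ-≤; *-cancelˡ-≤; *-distribʳ-+; *-distribˡ-+; *-mono-≤; *-monoʳ-≤; *-monoˡ-≤; +-cancelˡ-≤;
  +-mono-<-≤; +-mono-≤; +-monoʳ-<; +-monoʳ-≤; +-monoˡ-<; +-monoˡ-≤; +-suc; <-irrefl; <-≤-connex; <-≤-trans; <⇒≤;
  <⇒≱; ^-*-assoc; ^-distribˡ-+-*; ^-monoʳ-<; ^-monoʳ-≤; ^-monoˡ-≤; m*n≢0; m+[n∸m]≡n; m^n>0; m^n≢0; m∸n+n≡m;
  m≤m*n; m≤m+n; m≤n*m; m≤n+m; n<1+n; n≤1+n; suc-injective; suc-pred; ≤-<-connex; ≤-<-trans; ≤-pred; ≤-refl;
  ≤-reflexive; ≤-trans; ≮⇒≥; ≰⇒>)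
open import Data.Integer as ℤ using (ℤ; +_; -[1+_]; 0ℤ; 1ℤ)
import Data.Integer.Properties as ℤ
import Data.Integer.DivMod as ℤ
open import Data.Integer.Tactic.RingSolver using (solve-∀)
open import Data.Nat.Tactic.RingSolver using () renaming (solve-∀ to ℕ-solve-∀)
open import Data.Product using (Σ; ∃; _×_; _,_; proj₁; proj₂)
open import Data.Nat.DivMod using (_%_; _/_; m/n*n≤m; m%n<n; m≡m%n+[m/n]*n; m<n*o⇒m/o<n)
open import Data.Nat.Divisibility using (_∣_; ∣⇒≤; ∣m+n∣m⇒∣n; n∣m*n; ∣n⇒∣m*n; ∣m⇒∣m*n)
open import Data.Fin as Fin using (Fin)
import Data.Fin.Properties as Fin
open import Data.Sum using (_⊎_; inj₁; inj₂; [_,_]′)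
open import Relation.Binary.Definitions using (tri<; tri≈; tri>)
open import Data.Empty using (⊥; ⊥-elim)
open import Data.Bool using (Bool; true; false; if_then_else_; _∧_; _∨_) renaming (T to IsTrue)
open import Data.List using (List; []; _∷_; foldr; length)
open import Data.List.Membership.Propositional using (_∈_)
open import Data.List.Relation.Unary.Unique.Propositional using (Unique)
open import Data.List.Relation.Unary.Any using (here; there)
open import Data.List.Relation.Unary.All as All using (All)
open import Data.Product.Properties using (≡-dec)
open import Data.Maybe using (just; nothing)
open import Function using (_∘_)
open import Function.Bundles using (_⇔_; mk⇔)
open import Level using (0ℓ)
open import Relation.Nullary using (¬_; Dec; yes; no; does)
open import Relation.Nullary.Decidable using (¬?; decidable-stable; toWitness)
open import Relation.Binary.PropositionalEquality
  using (_≡_; _≢_; refl; sym; trans; cong; cong₂; subst; subst₂; isEquivalence; module ≡-Reasoning)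
open import Algebra.Bundles using (CommutativeRing)
import Algebra.Properties.CommutativeSemiring.Exp
import Tactic.RingSolver.NonReflective
open import Tactic.RingSolver.Core.AlmostCommutativeRing using (AlmostCommutativeRing; fromCommutativeRing)

-- The ring ℤ[φ], ordered as a subring of ℝ

-- The accuracy that refutes an approximation by `φ ^ᵣ N *ᵣ G` is `Λ₀ * (x * p)` bits, where x p is
-- at most N / 2^(h+1), while Λ₀ need only be 14 (h + 1) + 67. So only a fraction Λ₀ / 2^(h+1) of N
-- bits is required. It becomes as small as desired when h grows, at the price of a larger q. This
-- governs the two choices of parameters. With G = φᵈ + 1 about a / 2 bits are available, so the
-- modest `h₂` suffices; since the height of G enters linearly, the result is a bound n ≤ C (4 u +
-- d) with C = 131072 u = 2^225. With G = 1 about d / 2 bits are available, so either n is bounded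
-- outright or d is below a fixed small fraction of n. The large `h₁` makes this fraction smaller
-- than 1 / C, and then the linear bound closes up.

data ℤφ : Set where
  mk : ℤ → ℤ → ℤφ

infixl 6 _+ᵣ_
infixl 7 _*ᵣ_
infix 8 -ᵣ_

_+ᵣ_ _*ᵣ_ : ℤφ → ℤφ → ℤφ
mk a b +ᵣ mk c d = mk (a ℤ.+ c) (b ℤ.+ d)
mk a b *ᵣ mk c d = mk (a ℤ.* c ℤ.+ b ℤ.* d) (a ℤ.* d ℤ.+ b ℤ.* c ℤ.+ b ℤ.* d)

-ᵣ_ conj : ℤφ → ℤφ
-ᵣ mk a b = mk (ℤ.- a) (ℤ.- b)
conj (mk a b) = mk (a ℤ.+ b) (ℤ.- b)

ι : ℕ → ℤφ
ι n = mk (+ n) 0ℤ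

0ᵣ 1ᵣ φ : ℤφ
0ᵣ = mk 0ℤ 0ℤ
1ᵣ = mk 1ℤ 0ℤ
φ = mk 0ℤ 1ℤ

mk-injective : ∀ {a b c d} → mk a b ≡ mk c d → a ≡ c × b ≡ d
mk-injective refl = refl , refl

_≟ᵣ_ : (x y : ℤφ) → Dec (x ≡ y)
mk a b ≟ᵣ mk c d with a ℤ.≟ c | b ℤ.≟ d
... | yes refl | yes refl = yes refl
... | no a≢c | _ = no (a≢c ∘ proj₁ ∘ mk-injective)
... | yes _ | no b≢d = no (b≢d ∘ proj₂ ∘ mk-injective)

private
  *-assoc₁ : ∀ a b c d e f →
    (a ℤ.* c ℤ.+ b ℤ.* d) ℤ.* e ℤ.+ (a ℤ.* d ℤ.+ b ℤ.* c ℤ.+ b ℤ.* d) ℤ.* f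
      ≡ a ℤ.* (c ℤ.* e ℤ.+ d ℤ.* f) ℤ.+ b ℤ.* (c ℤ.* f ℤ.+ d ℤ.* e ℤ.+ d ℤ.* f)
  *-assoc₁ = solve-∀
  *-assoc₂ : ∀ a b c d e f →
    (a ℤ.* c ℤ.+ b ℤ.* d) ℤ.* f ℤ.+ (a ℤ.* d ℤ.+ b ℤ.* c ℤ.+ b ℤ.* d) ℤ.* e
        ℤ.+ (a ℤ.* d ℤ.+ b ℤ.* c ℤ.+ b ℤ.* d) ℤ.* f
      ≡ a ℤ.* (c ℤ.* f ℤ.+ d ℤ.* e ℤ.+ d ℤ.* f) ℤ.+ b ℤ.* (c ℤ.* e ℤ.+ d ℤ.* f)
        ℤ.+ b ℤ.* (c ℤ.* f ℤ.+ d ℤ.* e ℤ.+ d ℤ.* f)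
  *-assoc₂ = solve-∀
  *-comm₁ : ∀ a b c d → a ℤ.* c ℤ.+ b ℤ.* d ≡ c ℤ.* a ℤ.+ d ℤ.* b
  *-comm₁ = solve-∀
  *-comm₂ : ∀ a b c d → a ℤ.* d ℤ.+ b ℤ.* c ℤ.+ b ℤ.* d ≡ c ℤ.* b ℤ.+ d ℤ.* a ℤ.+ d ℤ.* b
  *-comm₂ = solve-∀
  distrib₁ : ∀ a b c d e f → a ℤ.* (c ℤ.+ e) ℤ.+ b ℤ.* (d ℤ.+ f)
    ≡ a ℤ.* c ℤ.+ b ℤ.* d ℤ.+ (a ℤ.* e ℤ.+ b ℤ.* f)
  distrib₁ = solve-∀
  distrib₂ : ∀ a b c d e f →
    a ℤ.* (d ℤ.+ f) ℤ.+ b ℤ.* (c ℤ.+ e) ℤ.+ b ℤ.* (d ℤ.+ f)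
    ≡ a ℤ.* d ℤ.+ b ℤ.* c ℤ.+ b ℤ.* d ℤ.+ (a ℤ.* f ℤ.+ b ℤ.* e ℤ.+ b ℤ.* f)
  distrib₂ = solve-∀
  identity₁ : ∀ a b → 1ℤ ℤ.* a ℤ.+ 0ℤ ℤ.* b ≡ a
  identity₁ = solve-∀
  identity₂ : ∀ a b → 1ℤ ℤ.* b ℤ.+ 0ℤ ℤ.* a ℤ.+ 0ℤ ℤ.* b ≡ b
  identity₂ = solve-∀

  +ᵣ-assoc : ∀ x y z → x +ᵣ y +ᵣ z ≡ x +ᵣ (y +ᵣ z)
  +ᵣ-assoc (mk a b) (mk c d) (mk e f) = cong₂ mk (ℤ.+-assoc a c e) (ℤ.+-assoc b d f)
  +ᵣ-comm : ∀ x y → x +ᵣ y ≡ y +ᵣ x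
  +ᵣ-comm (mk a b) (mk c d) = cong₂ mk (ℤ.+-comm a c) (ℤ.+-comm b d)
  +ᵣ-identityˡ : ∀ x → 0ᵣ +ᵣ x ≡ x
  +ᵣ-identityˡ (mk a b) = cong₂ mk (ℤ.+-identityˡ a) (ℤ.+-identityˡ b)
  -ᵣ-inverseˡ : ∀ x → -ᵣ x +ᵣ x ≡ 0ᵣ
  -ᵣ-inverseˡ (mk a b) = cong₂ mk (ℤ.+-inverseˡ a) (ℤ.+-inverseˡ b)
  *ᵣ-assoc : ∀ x y z → x *ᵣ y *ᵣ z ≡ x *ᵣ (y *ᵣ z)
  *ᵣ-assoc (mk a b) (mk c d) (mk e f) = cong₂ mk (*-assoc₁ a b c d e f) (*-assoc₂ a b c d e f)
  *ᵣ-comm : ∀ x y → x *ᵣ y ≡ y *ᵣ x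
  *ᵣ-comm (mk a b) (mk c d) = cong₂ mk (*-comm₁ a b c d) (*-comm₂ a b c d)
  *ᵣ-identityˡ : ∀ x → 1ᵣ *ᵣ x ≡ x
  *ᵣ-identityˡ (mk a b) = cong₂ mk (identity₁ a b) (identity₂ a b)
  *ᵣ-distribˡ : ∀ x y z → x *ᵣ (y +ᵣ z) ≡ x *ᵣ y +ᵣ x *ᵣ z
  *ᵣ-distribˡ (mk a b) (mk c d) (mk e f) = cong₂ mk (distrib₁ a b c d e f) (distrib₂ a b c d e f)

ring : CommutativeRing 0ℓ 0ℓ
ring = record
  { Carrier = ℤφ ; _≈_ = _≡_ ; _+_ = _+ᵣ_ ; _*_ = _*ᵣ_ ; -_ = -ᵣ_ ; 0# = 0ᵣ ; 1# = 1ᵣ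
  ; isCommutativeRing = record
    { isRing = record
      { +-isAbelianGroup = record
        { isGroup = record
          { isMonoid = record
            { isSemigroup = record
              { isMagma = record { isEquivalence = isEquivalence ; ∙-cong = cong₂ _+ᵣ_ }
              ; assoc = +ᵣ-assoc }
            ; identity = +ᵣ-identityˡ , λ x → trans (+ᵣ-comm x 0ᵣ) (+ᵣ-identityˡ x) }
          ; inverse = -ᵣ-inverseˡ , λ x → trans (+ᵣ-comm x (-ᵣ x)) (-ᵣ-inverseˡ x)
          ; ⁻¹-cong = cong -ᵣ_ }
        ; comm = +ᵣ-comm }
      ; *-cong = cong₂ _*ᵣ_
      ; *-assoc = *ᵣ-assoc
      ; *-identity = *ᵣ-identityˡ , λ x → trans (*ᵣ-comm x 1ᵣ) (*ᵣ-identityˡ x)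
      ; distrib = *ᵣ-distribˡ , λ x y z → trans (*ᵣ-comm (y +ᵣ z) x)
          (trans (*ᵣ-distribˡ x y z) (cong₂ _+ᵣ_ (*ᵣ-comm x y) (*ᵣ-comm x z))) }
    ; *-comm = *ᵣ-comm } }

open CommutativeRing ring public
  using (*-assoc; *-comm; +-assoc; +-comm; zeroˡ; zeroʳ; distribˡ; distribʳ; *-identityˡ; *-identityʳ; +-identityˡ; +-identityʳ)
  renaming (_-_ to infixl 6 _-ᵣ_)
module Exp = Algebra.Properties.CommutativeSemiring.Exp (CommutativeRing.commutativeSemiring ring)
open Exp public using (^-homo-*; ^-assocʳ; ^-distrib-*) renaming (_^_ to infixr 8 _^ᵣ_)

almostRing : AlmostCommutativeRing 0ℓ 0ℓ
almostRing = fromCommutativeRing ring λ { (mk (+ 0) (+ 0)) → just refl ; _ → nothing }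

open Tactic.RingSolver.NonReflective almostRing public using (solve; _⊜_; _⊕_; _⊗_; ⊝_; Κ)

ι-* : ∀ m n → ι (m * n) ≡ ι m *ᵣ ι n
ι-* m n = cong₂ mk
  (trans (ℤ.pos-* m n) (sym (trans (cong (λ z → + m ℤ.* + n ℤ.+ z) (ℤ.*-zeroˡ 0ℤ)) (ℤ.+-identityʳ _))))
  (sym (trans (cong (λ z → z ℤ.+ 0ℤ ℤ.* + n ℤ.+ 0ℤ ℤ.* 0ℤ) (ℤ.*-zeroʳ (+ m)))
     (cong (λ z → 0ℤ ℤ.+ z ℤ.+ 0ℤ) (ℤ.*-zeroˡ (+ n)))))

ι-^ : ∀ m n → ι (m ^ n) ≡ ι m ^ᵣ n
ι-^ m zero = refl
ι-^ m (suc n) = trans (ι-* m (m ^ n)) (cong (ι m *ᵣ_) (ι-^ m n))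

conj-+ : ∀ x y → conj (x +ᵣ y) ≡ conj x +ᵣ conj y
conj-+ (mk a b) (mk c d) = cong₂ mk (lem a b c d) (ℤ.neg-distrib-+ b d)
  where
  lem : ∀ a b c d → a ℤ.+ c ℤ.+ (b ℤ.+ d) ≡ a ℤ.+ b ℤ.+ (c ℤ.+ d)
  lem = solve-∀

conj-* : ∀ x y → conj (x *ᵣ y) ≡ conj x *ᵣ conj y
conj-* (mk a b) (mk c d) = cong₂ mk (lem₁ a b c d) (lem₂ a b c d)
  where
  lem₁ : ∀ a b c d → a ℤ.* c ℤ.+ b ℤ.* d ℤ.+ (a ℤ.* d ℤ.+ b ℤ.* c ℤ.+ b ℤ.* d)
    ≡ (a ℤ.+ b) ℤ.* (c ℤ.+ d) ℤ.+ ℤ.- b ℤ.* ℤ.- d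
  lem₁ = solve-∀
  lem₂ : ∀ a b c d → ℤ.- (a ℤ.* d ℤ.+ b ℤ.* c ℤ.+ b ℤ.* d)
    ≡ (a ℤ.+ b) ℤ.* ℤ.- d ℤ.+ ℤ.- b ℤ.* (c ℤ.+ d) ℤ.+ ℤ.- b ℤ.* ℤ.- d
  lem₂ = solve-∀

conj-ι : ∀ n → conj (ι n) ≡ ι n
conj-ι n = cong₂ mk (ℤ.+-identityʳ (+ n)) refl

conj-^ : ∀ x n → conj (x ^ᵣ n) ≡ conj x ^ᵣ n
conj-^ x zero = refl
conj-^ x (suc n) = trans (conj-* x (x ^ᵣ n)) (cong (conj x *ᵣ_) (conj-^ x n))

-- Nonnegativity, the order and absolute values

NN : ℤφ → Set
NN (mk a b) = 0ℤ ℤ.≤ a × 0ℤ ℤ.≤ b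

private
  +-nn : ∀ {a b} → 0ℤ ℤ.≤ a → 0ℤ ℤ.≤ b → 0ℤ ℤ.≤ a ℤ.+ b
  +-nn p q = ℤ.+-mono-≤ p q
  *-nn : ∀ {a b} → 0ℤ ℤ.≤ a → 0ℤ ℤ.≤ b → 0ℤ ℤ.≤ a ℤ.* b
  *-nn {+ m} {+ n} _ _ = subst (0ℤ ℤ.≤_) (ℤ.pos-* m n) (ℤ.+≤+ z≤n)

NN-+ : ∀ {x y} → NN x → NN y → NN (x +ᵣ y)
NN-+ {mk _ _} {mk _ _} (p , q) (r , s) = +-nn p r , +-nn q s

NN-* : ∀ {x y} → NN x → NN y → NN (x *ᵣ y)
NN-* {mk _ _} {mk _ _} (p , q) (r , s) =
  +-nn (*-nn p r) (*-nn q s) , +-nn (+-nn (*-nn p s) (*-nn q r)) (*-nn q s)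

NN-φ^ : ∀ k → NN (φ ^ᵣ k)
NN-φ^ zero = ℤ.+≤+ z≤n , ℤ.+≤+ z≤n
NN-φ^ (suc k) = NN-* {φ} {φ ^ᵣ k} (ℤ.+≤+ z≤n , ℤ.+≤+ z≤n) (NN-φ^ k)

-- x ≥ 0 in ℝ: the cones φ⁻ᵏ(ℕ + ℕφ) increase to the nonnegative half line.
record Pos (x : ℤφ) : Set where
  constructor _,_
  field
    shift : ℕ
    nonneg : NN (φ ^ᵣ shift *ᵣ x)

Pos-+ : ∀ {x y} → Pos x → Pos y → Pos (x +ᵣ y)
Pos-+ {x} {y} (k , p) (l , q) = k + l , subst NN eq
    (NN-+ {φ ^ᵣ l *ᵣ (φ ^ᵣ k *ᵣ x)} {φ ^ᵣ k *ᵣ (φ ^ᵣ l *ᵣ y)}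
      (NN-* {φ ^ᵣ l} {φ ^ᵣ k *ᵣ x} (NN-φ^ l) p) (NN-* {φ ^ᵣ k} {φ ^ᵣ l *ᵣ y} (NN-φ^ k) q))
  where
  eq : φ ^ᵣ l *ᵣ (φ ^ᵣ k *ᵣ x) +ᵣ φ ^ᵣ k *ᵣ (φ ^ᵣ l *ᵣ y) ≡ φ ^ᵣ (k + l) *ᵣ (x +ᵣ y)
  eq = trans (solve 4 (λ a b x y → (b ⊗ (a ⊗ x) ⊕ a ⊗ (b ⊗ y)) ⊜ ((a ⊗ b) ⊗ (x ⊕ y))) refl (φ ^ᵣ k) (φ ^ᵣ l) x y)
    (cong (_*ᵣ (x +ᵣ y)) (sym (^-homo-* φ k l)))

Pos-* : ∀ {x y} → Pos x → Pos y → Pos (x *ᵣ y)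
Pos-* {x} {y} (k , p) (l , q) = k + l , subst NN eq (NN-* {φ ^ᵣ k *ᵣ x} {φ ^ᵣ l *ᵣ y} p q)
  where
  eq : φ ^ᵣ k *ᵣ x *ᵣ (φ ^ᵣ l *ᵣ y) ≡ φ ^ᵣ (k + l) *ᵣ (x *ᵣ y)
  eq = trans (solve 4 (λ a b x y → (a ⊗ x ⊗ (b ⊗ y)) ⊜ ((a ⊗ b) ⊗ (x ⊗ y))) refl (φ ^ᵣ k) (φ ^ᵣ l) x y)
    (cong (_*ᵣ (x *ᵣ y)) (sym (^-homo-* φ k l)))

NN⇒Pos : ∀ {x} → NN x → Pos x
NN⇒Pos {x} p = 0 , subst NN (sym (*-identityˡ x)) p

Pos-ι : ∀ n → Pos (ι n)
Pos-ι n = NN⇒Pos (ℤ.+≤+ z≤n , ℤ.+≤+ z≤n)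

Pos-φ : Pos φ
Pos-φ = NN⇒Pos (ℤ.+≤+ z≤n , ℤ.+≤+ z≤n)

Pos-ι*-cancel : ∀ n {x} → Pos (ι (suc n) *ᵣ x) → Pos x
Pos-ι*-cancel n {x} (k , p) = k , cancel (φ ^ᵣ k *ᵣ x)
    (subst NN (solve 3 (λ a b x → (a ⊗ (b ⊗ x)) ⊜ (b ⊗ (a ⊗ x))) refl (φ ^ᵣ k) (ι (suc n)) x) p)
  where
  lem₁ : ∀ c a b → c ℤ.* a ℤ.+ 0ℤ ℤ.* b ≡ c ℤ.* a
  lem₁ = solve-∀
  lem₂ : ∀ c a b → c ℤ.* b ℤ.+ 0ℤ ℤ.* a ℤ.+ 0ℤ ℤ.* b ≡ c ℤ.* b
  lem₂ = solve-∀
  div : ∀ {a} → 0ℤ ℤ.≤ + suc n ℤ.* a → 0ℤ ℤ.≤ a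
  div {a} q = ℤ.*-cancelˡ-≤-pos 0ℤ a (+ suc n) (subst (ℤ._≤ + suc n ℤ.* a) (sym (ℤ.*-zeroʳ (+ suc n))) q)
  cancel : ∀ y → NN (ι (suc n) *ᵣ y) → NN y
  cancel (mk a b) (q , r) = div (subst (0ℤ ℤ.≤_) (lem₁ (+ suc n) a b) q) , div (subst (0ℤ ℤ.≤_) (lem₂ (+ suc n) a b) r)

-- The order is not degenerate: φᵏ has nonnegative coordinates with sum at least 1, so a negative
-- integer multiple of it has a negative coordinate. Through this lemma inequalities between reals
-- become inequalities between integers again.
Pos-mk⇒≥0 : ∀ {z} → Pos (mk z 0ℤ) → 0ℤ ℤ.≤ z
Pos-mk⇒≥0 {+ _} _ = ℤ.+≤+ z≤n
Pos-mk⇒≥0 { -[1+ n ]} (k , p) = ⊥-elim (go (φ ^ᵣ k) (coordinate-sum k) (NN-φ^ k) p)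
  where
  coordinates : ℤφ → ℤ
  coordinates (mk a b) = a ℤ.+ b
  step : ∀ x → NN x → 1ℤ ℤ.≤ coordinates x → 1ℤ ℤ.≤ coordinates (φ *ᵣ x)
  step (mk a b) (_ , q) r = subst (1ℤ ℤ.≤_) (lem a b) (ℤ.+-mono-≤ r q)
    where
    lem : ∀ a b → a ℤ.+ b ℤ.+ b ≡ 0ℤ ℤ.* a ℤ.+ 1ℤ ℤ.* b ℤ.+ (0ℤ ℤ.* b ℤ.+ 1ℤ ℤ.* a ℤ.+ 1ℤ ℤ.* b)
    lem = solve-∀
  coordinate-sum : ∀ k → 1ℤ ℤ.≤ coordinates (φ ^ᵣ k)
  coordinate-sum zero = ℤ.+≤+ (s≤s z≤n)
  coordinate-sum (suc k) = step (φ ^ᵣ k) (NN-φ^ k) (coordinate-sum k)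
  go : ∀ x → 1ℤ ℤ.≤ coordinates x → NN x → NN (x *ᵣ mk -[1+ n ] 0ℤ) → ⊥
  go (mk (+ zero) (+ zero)) (ℤ.+≤+ ()) _ _
  go (mk (+ suc a) (+ b)) _ _ (q , _) = absurd (subst (0ℤ ℤ.≤_) (lem (+ suc a) (+ b) -[1+ n ]) q)
    where
    lem : ∀ a b c → a ℤ.* c ℤ.+ b ℤ.* 0ℤ ≡ a ℤ.* c
    lem = solve-∀
    absurd : 0ℤ ℤ.≤ + suc a ℤ.* -[1+ n ] → ⊥
    absurd ()
  go (mk (+ zero) (+ suc b)) _ _ (_ , q) = absurd (subst (0ℤ ℤ.≤_) (lem 0ℤ (+ suc b) -[1+ n ]) q)
    where
    lem : ∀ a b c → a ℤ.* 0ℤ ℤ.+ b ℤ.* c ℤ.+ b ℤ.* 0ℤ ≡ b ℤ.* c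
    lem = solve-∀
    absurd : 0ℤ ℤ.≤ + suc b ℤ.* -[1+ n ] → ⊥
    absurd ()

infix 4 _≼_

record _≼_ (x y : ℤφ) : Set where
  constructor ≼⁺
  field
    ≼⁻ : Pos (y -ᵣ x)
open _≼_

≼-refl : ∀ {x} → x ≼ x
≼-refl {x} = ≼⁺ (subst Pos (solve 1 (λ x → Κ 0ᵣ ⊜ (x ⊕ ⊝ x)) refl x) (Pos-ι 0))

≼-reflexive : ∀ {x y} → x ≡ y → x ≼ y
≼-reflexive refl = ≼-refl

≼-trans : ∀ {x y z} → x ≼ y → y ≼ z → x ≼ z
≼-trans {x} {y} {z} (≼⁺ p) (≼⁺ q) = ≼⁺ (subst Pos
  (solve 3 (λ x y z → ((y ⊕ ⊝ x) ⊕ (z ⊕ ⊝ y)) ⊜ (z ⊕ ⊝ x)) refl x y z) (Pos-+ p q))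

+-mono-≼ : ∀ {x y z w} → x ≼ y → z ≼ w → x +ᵣ z ≼ y +ᵣ w
+-mono-≼ {x} {y} {z} {w} (≼⁺ p) (≼⁺ q) = ≼⁺ (subst Pos
  (solve 4 (λ x y z w → ((y ⊕ ⊝ x) ⊕ (w ⊕ ⊝ z)) ⊜ ((y ⊕ w) ⊕ ⊝ (x ⊕ z))) refl x y z w) (Pos-+ p q))

Pos⇒≼ : ∀ {x} → Pos x → 0ᵣ ≼ x
Pos⇒≼ {x} p = ≼⁺ (subst Pos (solve 1 (λ x → x ⊜ (x ⊕ ⊝ Κ 0ᵣ)) refl x) p)

≼⇒Pos : ∀ {x} → 0ᵣ ≼ x → Pos x
≼⇒Pos {x} (≼⁺ p) = subst Pos (solve 1 (λ x → (x ⊕ ⊝ Κ 0ᵣ) ⊜ x) refl x) p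

Pos-mono : ∀ {x y} → Pos x → x ≼ y → Pos y
Pos-mono p q = ≼⇒Pos (≼-trans (Pos⇒≼ p) q)

*-monoˡ-≼ : ∀ {x y z} → Pos z → x ≼ y → z *ᵣ x ≼ z *ᵣ y
*-monoˡ-≼ {x} {y} {z} p (≼⁺ q) = ≼⁺ (subst Pos
  (solve 3 (λ x y z → (z ⊗ (y ⊕ ⊝ x)) ⊜ (z ⊗ y ⊕ ⊝ (z ⊗ x))) refl x y z) (Pos-* p q))

*-monoʳ-≼ : ∀ {x y z} → Pos z → x ≼ y → x *ᵣ z ≼ y *ᵣ z
*-monoʳ-≼ {x} {y} {z} p (≼⁺ q) = ≼⁺ (subst Pos
  (solve 3 (λ x y z → (z ⊗ (y ⊕ ⊝ x)) ⊜ (y ⊗ z ⊕ ⊝ (x ⊗ z))) refl x y z) (Pos-* p q))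

*-mono-≼ : ∀ {x y z w} → Pos x → Pos z → x ≼ y → z ≼ w → x *ᵣ z ≼ y *ᵣ w
*-mono-≼ px pz p q = ≼-trans (*-monoˡ-≼ px q) (*-monoʳ-≼ (Pos-mono pz q) p)

ι-mono : ∀ {m n} → m ≤ n → ι m ≼ ι n
ι-mono {m} {n} m≤n with k , refl ← ℕ.m≤n⇒∃[o]m+o≡n m≤n = ≼⁺ (subst Pos
  (solve 2 (λ x y → y ⊜ ((x ⊕ y) ⊕ ⊝ x)) refl (ι m) (ι k)) (Pos-ι k))

ι-cancel-≼ : ∀ {m n} → ι m ≼ ι n → m ≤ n
ι-cancel-≼ {m} {n} (≼⁺ p) = ℤ.drop‿+≤+ (ℤ.0≤i-j⇒j≤i (Pos-mk⇒≥0 p))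

ι*-cancel-≼ : ∀ n {x y} → ι (suc n) *ᵣ x ≼ ι (suc n) *ᵣ y → x ≼ y
ι*-cancel-≼ n {x} {y} (≼⁺ p) = ≼⁺ (Pos-ι*-cancel n (subst Pos
  (solve 3 (λ x y z → (z ⊗ y ⊕ ⊝ (z ⊗ x)) ⊜ (z ⊗ (y ⊕ ⊝ x))) refl x y (ι (suc n))) p))

Pos-^ : ∀ {x} n → Pos x → Pos (x ^ᵣ n)
Pos-^ zero p = Pos-ι 1
Pos-^ (suc n) p = Pos-* p (Pos-^ n p)

^-mono-≼ : ∀ {x y} n → Pos x → x ≼ y → x ^ᵣ n ≼ y ^ᵣ n
^-mono-≼ zero p q = ≼-refl
^-mono-≼ (suc n) p q = *-mono-≼ p (Pos-^ n p) q (^-mono-≼ n p q)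

-- ∣ x ∣ ≤ b
record Bd (x b : ℤφ) : Set where
  constructor bd
  field
    below : Pos (b -ᵣ x)
    above : Pos (b +ᵣ x)

Bd⇒Pos : ∀ {x b} → Bd x b → Pos b
Bd⇒Pos {x} {b} (bd p q) = Pos-ι*-cancel 1 (subst Pos
  (solve 2 (λ x b → ((b ⊕ ⊝ x) ⊕ (b ⊕ x)) ⊜ (Κ (ι 2) ⊗ b)) refl x b) (Pos-+ p q))

Bd-+ : ∀ {x y b c} → Bd x b → Bd y c → Bd (x +ᵣ y) (b +ᵣ c)
Bd-+ {x} {y} {b} {c} (bd p q) (bd r s) = bd
  (subst Pos (solve 4 (λ x y b c → ((b ⊕ ⊝ x) ⊕ (c ⊕ ⊝ y)) ⊜ ((b ⊕ c) ⊕ ⊝ (x ⊕ y))) refl x y b c) (Pos-+ p r))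
  (subst Pos (solve 4 (λ x y b c → ((b ⊕ x) ⊕ (c ⊕ y)) ⊜ ((b ⊕ c) ⊕ (x ⊕ y))) refl x y b c) (Pos-+ q s))

Bd-neg : ∀ {x b} → Bd x b → Bd (-ᵣ x) b
Bd-neg {x} {b} (bd p q) = bd (subst Pos (solve 2 (λ x b → (b ⊕ x) ⊜ (b ⊕ ⊝ (⊝ x))) refl x b) q) p

-- No distinction of signs is needed: 2 (b c - x y) = (b - x)(c + y) + (b + x)(c - y) and 2 (b c + x
-- y) = (b - x)(c - y) + (b + x)(c + y) are sums of products of nonnegative factors.
Bd-* : ∀ {x y b c} → Bd x b → Bd y c → Bd (x *ᵣ y) (b *ᵣ c)
Bd-* {x} {y} {b} {c} (bd p q) (bd r s) = bd
  (Pos-ι*-cancel 1 (subst Pos (solve 4 (λ x y b c →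
     ((b ⊕ ⊝ x) ⊗ (c ⊕ y) ⊕ (b ⊕ x) ⊗ (c ⊕ ⊝ y)) ⊜ (Κ (ι 2) ⊗ (b ⊗ c ⊕ ⊝ (x ⊗ y)))) refl x y b c)
     (Pos-+ (Pos-* p s) (Pos-* q r))))
  (Pos-ι*-cancel 1 (subst Pos (solve 4 (λ x y b c →
     ((b ⊕ ⊝ x) ⊗ (c ⊕ ⊝ y) ⊕ (b ⊕ x) ⊗ (c ⊕ y)) ⊜ (Κ (ι 2) ⊗ (b ⊗ c ⊕ x ⊗ y))) refl x y b c)
     (Pos-+ (Pos-* p r) (Pos-* q s))))

Bd-mono : ∀ {x b c} → Bd x b → b ≼ c → Bd x c
Bd-mono {x} {b} {c} (bd p q) (≼⁺ r) = bd
  (subst Pos (solve 3 (λ x b c → ((b ⊕ ⊝ x) ⊕ (c ⊕ ⊝ b)) ⊜ (c ⊕ ⊝ x)) refl x b c) (Pos-+ p r))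
  (subst Pos (solve 3 (λ x b c → ((b ⊕ x) ⊕ (c ⊕ ⊝ b)) ⊜ (c ⊕ x)) refl x b c) (Pos-+ q r))

Pos⇒Bd : ∀ {x} → Pos x → Bd x x
Pos⇒Bd {x} p = bd (≼⁻ ≼-refl) (Pos-+ p p)

Bd-^ : ∀ {x b} n → Bd x b → Bd (x ^ᵣ n) (b ^ᵣ n)
Bd-^ zero p = Pos⇒Bd (Pos-ι 1)
Bd-^ (suc n) p = Bd-* p (Bd-^ n p)

-- The norm form, integrality and the domain property

private
  odd≢0 : ∀ k → + 2 ℤ.* k ≢ 1ℤ
  odd≢0 k eq with ℤ.∣ k ∣ | trans (sym (ℤ.abs-* (+ 2) k)) (cong ℤ.∣_∣ eq)
  ... | zero | ()
  ... | suc m | e with trans (sym (+-suc m (m + 0))) (suc-injective e)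
  ...   | ()

  -- The prime 2 is inert in ℤ[φ]: the form a² + a b - b² is odd unless both a and b are even.
  halve : ∀ a b → a ℤ.* a ℤ.+ a ℤ.* b ℤ.- b ℤ.* b ≡ 0ℤ →
    Σ ℤ λ a′ → Σ ℤ λ b′ → a ≡ + 2 ℤ.* a′ × b ≡ + 2 ℤ.* b′
  halve a b eq with a ℤ.% + 2 | b ℤ.% + 2 | ℤ.n%d<d a (+ 2) | ℤ.n%d<d b (+ 2) | ℤ.a≡a%n+[a/n]*n a (+ 2) | ℤ.a≡a%n+[a/n]*n b (+ 2)
  ... | 0 | 0 | _ | _ | p | q = a ℤ./ + 2 , b ℤ./ + 2 , trans p (lem (a ℤ./ + 2)) , trans q (lem (b ℤ./ + 2))
    where
    lem : ∀ x → 0ℤ ℤ.+ x ℤ.* + 2 ≡ + 2 ℤ.* x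
    lem = solve-∀
  ... | 1 | 0 | _ | _ | p | q = ⊥-elim (odd≢0 _ (trans (sym (lem (a ℤ./ + 2) (b ℤ./ + 2)))
          (cong (λ z → 1ℤ ℤ.- z) (trans (sym (cong₂ (λ a b → a ℤ.* a ℤ.+ a ℤ.* b ℤ.- b ℤ.* b) p q)) eq))))
    where
    lem : ∀ x y → 1ℤ ℤ.- ((1ℤ ℤ.+ x ℤ.* + 2) ℤ.* (1ℤ ℤ.+ x ℤ.* + 2) ℤ.+ (1ℤ ℤ.+ x ℤ.* + 2) ℤ.* (0ℤ ℤ.+ y ℤ.* + 2) ℤ.- (0ℤ ℤ.+ y ℤ.* + 2) ℤ.* (0ℤ ℤ.+ y ℤ.* + 2))
      ≡ + 2 ℤ.* (+ 2 ℤ.* (y ℤ.* y ℤ.- x ℤ.* x ℤ.- x ℤ.- x ℤ.* y) ℤ.- y)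
    lem = solve-∀
  ... | 0 | 1 | _ | _ | p | q = ⊥-elim (odd≢0 _ (trans (sym (lem (a ℤ./ + 2) (b ℤ./ + 2)))
          (cong (λ z → 1ℤ ℤ.+ z) (trans (sym (cong₂ (λ a b → a ℤ.* a ℤ.+ a ℤ.* b ℤ.- b ℤ.* b) p q)) eq))))
    where
    lem : ∀ x y → 1ℤ ℤ.+ ((0ℤ ℤ.+ x ℤ.* + 2) ℤ.* (0ℤ ℤ.+ x ℤ.* + 2) ℤ.+ (0ℤ ℤ.+ x ℤ.* + 2) ℤ.* (1ℤ ℤ.+ y ℤ.* + 2) ℤ.- (1ℤ ℤ.+ y ℤ.* + 2) ℤ.* (1ℤ ℤ.+ y ℤ.* + 2))
      ≡ + 2 ℤ.* (+ 2 ℤ.* (x ℤ.* x ℤ.+ x ℤ.* y ℤ.- y ℤ.* y ℤ.- y) ℤ.+ x)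
    lem = solve-∀
  ... | 1 | 1 | _ | _ | p | q = ⊥-elim (odd≢0 _ (trans (sym (lem (a ℤ./ + 2) (b ℤ./ + 2)))
          (cong (λ z → 1ℤ ℤ.- z) (trans (sym (cong₂ (λ a b → a ℤ.* a ℤ.+ a ℤ.* b ℤ.- b ℤ.* b) p q)) eq))))
    where
    lem : ∀ x y → 1ℤ ℤ.- ((1ℤ ℤ.+ x ℤ.* + 2) ℤ.* (1ℤ ℤ.+ x ℤ.* + 2) ℤ.+ (1ℤ ℤ.+ x ℤ.* + 2) ℤ.* (1ℤ ℤ.+ y ℤ.* + 2) ℤ.- (1ℤ ℤ.+ y ℤ.* + 2) ℤ.* (1ℤ ℤ.+ y ℤ.* + 2))
      ≡ + 2 ℤ.* (+ 2 ℤ.* (y ℤ.* y ℤ.- x ℤ.* x ℤ.- x ℤ.- x ℤ.* y) ℤ.+ y ℤ.- x)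
    lem = solve-∀
  ... | suc (suc _) | _ | s≤s (s≤s ()) | _ | _ | _
  ... | 0 | suc (suc _) | _ | s≤s (s≤s ()) | _ | _
  ... | 1 | suc (suc _) | _ | s≤s (s≤s ()) | _ | _

  -- Infinite descent: a zero of the norm form has even coordinates, and its half is again a zero.
  -- The number `n` is the measure of the descent.
  norm≡0⇒≡0 : ∀ n a b → ℤ.∣ a ∣ + ℤ.∣ b ∣ ≤ n → a ℤ.* a ℤ.+ a ℤ.* b ℤ.- b ℤ.* b ≡ 0ℤ → mk a b ≡ 0ᵣ
  norm≡0⇒≡0 zero a b le _ = cong₂ mk
    (ℤ.∣i∣≡0⇒i≡0 (ℕ.m+n≡0⇒m≡0 _ (ℕ.n≤0⇒n≡0 le)))
    (ℤ.∣i∣≡0⇒i≡0 (ℕ.m+n≡0⇒n≡0 ℤ.∣ a ∣ (ℕ.n≤0⇒n≡0 le)))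
  norm≡0⇒≡0 (suc n) a b le eq with halve a b eq
  ... | a′ , b′ , refl , refl with norm≡0⇒≡0 n a′ b′ smaller quarter
    where
    smaller : ℤ.∣ a′ ∣ + ℤ.∣ b′ ∣ ≤ n
    smaller with ℤ.∣ a′ ∣ + ℤ.∣ b′ ∣ in e
    ... | zero = z≤n
    ... | suc s = ≤-trans (s≤s (m≤n+m s s)) (≤-pred (subst (_≤ suc n) twice le))
      where
      twice : ℤ.∣ + 2 ℤ.* a′ ∣ + ℤ.∣ + 2 ℤ.* b′ ∣ ≡ suc (suc (s + s))
      twice = trans (cong₂ ℕ._+_ (ℤ.abs-* (+ 2) a′) (ℤ.abs-* (+ 2) b′))
        (trans (sym (*-distribˡ-+ 2 ℤ.∣ a′ ∣ ℤ.∣ b′ ∣)) (trans (cong (2 ℕ.*_) e)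
          (cong suc (trans (+-suc s (s + 0)) (cong (λ z → suc (s + z)) (ℕ.+-identityʳ s))))))
    quarter : a′ ℤ.* a′ ℤ.+ a′ ℤ.* b′ ℤ.- b′ ℤ.* b′ ≡ 0ℤ
    quarter = ℤ.*-cancelˡ-≡ (+ 4) _ 0ℤ (trans (lem a′ b′) eq)
      where
      lem : ∀ x y → + 4 ℤ.* (x ℤ.* x ℤ.+ x ℤ.* y ℤ.- y ℤ.* y)
        ≡ + 2 ℤ.* x ℤ.* (+ 2 ℤ.* x) ℤ.+ + 2 ℤ.* x ℤ.* (+ 2 ℤ.* y) ℤ.- + 2 ℤ.* y ℤ.* (+ 2 ℤ.* y)
      lem = solve-∀
  ... | refl = refl

norm : ℤφ → ℤ
norm (mk a b) = a ℤ.* a ℤ.+ a ℤ.* b ℤ.- b ℤ.* b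

x*conj-x : ∀ x → x *ᵣ conj x ≡ mk (norm x) 0ℤ
x*conj-x (mk a b) = cong₂ mk (lem₁ a b) (lem₂ a b)
  where
  lem₁ : ∀ a b → a ℤ.* (a ℤ.+ b) ℤ.+ b ℤ.* ℤ.- b ≡ a ℤ.* a ℤ.+ a ℤ.* b ℤ.- b ℤ.* b
  lem₁ = solve-∀
  lem₂ : ∀ a b → a ℤ.* ℤ.- b ℤ.+ b ℤ.* (a ℤ.+ b) ℤ.+ b ℤ.* ℤ.- b ≡ 0ℤ
  lem₂ = solve-∀

norm-* : ∀ x y → norm (x *ᵣ y) ≡ norm x ℤ.* norm y
norm-* (mk a b) (mk c d) = lem a b c d
  where
  lem : ∀ a b c d → let e = a ℤ.* c ℤ.+ b ℤ.* d ; f = a ℤ.* d ℤ.+ b ℤ.* c ℤ.+ b ℤ.* d in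
    e ℤ.* e ℤ.+ e ℤ.* f ℤ.- f ℤ.* f
    ≡ (a ℤ.* a ℤ.+ a ℤ.* b ℤ.- b ℤ.* b) ℤ.* (c ℤ.* c ℤ.+ c ℤ.* d ℤ.- d ℤ.* d)
  lem = solve-∀

norm-zero : ∀ x → norm x ≡ 0ℤ → x ≡ 0ᵣ
norm-zero (mk a b) = norm≡0⇒≡0 _ a b ≤-refl

*ᵣ-domain : ∀ x y → x *ᵣ y ≡ 0ᵣ → x ≡ 0ᵣ ⊎ y ≡ 0ᵣ
*ᵣ-domain x y eq with ℤ.i*j≡0⇒i≡0∨j≡0 (norm x) (trans (sym (norm-* x y)) (cong norm eq))
... | inj₁ p = inj₁ (norm-zero x p)
... | inj₂ p = inj₂ (norm-zero y p)

-- Liouville's inequality: a nonzero element has ∣norm∣ ≥ 1.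
liouville : ∀ {x} M W₁ W₂ → Bd (ι M *ᵣ x) (ι W₁) → Bd (conj x) (ι W₂) → W₁ * W₂ < M → x ≡ 0ᵣ
liouville {x} M W₁ W₂ p q lt = norm-zero x (conclude (norm x) nonneg₁ nonneg₂)
  where
  prod : Bd (mk (+ M ℤ.* norm x) 0ℤ) (ι (W₁ * W₂))
  prod = subst₂′ eq (sym (ι-* W₁ W₂)) (Bd-* p q)
    where
    subst₂′ : ∀ {x y b c} → x ≡ y → b ≡ c → Bd x b → Bd y c
    subst₂′ refl refl p = p
    lem₁ : ∀ m n → m ℤ.* n ℤ.+ 0ℤ ℤ.* 0ℤ ≡ m ℤ.* n
    lem₁ = solve-∀
    lem₂ : ∀ m n → m ℤ.* 0ℤ ℤ.+ 0ℤ ℤ.* n ℤ.+ 0ℤ ℤ.* 0ℤ ≡ 0ℤ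
    lem₂ = solve-∀
    eq : ι M *ᵣ x *ᵣ conj x ≡ mk (+ M ℤ.* norm x) 0ℤ
    eq = trans (*-assoc (ι M) x (conj x)) (trans (cong (ι M *ᵣ_) (x*conj-x x))
      (cong₂ mk (lem₁ (+ M) (norm x)) (lem₂ (+ M) (norm x))))
  nonneg₁ : 0ℤ ℤ.≤ + (W₁ * W₂) ℤ.- + M ℤ.* norm x
  nonneg₁ = Pos-mk⇒≥0 (Bd.below prod)
  nonneg₂ : 0ℤ ℤ.≤ + (W₁ * W₂) ℤ.+ + M ℤ.* norm x
  nonneg₂ = Pos-mk⇒≥0 (Bd.above prod)
  small : ∀ n → + M ℤ.* + suc n ℤ.≤ + (W₁ * W₂) → ⊥
  small n le = <-irrefl refl (<-≤-trans lt (≤-trans (m≤m*n M (suc n))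
    (ℤ.drop‿+≤+ (subst (ℤ._≤ + (W₁ * W₂)) (sym (ℤ.pos-* M (suc n))) le))))
  conclude : ∀ n → 0ℤ ℤ.≤ + (W₁ * W₂) ℤ.- + M ℤ.* n → 0ℤ ℤ.≤ + (W₁ * W₂) ℤ.+ + M ℤ.* n → n ≡ 0ℤ
  conclude (+ zero) _ _ = refl
  conclude (+ suc n) r _ = ⊥-elim (small n (ℤ.0≤i-j⇒j≤i r))
  conclude -[1+ n ] _ r = ⊥-elim (small n (ℤ.0≤i-j⇒j≤i (subst (0ℤ ℤ.≤_) (lem (+ M) (+ suc n) (+ (W₁ * W₂))) r)))
    where
    lem : ∀ m n w → w ℤ.+ m ℤ.* ℤ.- n ≡ w ℤ.- m ℤ.* n
    lem = solve-∀

-- Finite sums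

∑ : ℕ → (ℕ → ℤφ) → ℤφ
∑ zero f = 0ᵣ
∑ (suc n) f = f 0 +ᵣ ∑ n (f ∘ suc)

∑-cong : ∀ n {f g} → (∀ i → i < n → f i ≡ g i) → ∑ n f ≡ ∑ n g
∑-cong zero eq = refl
∑-cong (suc n) eq = cong₂ _+ᵣ_ (eq 0 (s≤s z≤n)) (∑-cong n λ i lt → eq (suc i) (s≤s lt))

∑-zero : ∀ n {f} → (∀ i → i < n → f i ≡ 0ᵣ) → ∑ n f ≡ 0ᵣ
∑-zero zero eq = refl
∑-zero (suc n) eq = trans (cong₂ _+ᵣ_ (eq 0 (s≤s z≤n)) (∑-zero n λ i lt → eq (suc i) (s≤s lt))) (+-identityˡ 0ᵣ)

∑-+ : ∀ n f g → ∑ n (λ i → f i +ᵣ g i) ≡ ∑ n f +ᵣ ∑ n g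
∑-+ zero f g = refl
∑-+ (suc n) f g = trans (cong (f 0 +ᵣ g 0 +ᵣ_) (∑-+ n (f ∘ suc) (g ∘ suc)))
  (solve 4 (λ a b c d → ((a ⊕ b) ⊕ (c ⊕ d)) ⊜ ((a ⊕ c) ⊕ (b ⊕ d))) refl (f 0) (g 0) (∑ n (f ∘ suc)) (∑ n (g ∘ suc)))

∑-*ˡ : ∀ n c f → ∑ n (λ i → c *ᵣ f i) ≡ c *ᵣ ∑ n f
∑-*ˡ zero c f = sym (zeroʳ c)
∑-*ˡ (suc n) c f = trans (cong (c *ᵣ f 0 +ᵣ_) (∑-*ˡ n c (f ∘ suc))) (sym (distribˡ c _ _))

∑-swap : ∀ m n (f : ℕ → ℕ → ℤφ) → ∑ m (λ i → ∑ n (f i)) ≡ ∑ n (λ j → ∑ m (λ i → f i j))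
∑-swap zero n f = sym (∑-zero n λ _ _ → refl)
∑-swap (suc m) n f = trans (cong (∑ n (f 0) +ᵣ_) (∑-swap m n (f ∘ suc))) (sym (∑-+ n (f 0) _))

∑-last : ∀ n f → ∑ (suc n) f ≡ ∑ n f +ᵣ f n
∑-last zero f = +-comm (f 0) 0ᵣ
∑-last (suc n) f = trans (cong (f 0 +ᵣ_) (∑-last n (f ∘ suc))) (sym (+-assoc (f 0) _ _))

∑-drop : ∀ n f → f n ≡ 0ᵣ → ∑ (suc n) f ≡ ∑ n f
∑-drop n f eq = trans (∑-last n f) (trans (cong (∑ n f +ᵣ_) eq) (+-identityʳ _))

∑-Bd : ∀ n {f b} → (∀ i → i < n → Bd (f i) b) → Bd (∑ n f) (ι n *ᵣ b)
∑-Bd zero {f} {b} _ = subst (Bd 0ᵣ) (sym (zeroˡ b)) (Pos⇒Bd (Pos-ι 0))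
∑-Bd (suc n) {f} {b} p = subst (Bd _) (solve 2 (λ n b → (b ⊕ n ⊗ b) ⊜ ((Κ (ι 1) ⊕ n) ⊗ b)) refl (ι n) b)
  (Bd-+ (p 0 (s≤s z≤n)) (∑-Bd n λ i lt → p (suc i) (s≤s lt)))

<-split : ∀ {P : ℕ → Set} n → P n → (∀ k → k < n → P k) → ∀ k → k < suc n → P k
<-split n pn p k lt with ℕ.m<1+n⇒m<n∨m≡n lt
... | inj₁ k<n = p k k<n
... | inj₂ refl = pn

*ᵣ-cancel-0 : ∀ {x} y → x ≢ 0ᵣ → x *ᵣ y ≡ 0ᵣ → y ≡ 0ᵣ
*ᵣ-cancel-0 {x} y x≢0 eq with *ᵣ-domain x y eq
... | inj₁ x≡0 = ⊥-elim (x≢0 x≡0)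
... | inj₂ y≡0 = y≡0

*ᵣ-≢0 : ∀ {x y} → x ≢ 0ᵣ → y ≢ 0ᵣ → x *ᵣ y ≢ 0ᵣ
*ᵣ-≢0 x≢0 y≢0 = y≢0 ∘ *ᵣ-cancel-0 _ x≢0

^ᵣ-≢0 : ∀ {x} n → x ≢ 0ᵣ → x ^ᵣ n ≢ 0ᵣ
^ᵣ-≢0 zero _ ()
^ᵣ-≢0 (suc n) x≢0 = *ᵣ-≢0 x≢0 (^ᵣ-≢0 n x≢0)

x-y≡0⇒x≡y : ∀ {x y} → x -ᵣ y ≡ 0ᵣ → x ≡ y
x-y≡0⇒x≡y {x} {y} eq = trans (solve 2 (λ x y → x ⊜ ((x ⊕ ⊝ y) ⊕ y)) refl x y)
  (trans (cong (_+ᵣ y) eq) (+-identityˡ y))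

x≡y⇒x-y≡0 : ∀ {x y} → x ≡ y → x -ᵣ y ≡ 0ᵣ
x≡y⇒x-y≡0 {x} refl = solve 1 (λ x → (x ⊕ ⊝ x) ⊜ Κ 0ᵣ) refl x

ι-injective : ∀ {m n} → ι m ≡ ι n → m ≡ n
ι-injective eq = ℤ.+-injective (proj₁ (mk-injective eq))

-- Row rank equals column rank

module _ {Pt : Set} (origin : Pt) (In : Pt → Set)
  (search : (f : Pt → ℤφ) → (Σ Pt λ c → In c × f c ≢ 0ᵣ) ⊎ (∀ c → In c → f c ≡ 0ᵣ)) where

  Independent : ℕ → (ℕ → Pt → ℤφ) → Set
  Independent M f = ∀ (w : ℕ → ℤφ) → (∀ c → In c → ∑ M (λ k → w k *ᵣ f k c) ≡ 0ᵣ) → ∀ k → k < M → w k ≡ 0ᵣ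

  Nonsingular : ℕ → (ℕ → Pt → ℤφ) → (ℕ → Pt) → Set
  Nonsingular M f c = ∀ (p : ℕ → ℤφ) → (∀ k → k < M → ∑ M (λ i → p i *ᵣ f k (c i)) ≡ 0ᵣ) → ∀ i → i < M → p i ≡ 0ᵣ

  -- One step of fraction-free Gaussian elimination with pivot `f 0 c₀`: cross-multiplication clears
  -- column `c₀` from the remaining rows without division.
  eliminate : (ℕ → Pt → ℤφ) → Pt → ℕ → Pt → ℤφ
  eliminate f c₀ k c = f 0 c₀ *ᵣ f (suc k) c -ᵣ f (suc k) c₀ *ᵣ f 0 c

  eliminate-independent : ∀ M f c₀ → f 0 c₀ ≢ 0ᵣ → Independent (suc M) f → Independent M (eliminate f c₀)
  eliminate-independent M f c₀ f0≢0 indep w kernel k k<M =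
    *ᵣ-cancel-0 (w k) f0≢0 (trans (*-comm _ _) (indep w′ kernel′ (suc k) (s≤s k<M)))
    where
    S : ℤφ
    S = ∑ M (λ k → w k *ᵣ f (suc k) c₀)
    -- A relation between the reduced rows lifts to the original rows; the coefficient -S of row 0
    -- collects everything that the elimination subtracted.
    w′ : ℕ → ℤφ
    w′ zero = -ᵣ S
    w′ (suc k) = w k *ᵣ f 0 c₀
    kernel′ : ∀ c → In c → ∑ (suc M) (λ k → w′ k *ᵣ f k c) ≡ 0ᵣ
    kernel′ c c∈ = begin
      -ᵣ S *ᵣ f 0 c +ᵣ A
        ≡⟨ solve 3 (λ s a b → (⊝ s ⊗ a ⊕ b) ⊜ (b ⊕ ⊝ a ⊗ s)) refl S (f 0 c) A ⟩
      A +ᵣ -ᵣ f 0 c *ᵣ S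
        ≡⟨ cong (A +ᵣ_) (sym (∑-*ˡ M (-ᵣ f 0 c) _)) ⟩
      A +ᵣ ∑ M (λ k → -ᵣ f 0 c *ᵣ (w k *ᵣ f (suc k) c₀))
        ≡⟨ sym (∑-+ M _ _) ⟩
      ∑ M (λ k → w k *ᵣ f 0 c₀ *ᵣ f (suc k) c +ᵣ -ᵣ f 0 c *ᵣ (w k *ᵣ f (suc k) c₀))
        ≡⟨ ∑-cong M (λ k _ → solve 5 (λ w a b c d →
             (w ⊗ a ⊗ b ⊕ ⊝ c ⊗ (w ⊗ d)) ⊜ (w ⊗ (a ⊗ b ⊕ ⊝ (d ⊗ c)))) refl
             (w k) (f 0 c₀) (f (suc k) c) (f 0 c) (f (suc k) c₀)) ⟩
      ∑ M (λ k → w k *ᵣ eliminate f c₀ k c) ≡⟨ kernel c c∈ ⟩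
      0ᵣ ∎
      where
      open ≡-Reasoning
      A : ℤφ
      A = ∑ M (λ k → w k *ᵣ f 0 c₀ *ᵣ f (suc k) c)

  prepend : Pt → (ℕ → Pt) → ℕ → Pt
  prepend c₀ c zero = c₀
  prepend c₀ c (suc i) = c i

  prepend-nonsingular : ∀ M f c₀ c → f 0 c₀ ≢ 0ᵣ → Nonsingular M (eliminate f c₀) c → Nonsingular (suc M) f (prepend c₀ c)
  prepend-nonsingular M f c₀ c f0≢0 nonsing p kernel = conclude
    where
    T : ℕ → ℤφ
    T k = ∑ M (λ i → p (suc i) *ᵣ f k (c i))
    T≡ : ∀ k → k < suc M → T k ≡ -ᵣ (p 0 *ᵣ f k c₀)
    T≡ k lt = trans (solve 2 (λ a b → b ⊜ (⊝ a ⊕ (a ⊕ b))) refl (p 0 *ᵣ f k c₀) (T k))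
      (trans (cong (-ᵣ (p 0 *ᵣ f k c₀) +ᵣ_) (kernel k lt)) (+-identityʳ _))
    tail≡0 : ∀ i → i < M → p (suc i) ≡ 0ᵣ
    tail≡0 = nonsing (p ∘ suc) λ k lt → begin
      ∑ M (λ i → p (suc i) *ᵣ (f 0 c₀ *ᵣ f (suc k) (c i) -ᵣ f (suc k) c₀ *ᵣ f 0 (c i)))
        ≡⟨ ∑-cong M (λ i _ → solve 5 (λ p a b c d → (p ⊗ (a ⊗ b ⊕ ⊝ (c ⊗ d))) ⊜ (a ⊗ (p ⊗ b) ⊕ ⊝ c ⊗ (p ⊗ d)))
             refl (p (suc i)) (f 0 c₀) (f (suc k) (c i)) (f (suc k) c₀) (f 0 (c i))) ⟩
      ∑ M (λ i → f 0 c₀ *ᵣ (p (suc i) *ᵣ f (suc k) (c i)) +ᵣ -ᵣ f (suc k) c₀ *ᵣ (p (suc i) *ᵣ f 0 (c i)))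
        ≡⟨ trans (∑-+ M _ _) (cong₂ _+ᵣ_ (∑-*ˡ M _ _) (∑-*ˡ M _ _)) ⟩
      f 0 c₀ *ᵣ T (suc k) +ᵣ -ᵣ f (suc k) c₀ *ᵣ T 0
        ≡⟨ cong₂ (λ a b → f 0 c₀ *ᵣ a +ᵣ -ᵣ f (suc k) c₀ *ᵣ b) (T≡ (suc k) (s≤s lt)) (T≡ 0 (s≤s z≤n)) ⟩
      f 0 c₀ *ᵣ -ᵣ (p 0 *ᵣ f (suc k) c₀) +ᵣ -ᵣ f (suc k) c₀ *ᵣ -ᵣ (p 0 *ᵣ f 0 c₀)
        ≡⟨ solve 3 (λ p a b → (a ⊗ ⊝ (p ⊗ b) ⊕ ⊝ b ⊗ ⊝ (p ⊗ a)) ⊜ Κ 0ᵣ) refl (p 0) (f 0 c₀) (f (suc k) c₀) ⟩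
      0ᵣ ∎
      where open ≡-Reasoning
    conclude : ∀ i → i < suc M → p i ≡ 0ᵣ
    conclude zero _ = *ᵣ-cancel-0 (p 0) f0≢0 (trans (*-comm _ _) (trans (sym (+-identityʳ _))
      (trans (cong (p 0 *ᵣ f 0 c₀ +ᵣ_) (sym (∑-zero M λ i lt → trans (cong (_*ᵣ f 0 (c i)) (tail≡0 i lt)) (zeroˡ _))))
        (kernel 0 (s≤s z≤n)))))
    conclude (suc i) (s≤s lt) = tail≡0 i lt

  row≢0 : ∀ M f → Independent (suc M) f → ¬ (∀ c → In c → f 0 c ≡ 0ᵣ)
  row≢0 M f indep f0≡0 = 1≢0 (indep δ δ-kernel 0 (s≤s z≤n))
    where
    1≢0 : 1ᵣ ≢ 0ᵣ
    1≢0 ()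
    δ : ℕ → ℤφ
    δ zero = 1ᵣ
    δ (suc _) = 0ᵣ
    δ-kernel : ∀ c → In c → ∑ (suc M) (λ k → δ k *ᵣ f k c) ≡ 0ᵣ
    δ-kernel c c∈ = trans (cong₂ _+ᵣ_ (trans (*-identityˡ _) (f0≡0 c c∈)) (∑-zero M λ _ _ → zeroˡ _)) (+-identityˡ 0ᵣ)

  -- Gaussian elimination. Independence excludes a zero first row, so `search` produces a pivot
  -- column; the reduced rows are still independent, and a nonsingular choice of columns for them is
  -- extended by the pivot column.
  nonsingular-columns : ∀ M f → Independent M f →
    Σ (ℕ → Pt) λ c → (∀ i → i < M → In (c i)) × Nonsingular M f c
  nonsingular-columns zero f _ = (λ _ → origin) , (λ _ ()) , (λ _ _ _ ())
  nonsingular-columns (suc M) f indep = pivot (search (f 0))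
    where
    pivot : (Σ Pt λ c → In c × f 0 c ≢ 0ᵣ) ⊎ (∀ c → In c → f 0 c ≡ 0ᵣ) →
      Σ (ℕ → Pt) λ c → (∀ i → i < suc M → In (c i)) × Nonsingular (suc M) f c
    pivot (inj₂ f0≡0) = ⊥-elim (row≢0 M f indep f0≡0)
    pivot (inj₁ (c₀ , c₀∈ , f0≢0)) = extend (nonsingular-columns M (eliminate f c₀) (eliminate-independent M f c₀ f0≢0 indep))
      where
      extend : (Σ (ℕ → Pt) λ c → (∀ i → i < M → In (c i)) × Nonsingular M (eliminate f c₀) c) →
        Σ (ℕ → Pt) λ c → (∀ i → i < suc M → In (c i)) × Nonsingular (suc M) f c
      extend (c , c∈ , nonsing) = prepend c₀ c ,
        (λ { zero _ → c₀∈ ; (suc i) (s≤s lt) → c∈ i lt }) , prepend-nonsingular M f c₀ c f0≢0 nonsing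

-- Polynomial functions ℕ → ℤ[φ]

-- f is a polynomial of formal degree n, c being the coefficient of zⁿ (possibly 0).
data Lead : ℕ → (ℕ → ℤφ) → ℤφ → Set where
  const : ∀ {f c} → (∀ z → f z ≡ c) → Lead 0 f c
  horner : ∀ {n f g c} c₀ → (∀ z → f z ≡ c₀ +ᵣ ι z *ᵣ g z) → Lead n g c → Lead (suc n) f c

Lead-cong : ∀ {n f g c} → (∀ z → g z ≡ f z) → Lead n f c → Lead n g c
Lead-cong eq (const p) = const λ z → trans (eq z) (p z)
Lead-cong eq (horner c₀ p l) = horner c₀ (λ z → trans (eq z) (p z)) l

Lead-coeff : ∀ {n f c d} → c ≡ d → Lead n f c → Lead n f d
Lead-coeff refl l = l

Lead-raise : ∀ {n f c} → Lead n f c → Lead (suc n) f 0ᵣ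
Lead-raise {c = c} (const p) = horner c
  (λ z → trans (p z) (sym (trans (cong (c +ᵣ_) (zeroʳ (ι z))) (+-identityʳ c)))) (const λ _ → refl)
Lead-raise (horner c₀ p l) = horner c₀ p (Lead-raise l)

Lead-raise⁺ : ∀ m {n f c} → Lead n f c → Lead (suc (m + n)) f 0ᵣ
Lead-raise⁺ zero l = Lead-raise l
Lead-raise⁺ (suc m) l = Lead-raise (Lead-raise⁺ m l)

Lead-scale : ∀ {n f c} s → Lead n f c → Lead n (λ z → s *ᵣ f z) (s *ᵣ c)
Lead-scale s (const p) = const λ z → cong (s *ᵣ_) (p z)
Lead-scale s (horner {g = g} c₀ p l) = horner (s *ᵣ c₀)
  (λ z → trans (cong (s *ᵣ_) (p z)) (solve 4 (λ s c z g → (s ⊗ (c ⊕ z ⊗ g)) ⊜ (s ⊗ c ⊕ z ⊗ (s ⊗ g))) refl s c₀ (ι z) (g z)))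
  (Lead-scale s l)

Lead-+ : ∀ {n f g c d} → Lead n f c → Lead n g d → Lead n (λ z → f z +ᵣ g z) (c +ᵣ d)
Lead-+ (const p) (const q) = const λ z → cong₂ _+ᵣ_ (p z) (q z)
Lead-+ (horner {g = g} c₀ p l) (horner {g = h} d₀ q k) = horner (c₀ +ᵣ d₀)
  (λ z → trans (cong₂ _+ᵣ_ (p z) (q z)) (solve 5 (λ c d z g h → ((c ⊕ z ⊗ g) ⊕ (d ⊕ z ⊗ h)) ⊜ ((c ⊕ d) ⊕ z ⊗ (g ⊕ h))) refl c₀ d₀ (ι z) (g z) (h z)))
  (Lead-+ l k)

Lead-z : ∀ {n f c} → Lead n f c → Lead (suc n) (λ z → ι z *ᵣ f z) c
Lead-z l = horner 0ᵣ (λ z → sym (+-identityˡ _)) l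

Lead-* : ∀ {n m f g c d} → Lead n f c → Lead m g d → Lead (n + m) (λ z → f z *ᵣ g z) (c *ᵣ d)
Lead-* {g = g} {c = c} (const p) k = Lead-cong (λ z → cong (_*ᵣ g z) (p z)) (Lead-scale c k)
Lead-* {suc n} {g = g} (horner {g = h} c₀ p l) k = Lead-coeff (+-identityˡ _) (Lead-cong
  (λ z → trans (cong (_*ᵣ g z) (p z)) (solve 4 (λ c z h g → ((c ⊕ z ⊗ h) ⊗ g) ⊜ (c ⊗ g ⊕ z ⊗ (h ⊗ g))) refl c₀ (ι z) (h z) (g z)))
  (Lead-+ (Lead-raise⁺ n (Lead-scale c₀ k)) (Lead-z (Lead-* l k))))

Lead-suc : ∀ {n f c} → Lead n f c → Lead n (f ∘ suc) c
Lead-suc (const p) = const (p ∘ suc)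
Lead-suc (horner {g = g} c₀ p l) = Lead-coeff (+-identityʳ _) (Lead-cong
  (λ z → trans (p (suc z)) (solve 3 (λ c z g → (c ⊕ (Κ (ι 1) ⊕ z) ⊗ g) ⊜ ((c ⊕ z ⊗ g) ⊕ g)) refl c₀ (ι z) (g (suc z))))
  (Lead-+ (horner c₀ (λ _ → refl) (Lead-suc l)) (Lead-raise (Lead-suc l))))

Lead-factor : ∀ {n f c} → Lead (suc n) f c → ∀ a →
  Σ (ℕ → ℤφ) λ g → Lead n g c × (∀ z → f z -ᵣ f a ≡ (ι z -ᵣ ι a) *ᵣ g z)
Lead-factor {f = f} (horner {g = g} {c = c} c₀ p (const q)) a = g , const q , λ z →
  trans (cong₂ _-ᵣ_ (trans (p z) (cong (λ w → c₀ +ᵣ ι z *ᵣ w) (q z))) (trans (p a) (cong (λ w → c₀ +ᵣ ι a *ᵣ w) (q a))))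
  (trans (solve 4 (λ c₀ z a c → ((c₀ ⊕ z ⊗ c) ⊕ ⊝ (c₀ ⊕ a ⊗ c)) ⊜ ((z ⊕ ⊝ a) ⊗ c)) refl c₀ (ι z) (ι a) c)
    (cong ((ι z -ᵣ ι a) *ᵣ_) (sym (q z))))
Lead-factor (horner {g = g} c₀ p l@(horner _ _ _)) a with Lead-factor l a
... | h , k , eq = (λ z → g z +ᵣ ι a *ᵣ h z) ,
  Lead-coeff (+-identityʳ _) (Lead-+ l (Lead-raise (Lead-scale (ι a) k))) ,
  λ z → trans (cong₂ _-ᵣ_ (p z) (p a)) (trans
    (solve 5 (λ c₀ z a gz ga → ((c₀ ⊕ z ⊗ gz) ⊕ ⊝ (c₀ ⊕ a ⊗ ga)) ⊜ ((z ⊕ ⊝ a) ⊗ gz ⊕ a ⊗ (gz ⊕ ⊝ ga))) refl c₀ (ι z) (ι a) (g z) (g a))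
    (trans (cong (λ w → (ι z -ᵣ ι a) *ᵣ g z +ᵣ ι a *ᵣ w) (eq z))
      (solve 4 (λ z a g h → ((z ⊕ ⊝ a) ⊗ g ⊕ a ⊗ ((z ⊕ ⊝ a) ⊗ h)) ⊜ ((z ⊕ ⊝ a) ⊗ (g ⊕ a ⊗ h))) refl (ι z) (ι a) (g z) (h z))))

-- Splitting off the factor z - ρ 0 keeps the formal leading coefficient and uses up one of the n +
-- 1 distinct roots. In the end a constant, equal to this coefficient, has a root.
Lead-roots : ∀ {n f c} → Lead n f c → (ρ : ℕ → ℕ) → (∀ i j → ρ i ≡ ρ j → i ≡ j) →
  (∀ i → i ≤ n → f (ρ i) ≡ 0ᵣ) → c ≡ 0ᵣ
Lead-roots (const p) ρ inj root = trans (sym (p (ρ 0))) (root 0 z≤n)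
Lead-roots {suc n} {f} l@(horner _ _ _) ρ inj root with Lead-factor l (ρ 0)
... | g , k , eq = Lead-roots k (ρ ∘ suc) (λ i j e → suc-injective (inj (suc i) (suc j) e)) root′
  where
  root′ : ∀ i → i ≤ n → g (ρ (suc i)) ≡ 0ᵣ
  root′ i le = *ᵣ-cancel-0 _ distinct (trans (sym (eq (ρ (suc i))))
    (cong₂ _-ᵣ_ (root (suc i) (s≤s le)) (root 0 z≤n)))
    where
    distinct : ι (ρ (suc i)) -ᵣ ι (ρ 0) ≢ 0ᵣ
    distinct e = ℕ.1+n≢0 (inj (suc i) 0 (ι-injective (x-y≡0⇒x≡y e)))

-- Binomial coefficients

_choose_ : ℕ → ℕ → ℕ
_ choose zero = 1
zero choose suc _ = 0
suc n choose suc k = n choose k + n choose suc k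

infix 8 _choose_

-- This is multiplication by z in the Newton basis, in a form without subtraction. It serves both to
-- compute leading coefficients and to show that functionals killing low binomials kill all
-- polynomials of low degree.
choose-absorb : ∀ z k → suc k * z choose (suc k) + k * z choose k ≡ z * z choose k
choose-absorb zero zero = refl
choose-absorb zero (suc k) rewrite ℕ.*-zeroʳ k = refl
choose-absorb (suc z) zero = trans (lem₁ (z choose 1)) (trans (cong suc (choose-absorb z 0)) (lem₂ z))
  where
  lem₁ : ∀ c → 1 * (1 + c) + 0 ≡ suc (1 * c + 0)
  lem₁ = ℕ-solve-∀
  lem₂ : ∀ z → suc (z * 1) ≡ suc z * 1
  lem₂ = ℕ-solve-∀
choose-absorb (suc z) (suc k) = trans
  (lem₁ k (z choose k) (z choose suc k) (z choose suc (suc k)))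
  (trans (cong₂ (λ a b → a + b + (z choose k + z choose suc k)) (choose-absorb z (suc k)) (choose-absorb z k))
    (lem₂ z (z choose k) (z choose suc k)))
  where
  lem₁ : ∀ k c₀ c₁ c₂ → suc (suc k) * (c₁ + c₂) + suc k * (c₀ + c₁)
    ≡ suc (suc k) * c₂ + suc k * c₁ + (suc k * c₁ + k * c₀) + (c₀ + c₁)
  lem₁ = ℕ-solve-∀
  lem₂ : ∀ z c₀ c₁ → z * c₁ + z * c₀ + (c₀ + c₁) ≡ suc z * (c₀ + c₁)
  lem₂ = ℕ-solve-∀

ι-choose-absorb : ∀ z k → ι (suc k) *ᵣ ι (z choose suc k) +ᵣ ι k *ᵣ ι (z choose k) ≡ ι z *ᵣ ι (z choose k)
ι-choose-absorb z k = trans (sym (cong₂ _+ᵣ_ (ι-* (suc k) _) (ι-* k _)))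
  (trans (cong ι (choose-absorb z k)) (ι-* z (z choose k)))

-- The factor k! clears the denominators of the binomial polynomial, since coefficients must lie in
-- ℤ[φ]; it makes the polynomial monic.
Lead-choose : ∀ k → Lead k (λ z → ι (k !) *ᵣ ι (z choose k)) 1ᵣ
Lead-choose zero = const λ _ → refl
Lead-choose (suc k) = Lead-coeff (+-identityʳ 1ᵣ) (Lead-cong eq
    (Lead-+ (Lead-z (Lead-choose k)) (Lead-raise (Lead-scale (-ᵣ ι k) (Lead-choose k)))))
  where
  eq : ∀ z → ι (suc k !) *ᵣ ι (z choose suc k)
    ≡ ι z *ᵣ (ι (k !) *ᵣ ι (z choose k)) +ᵣ -ᵣ ι k *ᵣ (ι (k !) *ᵣ ι (z choose k))
  eq z = trans (cong (_*ᵣ ι (z choose suc k)) (ι-* (suc k) (k !)))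
    (trans (solve 5 (λ s f c k d → (s ⊗ f ⊗ c) ⊜ (f ⊗ (s ⊗ c ⊕ k ⊗ d) ⊕ ⊝ k ⊗ (f ⊗ d))) refl
             (ι (suc k)) (ι (k !)) (ι (z choose suc k)) (ι k) (ι (z choose k)))
    (cong (_+ᵣ -ᵣ ι k *ᵣ (ι (k !) *ᵣ ι (z choose k)))
      (trans (cong (ι (k !) *ᵣ_) (ι-choose-absorb z k))
        (solve 3 (λ f z d → (f ⊗ (z ⊗ d)) ⊜ (z ⊗ (f ⊗ d))) refl (ι (k !)) (ι z) (ι (z choose k))))))

newton : ℕ → (ℕ → ℤφ) → ℕ → ℤφ
newton n c z = ∑ n (λ k → c k *ᵣ ι (z choose k))

newton-drop : ∀ n c z → c n ≡ 0ᵣ → newton (suc n) c z ≡ newton n c z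
newton-drop n c z eq = ∑-drop n (λ k → c k *ᵣ ι (z choose k))
  (trans (cong (_*ᵣ ι (z choose n)) eq) (zeroˡ (ι (z choose n))))

Lead-newton : ∀ n c → Lead n (λ z → ι (n !) *ᵣ newton (suc n) c z) (c n)
Lead-newton zero c = const λ z → solve 1 (λ c → (Κ 1ᵣ ⊗ (c ⊗ Κ 1ᵣ ⊕ Κ 0ᵣ)) ⊜ c) refl (c 0)
Lead-newton (suc n) c = Lead-coeff (trans (+-identityˡ _) (*-identityʳ _)) (Lead-cong eq
    (Lead-+ (Lead-raise (Lead-scale (ι (suc n)) (Lead-newton n c))) (Lead-scale (c (suc n)) (Lead-choose (suc n)))))
  where
  eq : ∀ z → ι (suc n !) *ᵣ newton (suc (suc n)) c z
    ≡ ι (suc n) *ᵣ (ι (n !) *ᵣ newton (suc n) c z) +ᵣ c (suc n) *ᵣ (ι (suc n !) *ᵣ ι (z choose suc n))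
  eq z = trans (cong₂ _*ᵣ_ (ι-* (suc n) (n !)) (∑-last (suc n) (λ k → c k *ᵣ ι (z choose k))))
    (trans (solve 5 (λ s f w c d → ((s ⊗ f) ⊗ (w ⊕ c ⊗ d)) ⊜ (s ⊗ (f ⊗ w) ⊕ c ⊗ ((s ⊗ f) ⊗ d))) refl
       (ι (suc n)) (ι (n !)) (newton (suc n) c z) (c (suc n)) (ι (z choose suc n)))
      (cong (λ w → ι (suc n) *ᵣ (ι (n !) *ᵣ newton (suc n) c z) +ᵣ c (suc n) *ᵣ (w *ᵣ ι (z choose suc n)))
        (sym (ι-* (suc n) (n !)))))

-- The zero estimate

lattice-< : ∀ {r j j′} i i′ → i < r → j < j′ → i + r * j < i′ + r * j′
lattice-< {r} {j} {j′} i i′ i<r j<j′ = <-≤-trans (+-monoˡ-< (r * j) i<r)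
  (≤-trans (≤-reflexive (sym (ℕ.*-suc r j))) (≤-trans (*-monoʳ-≤ r j<j′) (m≤n+m _ i′)))

lattice-injective : ∀ {x r i i′} j j′ → x ≤ r → i < x → i′ < x → i + r * j ≡ i′ + r * j′ → j ≡ j′
lattice-injective {x} {r} {i} {i′} j j′ x≤r i<x i′<x eq with ℕ.<-cmp j j′
... | tri≈ _ j≡j′ _ = j≡j′
... | tri< j<j′ _ _ = ⊥-elim (<-irrefl eq (lattice-< i i′ (<-≤-trans i<x x≤r) j<j′))
... | tri> _ _ j′<j = ⊥-elim (<-irrefl (sym eq) (lattice-< i′ i (<-≤-trans i′<x x≤r) j′<j))

module ZeroEstimate (a b : ℤφ) (a≢b : a ≢ b) (x Y r : ℕ) .{{_ : NonZero x}} (x≤r : x ≤ r) (t : ℕ → ℕ → ℤφ)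
  (t≢0 : ∀ i j → t i j ≢ 0ᵣ) (t-step : ∀ i j → i < x → b *ᵣ t (suc i) j ≡ a *ᵣ t i j) where

  ρ : ℕ → ℕ
  ρ l = l % x + r * (l / x)

  ρ-injective : ∀ l l′ → ρ l ≡ ρ l′ → l ≡ l′
  ρ-injective l l′ eq = trans (m≡m%n+[m/n]*n l x) (trans
      (cong₂ (λ u v → u + v * x)
        (ℕ.+-cancelʳ-≡ (r * (l / x)) (l % x) (l′ % x) (trans eq (cong (λ w → l′ % x + r * w) (sym quot)))) quot)
      (sym (m≡m%n+[m/n]*n l′ x)))
    where
    quot : l / x ≡ l′ / x
    quot = lattice-injective (l / x) (l′ / x) x≤r (m%n<n l x) (m%n<n l′ x) eq

  -- The index i includes x, so that for each of the x values i < x both neighbours z and z + 1 are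
  -- available.
  Vanishes : ℕ → ℕ → (ℕ → ℤφ) → (ℕ → ℤφ) → Set
  Vanishes e f c d = ∀ i j → i ≤ x → j < Y → newton e c (i + r * j) +ᵣ newton f d (i + r * j) *ᵣ t i j ≡ 0ᵣ

  module _ {n F C} (lead : Lead n F C) (n<xY : n < x * Y)
    (root : ∀ i j → i < x → j < Y → F (i + r * j) ≡ 0ᵣ) where
    lattice-roots : C ≡ 0ᵣ
    lattice-roots = Lead-roots lead ρ ρ-injective λ l l≤n →
      root (l % x) (l / x) (m%n<n l x) (m<n*o⇒m/o<n (subst (l <_) (ℕ.*-comm x Y) (≤-<-trans l≤n n<xY)))

  -- a P(z) Q(z + 1) - b P(z + 1) Q(z) vanishes at the lattice points and has leading coefficient (a - b) c d.
  top-coefficients : ∀ e f c d → suc e + f < x * Y → Vanishes (suc e) (suc f) c d → c e ≡ 0ᵣ ⊎ d f ≡ 0ᵣ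
  top-coefficients e f c d lt van = *ᵣ-domain (c e) (d f) (*ᵣ-cancel-0 (c e *ᵣ d f) (a≢b ∘ x-y≡0⇒x≡y)
    (trans (solve 3 (λ a b w → ((a ⊕ ⊝ b) ⊗ w) ⊜ (a ⊗ w ⊕ ⊝ b ⊗ w)) refl a b (c e *ᵣ d f))
      (lattice-roots (Lead-+ (Lead-scale a (Lead-* LP (Lead-suc LQ))) (Lead-scale (-ᵣ b) (Lead-* (Lead-suc LP) LQ)))
        (ℕ.<-trans (n<1+n _) lt) root)))
    where
    P Q : ℕ → ℤφ
    P = newton (suc e) c
    Q = newton (suc f) d
    LP : Lead e (λ z → ι (e !) *ᵣ P z) (c e)
    LP = Lead-newton e c
    LQ : Lead f (λ z → ι (f !) *ᵣ Q z) (d f)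
    LQ = Lead-newton f d
    root : ∀ i j → i < x → j < Y → let z = i + r * j in
      a *ᵣ (ι (e !) *ᵣ P z *ᵣ (ι (f !) *ᵣ Q (suc z))) +ᵣ -ᵣ b *ᵣ (ι (e !) *ᵣ P (suc z) *ᵣ (ι (f !) *ᵣ Q z)) ≡ 0ᵣ
    root i j i<x j<Y = trans
      (solve 10 (λ a b E F P P′ Q Q′ t t′ →
          (a ⊗ (E ⊗ P ⊗ (F ⊗ Q′)) ⊕ ⊝ b ⊗ (E ⊗ P′ ⊗ (F ⊗ Q))) ⊜
          (E ⊗ F ⊗ (a ⊗ Q′ ⊗ (P ⊕ Q ⊗ t) ⊕ ⊝ (b ⊗ Q ⊗ (P′ ⊕ Q′ ⊗ t′)) ⊕ Q ⊗ Q′ ⊗ (b ⊗ t′ ⊕ ⊝ (a ⊗ t)))))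
        refl a b (ι (e !)) (ι (f !)) (P z) (P (suc z)) (Q z) (Q (suc z)) (t i j) (t (suc i) j))
      (trans (cong₂ _*ᵣ_ refl (cong₂ _+ᵣ_ (cong₂ _-ᵣ_
            (trans (cong (a *ᵣ Q (suc z) *ᵣ_) (van i j (<⇒≤ i<x) j<Y)) (zeroʳ (a *ᵣ Q (suc z))))
            (trans (cong (b *ᵣ Q z *ᵣ_) (van (suc i) j i<x j<Y)) (zeroʳ (b *ᵣ Q z))))
          (trans (cong (Q z *ᵣ Q (suc z) *ᵣ_) (x≡y⇒x-y≡0 (t-step i j i<x))) (zeroʳ (Q z *ᵣ Q (suc z))))))
        (solve 1 (λ w → (w ⊗ (Κ 0ᵣ ⊕ ⊝ Κ 0ᵣ ⊕ Κ 0ᵣ)) ⊜ Κ 0ᵣ) refl (ι (e !) *ᵣ ι (f !))))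
      where
      z : ℕ
      z = i + r * j

  -- Descent on the number of coefficients: one of the two top coefficients vanishes and is dropped.
  -- The elimination compares only z with z + 1, so `t` has to be geometric in i alone and nothing
  -- relates different j. Therefore the exact powers of √5 2ˢ / (φ^n₀ G), which merely approximate
  -- powers of λʳ, are admissible.
  zero-estimate : ∀ e f c d → e + f ≤ x * Y → Vanishes e f c d →
    (∀ k → k < e → c k ≡ 0ᵣ) × (∀ k → k < f → d k ≡ 0ᵣ)
  drop-c : ∀ e f c d → suc e + f ≤ x * Y → Vanishes (suc e) f c d → c e ≡ 0ᵣ →
    (∀ k → k < suc e → c k ≡ 0ᵣ) × (∀ k → k < f → d k ≡ 0ᵣ)
  drop-d : ∀ e f c d → e + suc f ≤ x * Y → Vanishes e (suc f) c d → d f ≡ 0ᵣ →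
    (∀ k → k < e → c k ≡ 0ᵣ) × (∀ k → k < suc f → d k ≡ 0ᵣ)

  zero-estimate zero zero c d _ _ = (λ _ ()) , (λ _ ())
  zero-estimate (suc e) zero c d le van = drop-c e zero c d le van
    (lattice-roots (Lead-newton e c) (subst (_≤ x * Y) (ℕ.+-identityʳ (suc e)) le) λ i j i<x j<Y →
      trans (cong (ι (e !) *ᵣ_) (trans (solve 2 (λ w t → w ⊜ (w ⊕ Κ 0ᵣ ⊗ t)) refl _ (t i j)) (van i j (<⇒≤ i<x) j<Y)))
        (zeroʳ (ι (e !))))
  zero-estimate zero (suc f) c d le van = drop-d zero f c d le van
    (lattice-roots (Lead-newton f d) le λ i j i<x j<Y →
      trans (cong (ι (f !) *ᵣ_) (*ᵣ-cancel-0 _ (t≢0 i j)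
        (trans (solve 2 (λ w t → (t ⊗ w) ⊜ (Κ 0ᵣ ⊕ w ⊗ t)) refl _ (t i j)) (van i j (<⇒≤ i<x) j<Y)))) (zeroʳ (ι (f !))))
  zero-estimate (suc e) (suc f) c d le van =
    [ drop-c e (suc f) c d le van , drop-d (suc e) f c d le van ]′
      (top-coefficients e f c d (subst (_≤ x * Y) (cong suc (+-suc e f)) le) van)

  drop-c e f c d le van c≡0 =
    let c< , d< = zero-estimate e f c d (≤-trans (n≤1+n _) le) λ i j i≤x j<Y →
          trans (cong (_+ᵣ newton f d _ *ᵣ t i j) (sym (newton-drop e c _ c≡0))) (van i j i≤x j<Y)
    in <-split e c≡0 c< , d<
  drop-d e f c d le van d≡0 =
    let c< , d< = zero-estimate e f c d (≤-trans (+-monoʳ-≤ e (n≤1+n f)) le) λ i j i≤x j<Y →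
          trans (cong (λ w → newton e c _ +ᵣ w *ᵣ t i j) (sym (newton-drop f d _ d≡0))) (van i j i≤x j<Y)
    in c< , <-split f d≡0 d<

-- Functionals annihilating polynomials of low degree

module _ (m : ℕ) (p : ℕ → ℤφ) (z : ℕ → ℕ) where

  Λ : (ℕ → ℤφ) → ℤφ
  Λ f = ∑ m (λ i → p i *ᵣ f (z i))

  Λ-cong : ∀ {f g} → (∀ z → f z ≡ g z) → Λ f ≡ Λ g
  Λ-cong eq = ∑-cong m λ i _ → cong (p i *ᵣ_) (eq (z i))

  Λ-+ : ∀ f g → Λ (λ z → f z +ᵣ g z) ≡ Λ f +ᵣ Λ g
  Λ-+ f g = trans (∑-cong m λ i _ → distribˡ (p i) _ _) (∑-+ m _ _)

  Λ-* : ∀ c f → Λ (λ z → c *ᵣ f z) ≡ c *ᵣ Λ f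
  Λ-* c f = trans (∑-cong m λ i _ → solve 3 (λ p c f → (p ⊗ (c ⊗ f)) ⊜ (c ⊗ (p ⊗ f))) refl (p i) c (f (z i))) (∑-*ˡ m c _)

  module _ (K : ℕ) (kernel : ∀ k → k < K → Λ (λ z → ι (z choose k)) ≡ 0ᵣ) where

    -- Horner's scheme: each multiplication by z raises the binomial index k by at most 1, by
    -- `ι-choose-absorb`, while the degree n drops by 1, so n + k never grows.
    Λ-Lead : ∀ {n f c} → Lead n f c → ∀ k → n + k < K → Λ (λ z → f z *ᵣ ι (z choose k)) ≡ 0ᵣ
    Λ-Lead {c = c} (const eq) k lt = trans (Λ-cong λ z → cong (_*ᵣ ι (z choose k)) (eq z))
      (trans (Λ-* c (λ z → ι (z choose k))) (trans (cong (c *ᵣ_) (kernel k lt)) (zeroʳ c)))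
    Λ-Lead {suc n} {f} (horner {g = g} c₀ eq l) k lt = begin
      Λ (λ z → f z *ᵣ ι (z choose k))
        ≡⟨ Λ-cong expand ⟩
      Λ (λ z → c₀ *ᵣ ι (z choose k) +ᵣ (ι (suc k) *ᵣ (g z *ᵣ ι (z choose suc k)) +ᵣ ι k *ᵣ (g z *ᵣ ι (z choose k))))
        ≡⟨ trans (Λ-+ (λ z → c₀ *ᵣ ι (z choose k)) (λ z → ι (suc k) *ᵣ G₁ z +ᵣ ι k *ᵣ G₀ z)) (cong₂ _+ᵣ_ (Λ-* c₀ (λ z → ι (z choose k)))
             (trans (Λ-+ (λ z → ι (suc k) *ᵣ G₁ z) (λ z → ι k *ᵣ G₀ z)) (cong₂ _+ᵣ_ (Λ-* (ι (suc k)) G₁) (Λ-* (ι k) G₀)))) ⟩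
      c₀ *ᵣ Λ (λ z → ι (z choose k)) +ᵣ (ι (suc k) *ᵣ Λ (λ z → g z *ᵣ ι (z choose suc k)) +ᵣ ι k *ᵣ Λ (λ z → g z *ᵣ ι (z choose k)))
        ≡⟨ cong₂ _+ᵣ_ (cong (c₀ *ᵣ_) (kernel k (≤-<-trans (m≤n+m k (suc n)) lt)))
             (cong₂ _+ᵣ_ (cong (ι (suc k) *ᵣ_) (Λ-Lead l (suc k) (subst (_< K) (sym (+-suc n k)) lt)))
               (cong (ι k *ᵣ_) (Λ-Lead l k (ℕ.<-trans (n<1+n _) lt)))) ⟩
      c₀ *ᵣ 0ᵣ +ᵣ (ι (suc k) *ᵣ 0ᵣ +ᵣ ι k *ᵣ 0ᵣ)
        ≡⟨ solve 3 (λ a b c → (a ⊗ Κ 0ᵣ ⊕ (b ⊗ Κ 0ᵣ ⊕ c ⊗ Κ 0ᵣ)) ⊜ Κ 0ᵣ) refl c₀ (ι (suc k)) (ι k) ⟩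
      0ᵣ ∎
      where
      open ≡-Reasoning
      G₀ G₁ : ℕ → ℤφ
      G₀ z = g z *ᵣ ι (z choose k)
      G₁ z = g z *ᵣ ι (z choose suc k)
      expand : ∀ z → f z *ᵣ ι (z choose k)
        ≡ c₀ *ᵣ ι (z choose k) +ᵣ (ι (suc k) *ᵣ (g z *ᵣ ι (z choose suc k)) +ᵣ ι k *ᵣ (g z *ᵣ ι (z choose k)))
      expand z = trans (cong (_*ᵣ ι (z choose k)) (eq z))
        (trans (solve 4 (λ c z g b → ((c ⊕ z ⊗ g) ⊗ b) ⊜ (c ⊗ b ⊕ g ⊗ (z ⊗ b))) refl c₀ (ι z) (g z) (ι (z choose k)))
        (trans (cong (λ w → c₀ *ᵣ ι (z choose k) +ᵣ g z *ᵣ w) (sym (ι-choose-absorb z k)))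
          (solve 6 (λ w g s c k d → (w ⊕ g ⊗ (s ⊗ c ⊕ k ⊗ d)) ⊜ (w ⊕ (s ⊗ (g ⊗ c) ⊕ k ⊗ (g ⊗ d)))) refl
            (c₀ *ᵣ ι (z choose k)) (g z) (ι (suc k)) (ι (z choose suc k)) (ι k) (ι (z choose k)))))

    -- After multiplication by l! the first factor is a polynomial over ℤ[φ] of degree l; the factor
    -- l! is cancelled at the end.
    Λ-choose-choose : ∀ l k → l + k < K → Λ (λ z → ι (z choose l) *ᵣ ι (z choose k)) ≡ 0ᵣ
    Λ-choose-choose l k lt = *ᵣ-cancel-0 _ (ℕ.>⇒≢ (ℕ.1≤n! l) ∘ ι-injective)
      (trans (sym (Λ-* (ι (l !)) f)) (trans (Λ-cong λ z → sym (*-assoc (ι (l !)) (ι (z choose l)) (ι (z choose k))))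
        (Λ-Lead (Lead-choose l) k lt)))
      where
      f : ℕ → ℤφ
      f z = ι (z choose l) *ᵣ ι (z choose k)

-- Siegel's lemma

∑ℕ : ℕ → (ℕ → ℕ) → ℕ
∑ℕ zero f = 0
∑ℕ (suc n) f = f 0 + ∑ℕ n (f ∘ suc)

ι-∑ℕ : ∀ n f → ι (∑ℕ n f) ≡ ∑ n (ι ∘ f)
ι-∑ℕ zero f = refl
ι-∑ℕ (suc n) f = cong (ι (f 0) +ᵣ_) (ι-∑ℕ n (f ∘ suc))

∑ℕ-≤ : ∀ n {f b} → (∀ i → i < n → f i ≤ b) → ∑ℕ n f ≤ n * b
∑ℕ-≤ zero _ = z≤n
∑ℕ-≤ (suc n) le = +-mono-≤ (le 0 (s≤s z≤n)) (∑ℕ-≤ n λ i lt → le (suc i) (s≤s lt))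

extend : ∀ {m} → (Fin m → ℕ) → ℕ → ℕ
extend {zero} u _ = 0
extend {suc m} u zero = u Fin.zero
extend {suc m} u (suc i) = extend (u ∘ Fin.suc) i

extend-toℕ : ∀ {m} (u : Fin m → ℕ) i → extend u (Fin.toℕ i) ≡ u i
extend-toℕ u Fin.zero = refl
extend-toℕ u (Fin.suc i) = extend-toℕ (u ∘ Fin.suc) i

extend-≤ : ∀ {m B} (u : Fin m → ℕ) → (∀ i → u i ≤ B) → ∀ i → extend u i ≤ B
extend-≤ {zero} u le i = z≤n
extend-≤ {suc m} u le zero = le Fin.zero
extend-≤ {suc m} u le (suc i) = extend-≤ (u ∘ Fin.suc) (le ∘ Fin.suc) i

funToFin-cong : ∀ {m n} {f g : Fin m → Fin n} → (∀ i → f i ≡ g i) → Fin.funToFin f ≡ Fin.funToFin g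
funToFin-cong {zero} eq = refl
funToFin-cong {suc m} eq = cong₂ Fin.combine (eq Fin.zero) (funToFin-cong (eq ∘ Fin.suc))

finToFun-injective : ∀ {m n} (u w : Fin (n ^ m)) → (∀ i → Fin.finToFun {n} {m} u i ≡ Fin.finToFun w i) → u ≡ w
finToFun-injective {m} {n} u w eq = trans (sym (Fin.funToFin-finToFin {m} {n} u))
  (trans (funToFin-cong eq) (Fin.funToFin-finToFin {m} {n} w))

-- Pigeonhole: there are more vectors with entries in 0, ..., B than possible values of the K linear
-- forms, and the difference of two vectors with equal values is a solution. Its entries are
-- rational integers, hence fixed by conjugation, so Liouville's inequality meets the same
-- coefficients on the conjugate side.
siegel : ∀ m K β B (A : ℕ → ℕ → ℕ) → (∀ k i → k < K → i < m → A k i ≤ β) → suc (m * (B * β)) ^ K < suc B ^ m →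
  Σ (ℕ → ℤφ) λ p → (∀ i → Bd (p i) (ι B)) × (∀ i → conj (p i) ≡ p i) × (∀ k → k < K → ∑ m (λ i → p i *ᵣ ι (A k i)) ≡ 0ᵣ) × ¬ (∀ i → i < m → p i ≡ 0ᵣ)
siegel m K β B A A≤β lt = collision (Fin.pigeonhole lt image)
  where
  vec : Fin (suc B ^ m) → ℕ → ℕ
  vec u = extend (Fin.toℕ ∘ Fin.finToFun {suc B} {m} u)
  vec≤B : ∀ u i → vec u i ≤ B
  vec≤B u = extend-≤ _ λ i → ≤-pred (Fin.toℕ<n (Fin.finToFun {suc B} {m} u i))
  value : Fin (suc B ^ m) → ℕ → ℕ
  value u k = ∑ℕ m (λ i → vec u i * A k i)
  value< : ∀ u k → k < K → value u k < suc (m * (B * β))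
  value< u k k<K = s≤s (∑ℕ-≤ m λ i i<m → *-mono-≤ (vec≤B u i) (A≤β k i k<K i<m))
  image : Fin (suc B ^ m) → Fin (suc (m * (B * β)) ^ K)
  image u = Fin.funToFin {K} λ k → Fin.fromℕ< (value< u (Fin.toℕ k) (Fin.toℕ<n k))
  collision : (∃ λ u → ∃ λ w → u Fin.< w × image u ≡ image w) → _
  collision (u , w , u<w , eq) = p , p-Bd , (λ i → cong₂ mk (ℤ.+-identityʳ _) refl) , p-kernel , p≢0
    where
    p : ℕ → ℤφ
    p i = ι (vec u i) -ᵣ ι (vec w i)
    p-Bd : ∀ i → Bd (p i) (ι B)
    p-Bd i = bd (subst Pos (solve 3 (λ b u w → ((b ⊕ ⊝ u) ⊕ w) ⊜ (b ⊕ ⊝ (u ⊕ ⊝ w))) refl (ι B) (ι (vec u i)) (ι (vec w i)))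
                  (Pos-+ (_≼_.≼⁻ (ι-mono (vec≤B u i))) (Pos-ι (vec w i))))
                (subst Pos (solve 3 (λ b u w → ((b ⊕ ⊝ w) ⊕ u) ⊜ (b ⊕ (u ⊕ ⊝ w))) refl (ι B) (ι (vec u i)) (ι (vec w i)))
                  (Pos-+ (_≼_.≼⁻ (ι-mono (vec≤B w i))) (Pos-ι (vec u i))))
    same-value : ∀ k → k < K → value u k ≡ value w k
    same-value k k<K = begin
      value u k ≡⟨ cong (value u) (sym (Fin.toℕ-fromℕ< k<K)) ⟩
      value u (Fin.toℕ κ) ≡⟨ sym (Fin.toℕ-fromℕ< _) ⟩
      Fin.toℕ (Fin.fromℕ< (value< u (Fin.toℕ κ) (Fin.toℕ<n κ)))
        ≡⟨ cong Fin.toℕ (trans (sym (Fin.finToFun-funToFin _ κ)) (trans (cong (λ v → Fin.finToFun {_} {K} v κ) eq) (Fin.finToFun-funToFin _ κ))) ⟩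
      Fin.toℕ (Fin.fromℕ< (value< w (Fin.toℕ κ) (Fin.toℕ<n κ))) ≡⟨ Fin.toℕ-fromℕ< _ ⟩
      value w (Fin.toℕ κ) ≡⟨ cong (value w) (Fin.toℕ-fromℕ< k<K) ⟩
      value w k ∎
      where
      open ≡-Reasoning
      κ : Fin K
      κ = Fin.fromℕ< k<K
    ι-value : ∀ v k → ι (value v k) ≡ ∑ m (λ i → ι (vec v i) *ᵣ ι (A k i))
    ι-value v k = trans (ι-∑ℕ m _) (∑-cong m λ i _ → ι-* (vec v i) (A k i))
    p-kernel : ∀ k → k < K → ∑ m (λ i → p i *ᵣ ι (A k i)) ≡ 0ᵣ
    p-kernel k k<K = begin
      ∑ m (λ i → p i *ᵣ ι (A k i))
        ≡⟨ ∑-cong m (λ i _ → solve 3 (λ u w a → ((u ⊕ ⊝ w) ⊗ a) ⊜ (u ⊗ a ⊕ Κ (-ᵣ 1ᵣ) ⊗ (w ⊗ a))) refl (ι (vec u i)) (ι (vec w i)) (ι (A k i))) ⟩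
      ∑ m (λ i → ι (vec u i) *ᵣ ι (A k i) +ᵣ -ᵣ 1ᵣ *ᵣ (ι (vec w i) *ᵣ ι (A k i)))
        ≡⟨ trans (∑-+ m _ _) (cong₂ _+ᵣ_ (sym (ι-value u k)) (trans (∑-*ˡ m (-ᵣ 1ᵣ) _) (cong (-ᵣ 1ᵣ *ᵣ_) (sym (ι-value w k))))) ⟩
      ι (value u k) +ᵣ -ᵣ 1ᵣ *ᵣ ι (value w k)
        ≡⟨ cong (λ v → ι v +ᵣ -ᵣ 1ᵣ *ᵣ ι (value w k)) (same-value k k<K) ⟩
      ι (value w k) +ᵣ -ᵣ 1ᵣ *ᵣ ι (value w k)
        ≡⟨ solve 1 (λ a → (a ⊕ Κ (-ᵣ 1ᵣ) ⊗ a) ⊜ Κ 0ᵣ) refl (ι (value w k)) ⟩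
      0ᵣ ∎
      where open ≡-Reasoning
    p≢0 : ¬ (∀ i → i < m → p i ≡ 0ᵣ)
    p≢0 p≡0 = <-irrefl (cong Fin.toℕ (finToFun-injective {m} u w λ i → Fin.toℕ-injective
      (trans (sym (extend-toℕ _ i)) (trans (ι-injective (x-y≡0⇒x≡y (p≡0 (Fin.toℕ i) (Fin.toℕ<n i)))) (extend-toℕ _ i))))) u<w

-- Taylor expansion

module Taylor (a b u : ℤφ) (a≡b+u : a ≡ b +ᵣ u) where

  -- The quotient by uᵛ of aᶻ minus the first v terms of the binomial expansion of (b + u)ᶻ; the
  -- recursion comes from Pascal's rule and avoids the division.
  remainder : ℕ → ℕ → ℤφ
  remainder zero z = a ^ᵣ z
  remainder (suc v) zero = 0ᵣ
  remainder (suc v) (suc z) = b *ᵣ remainder (suc v) z +ᵣ remainder v z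

  term : ℕ → ℕ → ℕ → ℤφ
  term T z l = ι (z choose l) *ᵣ (u ^ᵣ l *ᵣ b ^ᵣ (T ∸ l))

  -- The factor bʸ makes the expansion homogeneous of the fixed degree T. Each term then depends on
  -- z only through a binomial coefficient, so functionals that kill binomials kill the whole sum.
  -- The subtraction `T ∸ l` truncates only for l > T ≥ z, where z choose l is 0.
  taylor : ∀ v z y T → z + y ≡ T → b ^ᵣ y *ᵣ a ^ᵣ z ≡ ∑ v (term T z) +ᵣ b ^ᵣ y *ᵣ (u ^ᵣ v *ᵣ remainder v z)
  taylor zero z y T eq = solve 2 (λ w s → (w ⊗ s) ⊜ (Κ 0ᵣ ⊕ w ⊗ (Κ 1ᵣ ⊗ s))) refl (b ^ᵣ y) (a ^ᵣ z)
  taylor (suc v) zero y .y refl = trans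
    (solve 2 (λ w s → (w ⊗ Κ 1ᵣ) ⊜ ((Κ 1ᵣ ⊗ (Κ 1ᵣ ⊗ w) ⊕ Κ 0ᵣ) ⊕ w ⊗ (s ⊗ Κ 0ᵣ))) refl (b ^ᵣ y) (u ^ᵣ suc v))
    (cong (λ s → ι 1 *ᵣ (1ᵣ *ᵣ b ^ᵣ y) +ᵣ s +ᵣ b ^ᵣ y *ᵣ (u ^ᵣ suc v *ᵣ 0ᵣ)) (sym (∑-zero v λ l _ → zeroˡ (u ^ᵣ suc l *ᵣ b ^ᵣ (y ∸ suc l)))))
  taylor (suc v) (suc z) y .(suc (z + y)) refl = begin
    b ^ᵣ y *ᵣ (a *ᵣ a ^ᵣ z)
      ≡⟨ cong (λ c → b ^ᵣ y *ᵣ (c *ᵣ a ^ᵣ z)) a≡b+u ⟩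
    b ^ᵣ y *ᵣ ((b +ᵣ u) *ᵣ a ^ᵣ z)
      ≡⟨ solve 4 (λ b u w s → (w ⊗ ((b ⊕ u) ⊗ s)) ⊜ (b ⊗ w ⊗ s ⊕ u ⊗ (w ⊗ s))) refl b u (b ^ᵣ y) (a ^ᵣ z) ⟩
    b ^ᵣ suc y *ᵣ a ^ᵣ z +ᵣ u *ᵣ (b ^ᵣ y *ᵣ a ^ᵣ z)
      ≡⟨ cong₂ (λ s t → s +ᵣ u *ᵣ t) (taylor (suc v) z (suc y) (suc T) (+-suc z y)) (taylor v z y T refl) ⟩
    head +ᵣ tail₁ +ᵣ b ^ᵣ suc y *ᵣ (u ^ᵣ suc v *ᵣ R₁) +ᵣ u *ᵣ (tail₀ +ᵣ b ^ᵣ y *ᵣ (u ^ᵣ v *ᵣ R₀))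
      ≡⟨ solve 9 (λ b u w s h t₁ t₀ R₁ R₀ → (h ⊕ t₁ ⊕ b ⊗ w ⊗ (u ⊗ s ⊗ R₁) ⊕ u ⊗ (t₀ ⊕ w ⊗ (s ⊗ R₀)))
           ⊜ (h ⊕ (t₁ ⊕ u ⊗ t₀) ⊕ w ⊗ (u ⊗ s ⊗ (b ⊗ R₁ ⊕ R₀)))) refl b u (b ^ᵣ y) (u ^ᵣ v) head tail₁ tail₀ R₁ R₀ ⟩
    head +ᵣ (tail₁ +ᵣ u *ᵣ tail₀) +ᵣ b ^ᵣ y *ᵣ (u ^ᵣ suc v *ᵣ remainder (suc v) (suc z))
      ≡⟨ cong (λ t → head +ᵣ t +ᵣ b ^ᵣ y *ᵣ (u ^ᵣ suc v *ᵣ remainder (suc v) (suc z)))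
           (trans (cong (tail₁ +ᵣ_) (sym (∑-*ˡ v u (term T z)))) (trans (sym (∑-+ v (term (suc T) z ∘ suc) (λ l → u *ᵣ term T z l)))
             (∑-cong v λ l _ → solve 5 (λ c₀ c₁ u s w → (c₁ ⊗ (u ⊗ s ⊗ w) ⊕ u ⊗ (c₀ ⊗ (s ⊗ w))) ⊜ ((c₀ ⊕ c₁) ⊗ (u ⊗ s ⊗ w)))
               refl (ι (z choose l)) (ι (z choose suc l)) u (u ^ᵣ l) (b ^ᵣ (T ∸ l))))) ⟩
    ∑ (suc v) (term (suc T) (suc z)) +ᵣ b ^ᵣ y *ᵣ (u ^ᵣ suc v *ᵣ remainder (suc v) (suc z)) ∎
    where
    open ≡-Reasoning
    T : ℕ
    T = z + y
    head tail₁ tail₀ R₁ R₀ : ℤφ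
    head = term (suc T) z 0
    tail₁ = ∑ v (term (suc T) z ∘ suc)
    tail₀ = ∑ v (term T z)
    R₁ = remainder (suc v) z
    R₀ = remainder v z

  module _ (a≥0 : Pos a) (b≥0 : Pos b) (b≼a : b ≼ a) where

    remainder-Pos : ∀ v z → Pos (remainder v z)
    remainder-Pos zero z = Pos-^ z a≥0
    remainder-Pos (suc v) zero = Pos-ι 0
    remainder-Pos (suc v) (suc z) = Pos-+ (Pos-* b≥0 (remainder-Pos (suc v) z)) (remainder-Pos v z)

    -- Lagrange's form of the remainder as an inequality: Pascal's rule, with one factor b replaced
    -- by the larger a at each step.
    remainder-≼ : ∀ v z → b ^ᵣ v *ᵣ remainder v z ≼ ι (z choose v) *ᵣ a ^ᵣ z
    remainder-≼ zero z = ≼-refl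
    remainder-≼ (suc v) zero = ≼-reflexive (trans (zeroʳ (b ^ᵣ suc v)) (sym (zeroˡ 1ᵣ)))
    remainder-≼ (suc v) (suc z) = ≼-trans
      (≼-reflexive (solve 4 (λ b w R₁ R₀ → (b ⊗ w ⊗ (b ⊗ R₁ ⊕ R₀)) ⊜ (b ⊗ (b ⊗ w ⊗ R₁ ⊕ w ⊗ R₀))) refl b (b ^ᵣ v) (remainder (suc v) z) (remainder v z)))
      (≼-trans (*-monoˡ-≼ b≥0 (+-mono-≼ (remainder-≼ (suc v) z) (remainder-≼ v z)))
      (≼-trans (*-monoʳ-≼ (Pos-+ (Pos-* (Pos-ι (z choose suc v)) (Pos-^ z a≥0)) (Pos-* (Pos-ι (z choose v)) (Pos-^ z a≥0))) b≼a)
        (≼-reflexive (solve 4 (λ a w c₁ c₀ → (a ⊗ (c₁ ⊗ w ⊕ c₀ ⊗ w)) ⊜ ((c₀ ⊕ c₁) ⊗ (a ⊗ w))) refl a (a ^ᵣ z) (ι (z choose suc v)) (ι (z choose v))))))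

-- Bounds for binomial coefficients

choose-mono : ∀ {M N} k → M ≤ N → M choose k ≤ N choose k
choose-mono k M≤N = go k (ℕ.≤⇒≤′ M≤N)
  where
  step : ∀ N k → N choose k ≤ suc N choose k
  step N zero = ≤-refl
  step N (suc k) = m≤n+m _ (N choose k)
  go : ∀ {M N} k → M ℕ.≤′ N → M choose k ≤ N choose k
  go k ℕ.≤′-refl = ≤-refl
  go k (ℕ.≤′-step le) = ≤-trans (go k le) (step _ k)

-- A single term of the expansion of (1 + 1/M)^N is at most the whole, denominators cleared.
choose*^≤ : ∀ M N k → N choose k * M ^ N ≤ M ^ k * suc M ^ N
choose*^≤ M N zero = *-monoʳ-≤ 1 (^-monoˡ-≤ N (n≤1+n M))
choose*^≤ M zero (suc k) = z≤n
choose*^≤ M (suc N) (suc k) = begin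
  (N choose k + N choose suc k) * (M * M ^ N)
    ≡⟨ lem₁ (N choose k) (N choose suc k) M (M ^ N) ⟩
  M * (N choose k * M ^ N) + M * (N choose suc k * M ^ N)
    ≤⟨ +-mono-≤ (*-monoʳ-≤ M (choose*^≤ M N k)) (*-monoʳ-≤ M (choose*^≤ M N (suc k))) ⟩
  M * (M ^ k * suc M ^ N) + M * (M * M ^ k * suc M ^ N)
    ≡⟨ lem₂ M (M ^ k) (suc M ^ N) ⟩
  M * M ^ k * (suc M * suc M ^ N) ∎
  where
  open ℕ.≤-Reasoning
  lem₁ : ∀ c d M w → (c + d) * (M * w) ≡ M * (c * w) + M * (d * w)
  lem₁ = ℕ-solve-∀
  lem₂ : ∀ M w s → M * (w * s) + M * (M * w * s) ≡ M * w * (suc M * s)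
  lem₂ = ℕ-solve-∀

-- Bernoulli's inequality (1 - 1/(M+1))ᵏ ≥ 1 - k/(M+1), denominators cleared.
bernoulli : ∀ M k d → k + d ≡ suc M → suc M ^ k * d ≤ M ^ k * suc M
bernoulli M zero d refl = ≤-refl
bernoulli M (suc k) d eq = begin
  suc M * suc M ^ k * d ≡⟨ lem₁ M (suc M ^ k) d ⟩
  suc M ^ k * (M * d + d) ≤⟨ *-monoʳ-≤ (suc M ^ k) (+-monoʳ-≤ (M * d) (subst (d ≤_) (suc-injective eq) (m≤n+m d k))) ⟩
  suc M ^ k * (M * d + M) ≡⟨ lem₂ M (suc M ^ k) d ⟩
  M * (suc M ^ k * suc d) ≤⟨ *-monoʳ-≤ M (bernoulli M k (suc d) (trans (+-suc k d) eq)) ⟩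
  M * (M ^ k * suc M) ≡⟨ sym (ℕ.*-assoc M (M ^ k) (suc M)) ⟩
  M * M ^ k * suc M ∎
  where
  open ℕ.≤-Reasoning
  lem₁ : ∀ M w d → suc M * w * d ≡ w * (M * d + d)
  lem₁ = ℕ-solve-∀
  lem₂ : ∀ M w d → w * (M * d + M) ≡ M * (w * suc d)
  lem₂ = ℕ-solve-∀

-- Bernoulli's inequality at the exponent M/2 gives the factor 2, which is squared; hence M is even.
[1+1/M]^M≤4 : ∀ n → let M = n + n in suc M ^ M ≤ 4 * M ^ M
[1+1/M]^M≤4 n = begin
  suc M ^ M ≡⟨ ^-distribˡ-+-* (suc M) n n ⟩
  suc M ^ n * suc M ^ n ≤⟨ *-mono-≤ half half ⟩
  2 * M ^ n * (2 * M ^ n) ≡⟨ lem (M ^ n) ⟩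
  4 * (M ^ n * M ^ n) ≡⟨ cong (4 ℕ.*_) (sym (^-distribˡ-+-* M n n)) ⟩
  4 * M ^ M ∎
  where
  open ℕ.≤-Reasoning
  M : ℕ
  M = n + n
  lem : ∀ w → 2 * w * (2 * w) ≡ 4 * (w * w)
  lem = ℕ-solve-∀
  half : suc M ^ n ≤ 2 * M ^ n
  half = *-cancelʳ-≤ _ _ (suc n) (≤-trans (bernoulli M n (suc n) (+-suc n n))
    (≤-trans (*-monoʳ-≤ (M ^ n) (s≤s (+-monoʳ-≤ n (n≤1+n n)))) (≤-reflexive (lem′ n (M ^ n)))))
    where
    lem′ : ∀ n w → w * suc (n + suc n) ≡ 2 * w * suc n
    lem′ = ℕ-solve-∀

^-distribʳ-* : ∀ n m o → (m * o) ^ n ≡ m ^ n * o ^ n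
^-distribʳ-* zero m o = refl
^-distribʳ-* (suc n) m o = trans (cong (m * o ℕ.*_) (^-distribʳ-* n m o)) (ℕ.[m*n]*[o*p]≡[m*o]*[n*p] m o (m ^ n) (o ^ n))

-- With M = 2^(h+1), a coefficient of order k is at most Mᵏ (1 + 1/M)^(M w) ≤ Mᵏ 4ʷ. Thus a height
-- of size 2^(h+1) w costs only h + 1 bits per unit of k.
choose-≤ : ∀ h w N k → N ≤ 2 ^ suc h * w → N choose k ≤ 2 ^ (suc h * k + 2 * w)
choose-≤ h w N k le = ≤-trans (choose-mono k le) (*-cancelʳ-≤ _ _ (M ^ (M * w)) {{m^n≢0 M (M * w) {{m^n≢0 2 (suc h)}}}} (begin
  (M * w) choose k * M ^ (M * w) ≤⟨ choose*^≤ M (M * w) k ⟩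
  M ^ k * suc M ^ (M * w) ≡⟨ cong (M ^ k ℕ.*_) (sym (^-*-assoc (suc M) M w)) ⟩
  M ^ k * (suc M ^ M) ^ w ≤⟨ *-monoʳ-≤ (M ^ k) (^-monoˡ-≤ w four) ⟩
  M ^ k * (4 * M ^ M) ^ w ≡⟨ cong (M ^ k ℕ.*_) (^-distribʳ-* w 4 (M ^ M)) ⟩
  M ^ k * (4 ^ w * (M ^ M) ^ w)
    ≡⟨ cong₂ (λ s t → M ^ k * (s * t)) (^-*-assoc 2 2 w) (^-*-assoc M M w) ⟩
  M ^ k * (2 ^ (2 * w) * M ^ (M * w)) ≡⟨ sym (ℕ.*-assoc (M ^ k) _ _) ⟩
  M ^ k * 2 ^ (2 * w) * M ^ (M * w)
    ≡⟨ cong (ℕ._* M ^ (M * w)) (trans (cong (ℕ._* 2 ^ (2 * w)) (^-*-assoc 2 (suc h) k)) (sym (^-distribˡ-+-* 2 (suc h * k) (2 * w)))) ⟩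
  2 ^ (suc h * k + 2 * w) * M ^ (M * w) ∎))
  where
  open ℕ.≤-Reasoning
  M : ℕ
  M = 2 ^ suc h
  four : suc M ^ M ≤ 4 * M ^ M
  four = subst (λ M → suc M ^ M ≤ 4 * M ^ M) (cong (2 ^ h ℕ.+_) (sym (ℕ.+-identityʳ (2 ^ h)))) ([1+1/M]^M≤4 (2 ^ h))

-- The interpolation argument

^-1ᵣ : ∀ n → 1ᵣ ^ᵣ n ≡ 1ᵣ
^-1ᵣ zero = refl
^-1ᵣ (suc n) = trans (*-identityˡ _) (^-1ᵣ n)

^ᵣ-∸ : ∀ x {i n} → i ≤ n → x ^ᵣ i *ᵣ x ^ᵣ (n ∸ i) ≡ x ^ᵣ n
^ᵣ-∸ x {i} {n} i≤n = trans (sym (^-homo-* x i (n ∸ i))) (cong (x ^ᵣ_) (m+[n∸m]≡n i≤n))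

Bd-subst : ∀ {x y b c} → x ≡ y → b ≡ c → Bd x b → Bd y c
Bd-subst refl refl p = p

Bd-ι*-cancel : ∀ m {x c} → Bd (ι (suc m) *ᵣ x) c → Bd x c
Bd-ι*-cancel m {x} {c} B@(bd p q) = bd
  (Pos-ι*-cancel m (subst Pos (solve 3 (λ m x c → ((c ⊕ ⊝ ((Κ 1ᵣ ⊕ m) ⊗ x)) ⊕ m ⊗ c) ⊜ ((Κ 1ᵣ ⊕ m) ⊗ (c ⊕ ⊝ x))) refl (ι m) x c)
    (Pos-+ p (Pos-* (Pos-ι m) (Bd⇒Pos B)))))
  (Pos-ι*-cancel m (subst Pos (solve 3 (λ m x c → ((c ⊕ ((Κ 1ᵣ ⊕ m) ⊗ x)) ⊕ m ⊗ c) ⊜ ((Κ 1ᵣ ⊕ m) ⊗ (c ⊕ x))) refl (ι m) x c)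
    (Pos-+ q (Pos-* (Pos-ι m) (Bd⇒Pos B)))))

-- Telescoping Uʲ⁺¹ - Vʲ⁺¹ = U (Uʲ - Vʲ) + (U - V) Vʲ. The factor c carries the accuracy and is
-- spent once in each summand.
Bd-^-difference : ∀ {U V H c} → Bd U H → Bd V H → Bd (c *ᵣ (U -ᵣ V)) H →
  ∀ j → Bd (c *ᵣ (U ^ᵣ j -ᵣ V ^ᵣ j)) (ι j *ᵣ H ^ᵣ j)
Bd-^-difference {U} {V} {H} {c} BU BV BD = go
  where
  base : c *ᵣ (1ᵣ -ᵣ 1ᵣ) ≡ 0ᵣ
  base = zeroʳ c
  step : ∀ u v → U *ᵣ (c *ᵣ (u -ᵣ v)) +ᵣ c *ᵣ (U -ᵣ V) *ᵣ v ≡ c *ᵣ (U *ᵣ u -ᵣ V *ᵣ v)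
  step u v = solve 5 (λ U V u v c → (U ⊗ (c ⊗ (u ⊕ ⊝ v)) ⊕ c ⊗ (U ⊕ ⊝ V) ⊗ v) ⊜ (c ⊗ (U ⊗ u ⊕ ⊝ (V ⊗ v)))) refl U V u v c
  bound : ∀ h j → H *ᵣ (ι j *ᵣ h) +ᵣ H *ᵣ h ≡ ι (suc j) *ᵣ (H *ᵣ h)
  bound h j = solve 3 (λ H h j → (H ⊗ (j ⊗ h) ⊕ H ⊗ h) ⊜ ((Κ 1ᵣ ⊕ j) ⊗ (H ⊗ h))) refl H h (ι j)
  go : ∀ j → Bd (c *ᵣ (U ^ᵣ j -ᵣ V ^ᵣ j)) (ι j *ᵣ H ^ᵣ j)
  go zero = subst (λ e → Bd e 0ᵣ) (sym base) (Pos⇒Bd (Pos-ι 0))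
  go (suc j) = subst₂ Bd (step (U ^ᵣ j) (V ^ᵣ j)) (bound (H ^ᵣ j) j) (Bd-+ (Bd-* BU (go j)) (Bd-* BD (Bd-^ j BV)))

√5 : ℤφ
√5 = mk -[1+ 0 ] (+ 2)

√5-Pos : Pos √5
√5-Pos = 1 , ℤ.+≤+ z≤n , ℤ.+≤+ z≤n

√5-Bd : Bd √5 (ι 3)
√5-Bd = bd (2 , ℤ.+≤+ z≤n , ℤ.+≤+ z≤n) (0 , ℤ.+≤+ z≤n , ℤ.+≤+ z≤n)

conj-√5-Bd : Bd (conj √5) (ι 3)
conj-√5-Bd = bd (0 , ℤ.+≤+ z≤n , ℤ.+≤+ z≤n) (2 , ℤ.+≤+ z≤n , ℤ.+≤+ z≤n)

conj-φ-Bd : Bd (conj φ) 1ᵣ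
conj-φ-Bd = bd (0 , ℤ.+≤+ z≤n , ℤ.+≤+ z≤n) (2 , ℤ.+≤+ z≤n , ℤ.+≤+ z≤n)

conj-φ^-Bd : ∀ q → Bd (conj (φ ^ᵣ q)) 1ᵣ
conj-φ^-Bd q = Bd-subst (sym (conj-^ φ q)) (^-1ᵣ q) (Bd-^ q conj-φ-Bd)

conj-∑ : ∀ n f → conj (∑ n f) ≡ ∑ n (conj ∘ f)
conj-∑ zero f = refl
conj-∑ (suc n) f = trans (conj-+ (f 0) _) (cong (conj (f 0) +ᵣ_) (conj-∑ n (f ∘ suc)))

-- φ is a unit, whereas 2ᵖ has norm 4ᵖ > 1.
φ^≢2^ : ∀ q p → 1 ≤ p → φ ^ᵣ q ≢ ι (2 ^ p)
φ^≢2^ q p 1≤p eq = ℕ.<⇒≢ big (sym (trans (cong ℤ.∣_∣ (trans (sym norm-ι) (cong norm (sym eq)))) (unit q)))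
  where
  unit : ∀ q → ℤ.∣ norm (φ ^ᵣ q) ∣ ≡ 1
  unit zero = refl
  unit (suc q) = trans (cong ℤ.∣_∣ (norm-* φ (φ ^ᵣ q))) (trans (ℤ.abs-* -[1+ 0 ] (norm (φ ^ᵣ q))) (trans (ℕ.*-identityˡ _) (unit q)))
  norm-ι : norm (ι (2 ^ p)) ≡ + (2 ^ p * 2 ^ p)
  norm-ι = trans (lem (+ (2 ^ p))) (sym (ℤ.pos-* (2 ^ p) (2 ^ p)))
    where
    lem : ∀ w → w ℤ.* w ℤ.+ w ℤ.* 0ℤ ℤ.- 0ℤ ℤ.* 0ℤ ≡ w ℤ.* w
    lem = solve-∀
  big : 1 < 2 ^ p * 2 ^ p
  big = *-mono-≤ {2} {2 ^ p} {1} {2 ^ p} (^-monoʳ-≤ 2 1≤p) (m^n>0 2 p)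

*-2^-mono : ∀ {X Y} i j → X ≤ 2 ^ i → Y ≤ 2 ^ j → X * Y ≤ 2 ^ (i + j)
*-2^-mono i j X≤ Y≤ = ≤-trans (*-mono-≤ X≤ Y≤) (≤-reflexive (sym (^-distribˡ-+-* 2 i j)))

n<2^n : ∀ n → n < 2 ^ n
n<2^n zero = s≤s z≤n
n<2^n (suc n) = ≤-trans (+-mono-≤ (m^n>0 2 n) (n<2^n n)) (≤-reflexive (cong (2 ^ n ℕ.+_) (sym (ℕ.+-identityʳ (2 ^ n)))))

3n≤2^n : ∀ n → 4 ≤ n → 3 * n ≤ 2 ^ n
3n≤2^n n 4≤n = subst (λ n → 3 * n ≤ 2 ^ n) (m+[n∸m]≡n 4≤n) (bound (n ∸ 4))
  where
  lem₁ : ∀ k → 16 * suc k ≡ 3 * (4 + k) + (13 * k + 4)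
  lem₁ = ℕ-solve-∀
  lem₂ : ∀ w → 16 * w ≡ 2 * (2 * (2 * (2 * w)))
  lem₂ = ℕ-solve-∀
  bound : ∀ k → 3 * (4 + k) ≤ 2 ^ (4 + k)
  bound k = ≤-trans (subst (3 * (4 + k) ≤_) (sym (lem₁ k)) (m≤m+n _ _))
    (≤-trans (*-monoʳ-≤ 16 (n<2^n k)) (≤-reflexive (lem₂ (2 ^ k))))

join : ∀ {A : Set} → ℕ → (ℕ → A) → (ℕ → A) → ℕ → A
join zero f g = g
join (suc K) f g zero = f 0
join (suc K) f g (suc k) = join K (f ∘ suc) g k

join-left : ∀ {A : Set} K (f g : ℕ → A) k → k < K → join K f g k ≡ f k
join-left (suc K) f g zero _ = refl
join-left (suc K) f g (suc k) (s≤s lt) = join-left K (f ∘ suc) g k lt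

join-right : ∀ {A : Set} K (f g : ℕ → A) k → join K f g (K + k) ≡ g k
join-right zero f g k = refl
join-right (suc K) f g k = join-right K (f ∘ suc) g k

∑-join : ∀ {A : Set} K K′ (w : ℕ → ℤφ) (f g : ℕ → A) (h : A → ℤφ) →
  ∑ (K + K′) (λ k → w k *ᵣ h (join K f g k)) ≡ ∑ K (λ k → w k *ᵣ h (f k)) +ᵣ ∑ K′ (λ k → w (K + k) *ᵣ h (g k))
∑-join zero K′ w f g h = sym (+-identityˡ _)
∑-join (suc K) K′ w f g h = trans (cong (w 0 *ᵣ h (f 0) +ᵣ_) (∑-join K K′ (w ∘ suc) (f ∘ suc) g h)) (sym (+-assoc (w 0 *ᵣ h (f 0)) _ _))

-- There are 3 v unknowns and 2 v equations, and (s³ + 1)² < (s² + 1)³. With s = m β this says that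
-- entries up to s² suffice in Siegel's lemma.
siegel-count : ∀ v s → 1 ≤ v → 1 ≤ s → suc (s * (s * s)) ^ (2 * v) < suc (s * s) ^ (3 * v)
siegel-count (suc v) (suc s) _ _ = subst₂ _<_
  (^-*-assoc (suc (suc s * (suc s * suc s))) 2 (suc v)) (^-*-assoc (suc (suc s * suc s)) 3 (suc v))
  (ℕ.^-monoˡ-< (suc v) (subst (suc (suc s * (suc s * suc s)) ^ 2 <_) (sym (lem s)) (s≤s (m≤m+n _ _))))
  where
  lem : ∀ s → let c = suc (suc s * suc s) ; d = suc (suc s * (suc s * suc s)) in
    c * (c * (c * 1)) ≡
    suc (d * (d * 1) +
      (3 * (s * s * s * s) + 10 * (s * s * s) + 15 * (s * s) + 12 * s + 3))
  lem = ℕ-solve-∀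

-- The rows are 2 v binomials in z and v binomials times `t`, in all 3 v = x Y, exactly as many as
-- the zero estimate allows. Siegel's lemma treats the first 2 v rows. For C(z, τ) λᶻ with τ < v the
-- first v Taylor terms have degree l + τ < 2 v, so they are annihilated as well, and Liouville's
-- inequality disposes of the remaining v rows.
module Interpolation
  (q p Λ₀ h x r s a : ℕ) (D : ℤφ)
  (1≤p : 1 ≤ p) (6≤x : 6 ≤ x) (6s≤x : 6 * (s + 2) ≤ x)
  (Λ₀≥ : 14 * suc h + 67 ≤ Λ₀)
  (x≤r : x ≤ r) (r≤ : r ≤ (x + 2) * 2 ^ suc h) (a≡ : p * r + s ≡ a)
  (b≼α : ι (2 ^ p) ≼ φ ^ᵣ q) (close : ι (2 ^ Λ₀) *ᵣ (φ ^ᵣ q -ᵣ ι (2 ^ p)) ≼ ι (2 ^ p))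
  (D-Pos : Pos D) (D≢0 : D ≢ 0ᵣ) (conj-D : Bd (conj D) (ι 2))
  (hyp : Bd (ι (2 ^ (Λ₀ * (x * p))) *ᵣ (√5 *ᵣ ι (2 ^ a) -ᵣ (φ ^ᵣ q) ^ᵣ r *ᵣ D)) (ι (2 ^ a)))
  where

  v Y m T β L : ℕ
  v = x * p
  Y = 3 * p
  m = 3 * v
  T = x + r * Y
  β = 2 ^ (2 * (suc h + 4) * v)
  L = 2 ^ (Λ₀ * v)

  α b u N U V H : ℤφ
  α = φ ^ᵣ q
  b = ι (2 ^ p)
  u = α -ᵣ b
  N = √5 *ᵣ ι (2 ^ s)
  U = b ^ᵣ r *ᵣ N
  V = α ^ᵣ r *ᵣ D
  H = ι (2 ^ (a + 2))

  -- This is λⁱ (√5 2ˢ / D)ʲ with λ = α / b, multiplied by b^x D^Y to clear denominators. By `hyp`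
  -- the second base is very close to λʳ.
  t : ℕ → ℕ → ℤφ
  t i j = α ^ᵣ i *ᵣ b ^ᵣ (x ∸ i) *ᵣ (N ^ᵣ j *ᵣ D ^ᵣ (Y ∸ j))

  ι2^≢0 : ∀ n → ι (2 ^ n) ≢ 0ᵣ
  ι2^≢0 n eq = ℕ.>⇒≢ (m^n>0 2 n) (ι-injective eq)

  φ≢0 : φ ≢ 0ᵣ
  φ≢0 ()

  √5≢0 : √5 ≢ 0ᵣ
  √5≢0 ()

  α-Pos : Pos α
  α-Pos = Pos-^ q Pos-φ

  b-Pos : Pos b
  b-Pos = Pos-ι (2 ^ p)

  u-Pos : Pos u
  u-Pos = _≼_.≼⁻ b≼α

  α≡b+u : α ≡ b +ᵣ u
  α≡b+u = solve 2 (λ α b → α ⊜ (b ⊕ (α ⊕ ⊝ b))) refl α b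

  t≢0 : ∀ i j → t i j ≢ 0ᵣ
  t≢0 i j = *ᵣ-≢0 (*ᵣ-≢0 (^ᵣ-≢0 i (^ᵣ-≢0 q φ≢0)) (^ᵣ-≢0 (x ∸ i) (ι2^≢0 p)))
    (*ᵣ-≢0 (^ᵣ-≢0 j (*ᵣ-≢0 √5≢0 (ι2^≢0 s))) (^ᵣ-≢0 (Y ∸ j) D≢0))

  t-step : ∀ i j → i < x → b *ᵣ t (suc i) j ≡ α *ᵣ t i j
  t-step i j i<x = trans
    (solve 5 (λ b α w z y → (b ⊗ (α ⊗ w ⊗ z ⊗ y)) ⊜ (α ⊗ (w ⊗ (b ⊗ z) ⊗ y))) refl b α (α ^ᵣ i) (b ^ᵣ (x ∸ suc i)) (N ^ᵣ j *ᵣ D ^ᵣ (Y ∸ j)))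
    (cong (λ k → α *ᵣ (α ^ᵣ i *ᵣ b ^ᵣ k *ᵣ (N ^ᵣ j *ᵣ D ^ᵣ (Y ∸ j)))) (sym (ℕ.+-∸-assoc 1 i<x)))

  instance
    x-nonZero : NonZero x
    x-nonZero = ℕ.>-nonZero (≤-trans (s≤s z≤n) 6≤x)

  1≤v : 1 ≤ v
  1≤v = *-mono-≤ (≤-trans (s≤s z≤n) 6≤x) 1≤p

  x≤v : x ≤ v
  x≤v = ≤-trans (≤-reflexive (sym (ℕ.*-identityʳ x))) (*-monoʳ-≤ x 1≤p)

  open ZeroEstimate α b (φ^≢2^ q p 1≤p) x Y r x≤r t t≢0 t-step using (zero-estimate)

  In : ℕ × ℕ → Set
  In (i , j) = i < suc x × j < Y

  height : ℕ × ℕ → ℕ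
  height (i , j) = i + r * j

  tᶜ : ℕ × ℕ → ℤφ
  tᶜ (i , j) = t i j

  search : (f : ℕ × ℕ → ℤφ) → (Σ (ℕ × ℕ) λ c → In c × f c ≢ 0ᵣ) ⊎ (∀ c → In c → f c ≡ 0ᵣ)
  search f = decide (ℕ.anyUpTo? (λ i → ℕ.anyUpTo? (λ j → ¬? (f (i , j) ≟ᵣ 0ᵣ)) Y) (suc x))
    where
    decide : Dec (∃ λ i → i < suc x × ∃ λ j → j < Y × f (i , j) ≢ 0ᵣ) →
      (Σ (ℕ × ℕ) λ c → In c × f c ≢ 0ᵣ) ⊎ (∀ c → In c → f c ≡ 0ᵣ)
    decide (yes (i , i< , j , j< , f≢0)) = inj₁ ((i , j) , (i< , j<) , f≢0)
    decide (no none) = inj₂ λ { (i , j) (i< , j<) → decidable-stable (f (i , j) ≟ᵣ 0ᵣ) λ f≢0 → none (i , i< , j , j< , f≢0) }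

  left right : ℕ → ℕ × ℕ → ℤφ
  left k c = ι (height c choose k)
  right k c = ι (height c choose k) *ᵣ tᶜ c

  row : ℕ → ℕ × ℕ → ℤφ
  row = join (2 * v) left right

  m≡2v+v : m ≡ 2 * v + v
  m≡2v+v = ℕ.+-comm v (2 * v)

  rows-independent : Independent (0 , 0) In search (2 * v + v) row
  rows-independent w kernel = combine
    (zero-estimate (2 * v) v w (λ k → w (2 * v + k)) (≤-reflexive (lem x p)) vanishes)
    where
    lem : ∀ x p → 2 * (x * p) + x * p ≡ x * (3 * p)
    lem = ℕ-solve-∀
    vanishes : ∀ i j → i ≤ x → j < Y →
      newton (2 * v) w (i + r * j) +ᵣ newton v (λ k → w (2 * v + k)) (i + r * j) *ᵣ t i j ≡ 0ᵣ
    vanishes i j i≤x j<Y = trans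
      (cong (newton (2 * v) w (i + r * j) +ᵣ_) (trans (*-comm (newton v (λ k → w (2 * v + k)) (i + r * j)) (t i j))
        (trans (sym (∑-*ˡ v (t i j) (λ k → w (2 * v + k) *ᵣ ι ((i + r * j) choose k))))
          (∑-cong v λ k _ → solve 3 (λ t w c → (t ⊗ (w ⊗ c)) ⊜ (w ⊗ (c ⊗ t))) refl (t i j) (w (2 * v + k)) (ι ((i + r * j) choose k))))))
      (trans (sym (∑-join (2 * v) v w left right (λ f → f (i , j)))) (kernel (i , j) (s≤s i≤x , j<Y)))
    combine : (∀ k → k < 2 * v → w k ≡ 0ᵣ) × (∀ k → k < v → w (2 * v + k) ≡ 0ᵣ) → ∀ k → k < 2 * v + v → w k ≡ 0ᵣ
    combine (lo , hi) k k< = [ lo k , (λ le → subst (λ l → w l ≡ 0ᵣ) (m+[n∸m]≡n le)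
      (hi (k ∸ 2 * v) (ℕ.+-cancelˡ-< (2 * v) _ _ (subst (_< 2 * v + v) (sym (m+[n∸m]≡n le)) k<)))) ]′ (<-≤-connex k (2 * v))

  -- The exponent in β is 2 (h+1) v + 6 v from `choose-≤`, plus 12 p ≤ 2 v, where 6 ≤ x is used.
  height-choose : ∀ c k → In c → k ≤ 2 * v → height c choose k ≤ β
  height-choose (i , j) k (s≤s i≤x , j<Y) k≤ = ≤-trans (choose-≤ h ((x + 2) * Y) _ k height≤)
    (^-monoʳ-≤ 2 (≤-trans (+-monoˡ-≤ _ (*-monoʳ-≤ (suc h) k≤))
      (≤-trans (≤-reflexive (lem₁ (suc h) x p)) (≤-trans (+-monoʳ-≤ (2 * suc h * v + 6 * v) (*-monoˡ-≤ (2 * p) 6≤x))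
        (≤-reflexive (lem₂ (suc h) x p))))))
    where
    lem₁ : ∀ g x p → g * (2 * (x * p)) + 2 * ((x + 2) * (3 * p))
      ≡ 2 * g * (x * p) + 6 * (x * p) + 6 * (2 * p)
    lem₁ = ℕ-solve-∀
    lem₂ : ∀ g x p → 2 * g * (x * p) + 6 * (x * p) + x * (2 * p) ≡ 2 * (g + 4) * (x * p)
    lem₂ = ℕ-solve-∀
    lem₃ : ∀ x w Y → (x + 2) * w * Y ≡ w * ((x + 2) * Y)
    lem₃ = ℕ-solve-∀
    height≤ : i + r * j ≤ 2 ^ suc h * ((x + 2) * Y)
    height≤ = ≤-trans (+-monoˡ-≤ (r * j) (≤-trans i≤x x≤r)) (≤-trans (≤-reflexive (sym (ℕ.*-suc r j)))
      (≤-trans (*-mono-≤ r≤ j<Y) (≤-reflexive (lem₃ x (2 ^ suc h) Y))))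

  -- Both sides are scaled by bʳʸ so that no division occurs; the main term is Dʸ αᶻ bᵗ⁻ᶻ.
  module Column (i j : ℕ) (i≤x : i ≤ x) (j≤Y : j ≤ Y) where

    z y : ℕ
    z = i + r * j
    y = (x ∸ i) + r * (Y ∸ j)

    z+y≡T : z + y ≡ T
    z+y≡T = trans (lem i (r * j) (x ∸ i) (r * (Y ∸ j))) (cong₂ ℕ._+_ (m+[n∸m]≡n i≤x)
      (trans (sym (*-distribˡ-+ r j (Y ∸ j))) (cong (r ℕ.*_) (m+[n∸m]≡n j≤Y))))
      where
      lem : ∀ a b c d → a + b + (c + d) ≡ a + c + (b + d)
      lem = ℕ-solve-∀

    A C : ℤφ
    A = α ^ᵣ i *ᵣ b ^ᵣ (x ∸ i)
    C = (b ^ᵣ r *ᵣ D) ^ᵣ (Y ∸ j)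

    scaled-t : b ^ᵣ (r * Y) *ᵣ t i j ≡ A *ᵣ (U ^ᵣ j *ᵣ C)
    scaled-t = begin
      b ^ᵣ (r * Y) *ᵣ (A *ᵣ (N ^ᵣ j *ᵣ D ^ᵣ (Y ∸ j)))
        ≡⟨ cong (_*ᵣ (A *ᵣ (N ^ᵣ j *ᵣ D ^ᵣ (Y ∸ j)))) (trans (sym (^-assocʳ b r Y)) (sym (^ᵣ-∸ (b ^ᵣ r) j≤Y))) ⟩
      (b ^ᵣ r) ^ᵣ j *ᵣ (b ^ᵣ r) ^ᵣ (Y ∸ j) *ᵣ (A *ᵣ (N ^ᵣ j *ᵣ D ^ᵣ (Y ∸ j)))
        ≡⟨ solve 5 (λ p q a n d → (p ⊗ q ⊗ (a ⊗ (n ⊗ d))) ⊜ (a ⊗ ((p ⊗ n) ⊗ (q ⊗ d)))) refl ((b ^ᵣ r) ^ᵣ j) ((b ^ᵣ r) ^ᵣ (Y ∸ j)) A (N ^ᵣ j) (D ^ᵣ (Y ∸ j)) ⟩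
      A *ᵣ ((b ^ᵣ r) ^ᵣ j *ᵣ N ^ᵣ j *ᵣ ((b ^ᵣ r) ^ᵣ (Y ∸ j) *ᵣ D ^ᵣ (Y ∸ j)))
        ≡⟨ cong₂ (λ e f → A *ᵣ (e *ᵣ f)) (sym (^-distrib-* (b ^ᵣ r) N j)) (sym (^-distrib-* (b ^ᵣ r) D (Y ∸ j))) ⟩
      A *ᵣ (U ^ᵣ j *ᵣ C) ∎
      where open ≡-Reasoning

    main : A *ᵣ (V ^ᵣ j *ᵣ C) ≡ D ^ᵣ Y *ᵣ (b ^ᵣ y *ᵣ α ^ᵣ z)
    main = begin
      A *ᵣ (V ^ᵣ j *ᵣ C)
        ≡⟨ cong₂ (λ e f → A *ᵣ (e *ᵣ f)) (^-distrib-* (α ^ᵣ r) D j) (^-distrib-* (b ^ᵣ r) D (Y ∸ j)) ⟩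
      A *ᵣ ((α ^ᵣ r) ^ᵣ j *ᵣ D ^ᵣ j *ᵣ ((b ^ᵣ r) ^ᵣ (Y ∸ j) *ᵣ D ^ᵣ (Y ∸ j)))
        ≡⟨ solve 6 (λ a b p d q e → (a ⊗ b ⊗ (p ⊗ d ⊗ (q ⊗ e))) ⊜ ((d ⊗ e) ⊗ ((b ⊗ q) ⊗ (a ⊗ p)))) refl
             (α ^ᵣ i) (b ^ᵣ (x ∸ i)) ((α ^ᵣ r) ^ᵣ j) (D ^ᵣ j) ((b ^ᵣ r) ^ᵣ (Y ∸ j)) (D ^ᵣ (Y ∸ j)) ⟩
      (D ^ᵣ j *ᵣ D ^ᵣ (Y ∸ j)) *ᵣ ((b ^ᵣ (x ∸ i) *ᵣ (b ^ᵣ r) ^ᵣ (Y ∸ j)) *ᵣ (α ^ᵣ i *ᵣ (α ^ᵣ r) ^ᵣ j))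
        ≡⟨ cong₂ _*ᵣ_ (^ᵣ-∸ D j≤Y) (cong₂ _*ᵣ_
             (trans (cong (b ^ᵣ (x ∸ i) *ᵣ_) (^-assocʳ b r (Y ∸ j))) (sym (^-homo-* b (x ∸ i) (r * (Y ∸ j)))))
             (trans (cong (α ^ᵣ i *ᵣ_) (^-assocʳ α r j)) (sym (^-homo-* α i (r * j))))) ⟩
      D ^ᵣ Y *ᵣ (b ^ᵣ y *ᵣ α ^ᵣ z) ∎
      where open ≡-Reasoning

  open Taylor α b u α≡b+u

  -- Two sources of error: the tail of the Taylor expansion, and the replacement of U = √5 2ᵃ by the
  -- nearby V = αʳ D.
  error : ℕ × ℕ → ℤφ
  error (i , j) = D ^ᵣ Y *ᵣ (b ^ᵣ y *ᵣ (u ^ᵣ v *ᵣ remainder v (i + r * j)))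
      +ᵣ α ^ᵣ i *ᵣ b ^ᵣ (x ∸ i) *ᵣ ((b ^ᵣ r *ᵣ D) ^ᵣ (Y ∸ j) *ᵣ (U ^ᵣ j -ᵣ V ^ᵣ j))
    where
    y : ℕ
    y = (x ∸ i) + r * (Y ∸ j)

  scaled : ∀ c → In c → b ^ᵣ (r * Y) *ᵣ tᶜ c ≡ D ^ᵣ Y *ᵣ ∑ v (term T (height c)) +ᵣ error c
  scaled (i , j) (s≤s i≤x , j<Y) = begin
    b ^ᵣ (r * Y) *ᵣ t i j
      ≡⟨ scaled-t ⟩
    A *ᵣ (U ^ᵣ j *ᵣ C)
      ≡⟨ solve 4 (λ a u c v → (a ⊗ (u ⊗ c)) ⊜ (a ⊗ (v ⊗ c) ⊕ a ⊗ (c ⊗ (u ⊕ ⊝ v)))) refl A (U ^ᵣ j) C (V ^ᵣ j) ⟩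
    A *ᵣ (V ^ᵣ j *ᵣ C) +ᵣ A *ᵣ (C *ᵣ (U ^ᵣ j -ᵣ V ^ᵣ j))
      ≡⟨ cong (_+ᵣ A *ᵣ (C *ᵣ (U ^ᵣ j -ᵣ V ^ᵣ j))) (trans main (cong (D ^ᵣ Y *ᵣ_) (taylor v z y T z+y≡T))) ⟩
    D ^ᵣ Y *ᵣ (∑ v (term T z) +ᵣ b ^ᵣ y *ᵣ (u ^ᵣ v *ᵣ remainder v z)) +ᵣ A *ᵣ (C *ᵣ (U ^ᵣ j -ᵣ V ^ᵣ j))
      ≡⟨ solve 4 (λ d s r e → (d ⊗ (s ⊕ r) ⊕ e) ⊜ (d ⊗ s ⊕ (d ⊗ r ⊕ e))) refl (D ^ᵣ Y) (∑ v (term T z)) (b ^ᵣ y *ᵣ (u ^ᵣ v *ᵣ remainder v z)) (A *ᵣ (C *ᵣ (U ^ᵣ j -ᵣ V ^ᵣ j))) ⟩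
    D ^ᵣ Y *ᵣ ∑ v (term T z) +ᵣ error (i , j) ∎
    where
    open ≡-Reasoning
    open Column i j i≤x (<⇒≤ j<Y)

  G Q : ℤφ
  G = ι (2 ^ suc p)
  Q = G ^ᵣ x *ᵣ H ^ᵣ Y

  ι-Bd : ∀ {m n} → m ≤ n → Bd (ι m) (ι n)
  ι-Bd {m} le = Bd-mono (Pos⇒Bd (Pos-ι m)) (ι-mono le)

  scale-≼ : ∀ n {x} → Pos x → x ≼ ι (2 ^ n) *ᵣ x
  scale-≼ n {x} x≥0 = ≼-trans (≼-reflexive (sym (*-identityˡ x))) (*-monoʳ-≼ x≥0 (ι-mono (m^n>0 2 n)))

  α-Bd : Bd α G
  α-Bd = Bd-mono (Pos⇒Bd α-Pos) (≼-trans (≼-reflexive α≡b+u)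
    (+-mono-≼ {b} {b} ≼-refl (≼-trans (≼-trans (scale-≼ Λ₀ u-Pos) close) (≼-reflexive (cong ι (sym (ℕ.+-identityʳ (2 ^ p))))))))

  b-Bd : Bd b G
  b-Bd = ι-Bd (m≤m+n (2 ^ p) _)

  U≡ : U ≡ √5 *ᵣ ι (2 ^ a)
  U≡ = trans (solve 3 (λ b w n → (b ⊗ (w ⊗ n)) ⊜ (w ⊗ (b ⊗ n))) refl (b ^ᵣ r) √5 (ι (2 ^ s)))
    (cong (√5 *ᵣ_) (trans (cong (_*ᵣ ι (2 ^ s)) (sym (ι-^ (2 ^ p) r))) (trans (sym (ι-* ((2 ^ p) ^ r) (2 ^ s)))
      (cong ι (trans (cong (ℕ._* 2 ^ s) (^-*-assoc 2 p r)) (trans (sym (^-distribˡ-+-* 2 (p * r) s)) (cong (2 ℕ.^_) a≡)))))))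

  difference : Bd (ι L *ᵣ (U -ᵣ V)) (ι (2 ^ a))
  difference = subst (λ w → Bd (ι L *ᵣ (w -ᵣ V)) (ι (2 ^ a))) (sym U≡) hyp

  L≡ : ∃ λ l → L ≡ suc l
  L≡ = pred L , sym (suc-pred L {{m^n≢0 2 (Λ₀ * v)}})

  unscaled-difference : Bd (U -ᵣ V) (ι (2 ^ a))
  unscaled-difference = Bd-ι*-cancel (proj₁ L≡) (subst (λ l → Bd (ι l *ᵣ (U -ᵣ V)) (ι (2 ^ a))) (proj₂ L≡) difference)

  4*2^a : 3 * 2 ^ a + 2 ^ a ≡ 2 ^ (a + 2)
  4*2^a = trans (lem (2 ^ a)) (sym (^-distribˡ-+-* 2 a 2))
    where
    lem : ∀ w → 3 * w + w ≡ w * 4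
    lem = ℕ-solve-∀

  U-Bd₀ : Bd U (ι (3 * 2 ^ a))
  U-Bd₀ = subst₂ Bd (sym U≡) (sym (ι-* 3 (2 ^ a))) (Bd-* √5-Bd (Pos⇒Bd (Pos-ι (2 ^ a))))

  U-Bd : Bd U H
  U-Bd = Bd-mono U-Bd₀ (ι-mono (subst (3 * 2 ^ a ≤_) 4*2^a (m≤m+n _ _)))

  V-Bd : Bd V H
  V-Bd = subst₂ Bd (solve 2 (λ u v → (u ⊕ ⊝ (u ⊕ ⊝ v)) ⊜ v) refl U V) (cong ι 4*2^a) (Bd-+ U-Bd₀ (Bd-neg unscaled-difference))

  scaled-difference : Bd (ι L *ᵣ (U -ᵣ V)) H
  scaled-difference = Bd-mono difference (ι-mono (^-monoʳ-≤ 2 (m≤m+n a 2)))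

  bD-Bd : Bd (b ^ᵣ r *ᵣ D) H
  bD-Bd = Bd-mono (Pos⇒Bd (Pos-* (Pos-^ r b-Pos) D-Pos))
    (≼-trans (*-monoʳ-≼ D-Pos (^-mono-≼ r b-Pos b≼α)) (≼⁺ (Bd.below V-Bd)))

  -- Each of the v Taylor terms gains Λ₀ bits because λ - 1 ≤ 2^-Λ₀. The accuracy assumed in `hyp`
  -- is the same Λ₀ v bits, so both parts of `error` are equally small.
  Lu^v≼b^v : ι L *ᵣ u ^ᵣ v ≼ b ^ᵣ v
  Lu^v≼b^v = ≼-trans (≼-reflexive (trans (cong (_*ᵣ u ^ᵣ v) (trans (cong ι (sym (^-*-assoc 2 Λ₀ v))) (ι-^ (2 ^ Λ₀) v)))
      (sym (^-distrib-* (ι (2 ^ Λ₀)) u v))))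
    (^-mono-≼ v (Pos-* (Pos-ι (2 ^ Λ₀)) u-Pos) close)

  error-Bd : ∀ c → In c → Bd (ι L *ᵣ error c) (ι (β + Y) *ᵣ Q)
  error-Bd (i , j) c∈@(s≤s i≤x , j<Y) = subst₂ Bd (sym (distribˡ (ι L) E₁ E₂)) (sym (distribʳ Q (ι β) (ι Y)))
      (Bd-+ (Bd-mono (Pos⇒Bd (Pos-* (Pos-ι L) E₁-Pos)) E₁-≼) E₂-Bd)
    where
    j≤Y : j ≤ Y
    j≤Y = <⇒≤ j<Y
    open Column i j i≤x j≤Y
    R E₁ E₂ W : ℤφ
    R = remainder v z
    E₁ = D ^ᵣ Y *ᵣ (b ^ᵣ y *ᵣ (u ^ᵣ v *ᵣ R))
    E₂ = A *ᵣ (C *ᵣ (U ^ᵣ j -ᵣ V ^ᵣ j))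
    W = D ^ᵣ Y *ᵣ b ^ᵣ y
    R-Pos : Pos R
    R-Pos = remainder-Pos α-Pos b-Pos b≼α v z
    W-Pos : Pos W
    W-Pos = Pos-* (Pos-^ Y D-Pos) (Pos-^ y b-Pos)
    E₁-Pos : Pos E₁
    E₁-Pos = Pos-* (Pos-^ Y D-Pos) (Pos-* (Pos-^ y b-Pos) (Pos-* (Pos-^ v u-Pos) R-Pos))
    A-Bd : Bd A (G ^ᵣ x)
    A-Bd = subst (Bd A) (^ᵣ-∸ G i≤x) (Bd-* (Bd-^ i α-Bd) (Bd-^ (x ∸ i) b-Bd))
    C-Bd : Bd C (H ^ᵣ (Y ∸ j))
    C-Bd = Bd-^ (Y ∸ j) bD-Bd
    main-≼ : A *ᵣ (V ^ᵣ j *ᵣ C) ≼ Q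
    main-≼ = ≼⁺ (Bd.below (subst (λ w → Bd (A *ᵣ (V ^ᵣ j *ᵣ C)) (G ^ᵣ x *ᵣ w)) (^ᵣ-∸ H j≤Y) (Bd-* A-Bd (Bd-* (Bd-^ j V-Bd) C-Bd))))
    E₁-≼ : ι L *ᵣ E₁ ≼ ι β *ᵣ Q
    E₁-≼ = ≼-trans (≼-reflexive (solve 5 (λ l d b u r → (l ⊗ (d ⊗ (b ⊗ (u ⊗ r)))) ⊜ (d ⊗ b ⊗ (l ⊗ u ⊗ r))) refl (ι L) (D ^ᵣ Y) (b ^ᵣ y) (u ^ᵣ v) R))
      (≼-trans (*-monoˡ-≼ W-Pos (*-monoʳ-≼ R-Pos Lu^v≼b^v))
      (≼-trans (*-monoˡ-≼ W-Pos (remainder-≼ α-Pos b-Pos b≼α v z))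
      (≼-trans (*-monoˡ-≼ W-Pos (*-monoʳ-≼ (Pos-^ z α-Pos) (ι-mono (height-choose (i , j) v c∈ (m≤m+n v _)))))
      (≼-trans (≼-reflexive (trans (solve 4 (λ d b c a → (d ⊗ b ⊗ (c ⊗ a)) ⊜ (c ⊗ (d ⊗ (b ⊗ a)))) refl (D ^ᵣ Y) (b ^ᵣ y) (ι β) (α ^ᵣ z))
          (cong (ι β *ᵣ_) (sym main))))
        (*-monoˡ-≼ (Pos-ι β) main-≼)))))
    E₂-Bd : Bd (ι L *ᵣ E₂) (ι Y *ᵣ Q)
    E₂-Bd = Bd-mono
      (subst₂ Bd (solve 4 (λ l a c d → (a ⊗ (c ⊗ (l ⊗ d))) ⊜ (l ⊗ (a ⊗ (c ⊗ d)))) refl (ι L) A C (U ^ᵣ j -ᵣ V ^ᵣ j))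
        (trans (solve 4 (λ g k j h → (g ⊗ (k ⊗ (j ⊗ h))) ⊜ (j ⊗ (g ⊗ (h ⊗ k)))) refl (G ^ᵣ x) (H ^ᵣ (Y ∸ j)) (ι j) (H ^ᵣ j))
          (cong (λ w → ι j *ᵣ (G ^ᵣ x *ᵣ w)) (^ᵣ-∸ H j≤Y)))
        (Bd-* A-Bd (Bd-* C-Bd (Bd-^-difference U-Bd V-Bd scaled-difference j))))
      (*-monoʳ-≼ (Pos-* (Pos-^ x (Pos-ι (2 ^ suc p))) (Pos-^ Y (Pos-ι (2 ^ (a + 2))))) (ι-mono j≤Y))

  conj-t-Bd : ∀ c → In c → Bd (conj (tᶜ c)) (b ^ᵣ x *ᵣ ι (2 ^ (s + 2)) ^ᵣ Y)
  conj-t-Bd (i , j) (s≤s i≤x , j<Y) = subst₂ Bd (sym conj-t)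
      (cong₂ _*ᵣ_ (^ᵣ-∸ b i≤x) (^ᵣ-∸ S (<⇒≤ j<Y)))
      (Bd-* (Bd-* (Bd-^ i conj-α) (Bd-^ (x ∸ i) conj-b)) (Bd-* (Bd-^ j conj-N) (Bd-^ (Y ∸ j) (Bd-mono conj-D (ι-mono (≤-trans (m≤m+n 2 2) (^-monoʳ-≤ 2 (m≤n+m 2 s))))))))
    where
    S : ℤφ
    S = ι (2 ^ (s + 2))
    conj-t : conj (t i j) ≡ conj α ^ᵣ i *ᵣ conj b ^ᵣ (x ∸ i) *ᵣ (conj N ^ᵣ j *ᵣ conj D ^ᵣ (Y ∸ j))
    conj-t = trans (conj-* (α ^ᵣ i *ᵣ b ^ᵣ (x ∸ i)) (N ^ᵣ j *ᵣ D ^ᵣ (Y ∸ j))) (cong₂ _*ᵣ_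
      (trans (conj-* (α ^ᵣ i) (b ^ᵣ (x ∸ i))) (cong₂ _*ᵣ_ (conj-^ α i) (conj-^ b (x ∸ i))))
      (trans (conj-* (N ^ᵣ j) (D ^ᵣ (Y ∸ j))) (cong₂ _*ᵣ_ (conj-^ N j) (conj-^ D (Y ∸ j)))))
    conj-α : Bd (conj α) b
    conj-α = Bd-mono (conj-φ^-Bd q) (ι-mono (m^n>0 2 p))
    conj-b : Bd (conj b) b
    conj-b = subst (λ w → Bd w b) (sym (conj-ι (2 ^ p))) (Pos⇒Bd b-Pos)
    conj-N : Bd (conj N) S
    conj-N = Bd-mono (subst₂ Bd (sym (trans (conj-* √5 (ι (2 ^ s))) (cong (conj √5 *ᵣ_) (conj-ι (2 ^ s))))) (sym (ι-* 3 (2 ^ s)))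
        (Bd-* conj-√5-Bd (Pos⇒Bd (Pos-ι (2 ^ s)))))
      (ι-mono (≤-trans (*-monoˡ-≤ (2 ^ s) (m≤m+n 3 1)) (≤-reflexive (trans (ℕ.*-comm 4 (2 ^ s)) (sym (^-distribˡ-+-* 2 s 2))))))

  B W₁ W₂ M : ℕ
  B = m * β * (m * β)
  W₁ = m * (B * (β * ((β + Y) * ((2 ^ suc p) ^ x * (2 ^ (a + 2)) ^ Y))))
  W₂ = m * (B * (β * ((2 ^ p) ^ x * (2 ^ (s + 2)) ^ Y)))
  M = L * (2 ^ p) ^ (r * Y)

  ι-*-≡ : ∀ {m n x y} → ι m ≡ x → ι n ≡ y → ι (m * n) ≡ x *ᵣ y
  ι-*-≡ {m} {n} refl refl = ι-* m n

  module Functionals (c : ℕ → ℕ × ℕ) (c∈ : ∀ i → i < m → In (c i)) (P : ℕ → ℤφ)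
    (P-Bd : ∀ i → Bd (P i) (ι B)) (conj-P : ∀ i → conj (P i) ≡ P i)
    (kernel : ∀ k → k < 2 * v → Λ m P (height ∘ c) (λ z → ι (z choose k)) ≡ 0ᵣ) (τ : ℕ) (τ<v : τ < v) where

    C : ℕ → ℤφ
    C i = ι (height (c i) choose τ)

    ψ : ℤφ
    ψ = ∑ m (λ i → P i *ᵣ right τ (c i))

    C-Bd : ∀ i → i < m → Bd (C i) (ι β)
    C-Bd i i<m = ι-Bd (height-choose (c i) τ (c∈ i i<m) (≤-trans (<⇒≤ τ<v) (m≤m+n v _)))

    main-vanishes : ∑ m (λ i → P i *ᵣ (C i *ᵣ ∑ v (term T (height (c i))))) ≡ 0ᵣ
    main-vanishes = begin
      ∑ m (λ i → P i *ᵣ (C i *ᵣ ∑ v (term T (height (c i)))))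
        ≡⟨ ∑-cong m (λ i _ → trans (sym (*-assoc (P i) (C i) (∑ v (term T (height (c i)))))) (sym (∑-*ˡ v (P i *ᵣ C i) (term T (height (c i)))))) ⟩
      ∑ m (λ i → ∑ v (λ l → P i *ᵣ C i *ᵣ term T (height (c i)) l))
        ≡⟨ ∑-swap m v (λ i l → P i *ᵣ C i *ᵣ term T (height (c i)) l) ⟩
      ∑ v (λ l → ∑ m (λ i → P i *ᵣ C i *ᵣ term T (height (c i)) l))
        ≡⟨ ∑-zero v (λ l l<v → trans
             (∑-cong m λ i _ → solve 4 (λ p c k w → (p ⊗ c ⊗ (k ⊗ w)) ⊜ (p ⊗ (w ⊗ (k ⊗ c)))) refl (P i) (C i) (ι (height (c i) choose l)) (u ^ᵣ l *ᵣ b ^ᵣ (T ∸ l)))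
             (trans (Λ-* m P (height ∘ c) (u ^ᵣ l *ᵣ b ^ᵣ (T ∸ l)) (λ z → ι (z choose l) *ᵣ ι (z choose τ)))
               (trans (cong (u ^ᵣ l *ᵣ b ^ᵣ (T ∸ l) *ᵣ_) (Λ-choose-choose m P (height ∘ c) (2 * v) kernel l τ (small l l<v)))
                 (zeroʳ (u ^ᵣ l *ᵣ b ^ᵣ (T ∸ l)))))) ⟩
      0ᵣ ∎
      where
      open ≡-Reasoning
      small : ∀ l → l < v → l + τ < 2 * v
      small l l<v = subst (l + τ <_) (cong (v ℕ.+_) (sym (ℕ.+-identityʳ v))) (+-mono-<-≤ l<v (<⇒≤ τ<v))

    scaled-ψ : b ^ᵣ (r * Y) *ᵣ ψ ≡ ∑ m (λ i → P i *ᵣ (C i *ᵣ error (c i)))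
    scaled-ψ = begin
      b ^ᵣ (r * Y) *ᵣ ψ
        ≡⟨ sym (∑-*ˡ m (b ^ᵣ (r * Y)) (λ i → P i *ᵣ right τ (c i))) ⟩
      ∑ m (λ i → b ^ᵣ (r * Y) *ᵣ (P i *ᵣ (C i *ᵣ tᶜ (c i))))
        ≡⟨ ∑-cong m (λ i i<m → trans (solve 4 (λ b p c t → (b ⊗ (p ⊗ (c ⊗ t))) ⊜ (p ⊗ (c ⊗ (b ⊗ t)))) refl (b ^ᵣ (r * Y)) (P i) (C i) (tᶜ (c i)))
             (trans (cong (λ w → P i *ᵣ (C i *ᵣ w)) (scaled (c i) (c∈ i i<m)))
               (solve 5 (λ p c d s e → (p ⊗ (c ⊗ (d ⊗ s ⊕ e))) ⊜ (d ⊗ (p ⊗ (c ⊗ s)) ⊕ p ⊗ (c ⊗ e))) refl (P i) (C i) (D ^ᵣ Y) (∑ v (term T (height (c i)))) (error (c i))))) ⟩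
      ∑ m (λ i → D ^ᵣ Y *ᵣ main i +ᵣ err i)
        ≡⟨ trans (∑-+ m (λ i → D ^ᵣ Y *ᵣ main i) err) (cong (_+ᵣ ∑ m err) (∑-*ˡ m (D ^ᵣ Y) main)) ⟩
      D ^ᵣ Y *ᵣ ∑ m main +ᵣ ∑ m err
        ≡⟨ trans (cong (λ w → D ^ᵣ Y *ᵣ w +ᵣ ∑ m err) main-vanishes) (trans (cong (_+ᵣ ∑ m err) (zeroʳ (D ^ᵣ Y))) (+-identityˡ (∑ m err))) ⟩
      ∑ m err ∎
      where
      open ≡-Reasoning
      main err : ℕ → ℤφ
      main i = P i *ᵣ (C i *ᵣ ∑ v (term T (height (c i))))
      err i = P i *ᵣ (C i *ᵣ error (c i))

    ψ-Bd : Bd (ι M *ᵣ ψ) (ι W₁)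
    ψ-Bd = subst₂ Bd eq ιW₁ (∑-Bd m λ i i<m → Bd-* (P-Bd i) (Bd-* (C-Bd i i<m) (error-Bd (c i) (c∈ i i<m))))
      where
      eq : ∑ m (λ i → P i *ᵣ (C i *ᵣ (ι L *ᵣ error (c i)))) ≡ ι M *ᵣ ψ
      eq = begin
        ∑ m (λ i → P i *ᵣ (C i *ᵣ (ι L *ᵣ error (c i))))
          ≡⟨ ∑-cong m (λ i _ → solve 4 (λ p c l e → (p ⊗ (c ⊗ (l ⊗ e))) ⊜ (l ⊗ (p ⊗ (c ⊗ e)))) refl (P i) (C i) (ι L) (error (c i))) ⟩
        ∑ m (λ i → ι L *ᵣ (P i *ᵣ (C i *ᵣ error (c i))))
          ≡⟨ ∑-*ˡ m (ι L) (λ i → P i *ᵣ (C i *ᵣ error (c i))) ⟩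
        ι L *ᵣ ∑ m (λ i → P i *ᵣ (C i *ᵣ error (c i)))
          ≡⟨ cong (ι L *ᵣ_) (sym scaled-ψ) ⟩
        ι L *ᵣ (b ^ᵣ (r * Y) *ᵣ ψ)
          ≡⟨ sym (*-assoc (ι L) (b ^ᵣ (r * Y)) ψ) ⟩
        ι L *ᵣ b ^ᵣ (r * Y) *ᵣ ψ
          ≡⟨ cong (_*ᵣ ψ) (sym (ι-*-≡ {L} refl (ι-^ (2 ^ p) (r * Y)))) ⟩
        ι M *ᵣ ψ ∎
        where open ≡-Reasoning
      ιW₁ : ι m *ᵣ (ι B *ᵣ (ι β *ᵣ (ι (β + Y) *ᵣ Q))) ≡ ι W₁
      ιW₁ = sym (ι-*-≡ {m} refl (ι-*-≡ {B} refl (ι-*-≡ {β} refl (ι-*-≡ {β + Y} refl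
        (ι-*-≡ {(2 ^ suc p) ^ x} (ι-^ (2 ^ suc p) x) (ι-^ (2 ^ (a + 2)) Y))))))

    conj-ψ-Bd : Bd (conj ψ) (ι W₂)
    conj-ψ-Bd = subst₂ Bd (sym eq) ιW₂ (∑-Bd m λ i i<m → Bd-* (P-Bd i) (Bd-* (C-Bd i i<m) (conj-t-Bd (c i) (c∈ i i<m))))
      where
      eq : conj ψ ≡ ∑ m (λ i → P i *ᵣ (C i *ᵣ conj (tᶜ (c i))))
      eq = trans (conj-∑ m (λ i → P i *ᵣ right τ (c i))) (∑-cong m λ i _ →
        trans (conj-* (P i) (right τ (c i))) (cong₂ _*ᵣ_ (conj-P i)
          (trans (conj-* (C i) (tᶜ (c i))) (cong (_*ᵣ conj (tᶜ (c i))) (conj-ι (height (c i) choose τ))))))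
      ιW₂ : ι m *ᵣ (ι B *ᵣ (ι β *ᵣ (b ^ᵣ x *ᵣ ι (2 ^ (s + 2)) ^ᵣ Y))) ≡ ι W₂
      ιW₂ = sym (ι-*-≡ {m} refl (ι-*-≡ {B} refl (ι-*-≡ {β} refl
        (ι-*-≡ {(2 ^ p) ^ x} (ι-^ (2 ^ p) x) (ι-^ (2 ^ (s + 2)) Y)))))

  W₁W₂<M : W₁ * W₂ < M
  W₁W₂<M = ≤-<-trans (*-2^-mono e₁ e₂ W₁≤ W₂≤) (subst (2 ^ (e₁ + e₂) <_) M≡ (^-monoʳ-< 2 (s≤s (s≤s z≤n)) exponents))
    where
    β′ f k₁ l₁ l₂ e₁ e₂ : ℕ
    β′ = 2 * (suc h + 4) * v
    f = v + β′ + (v + β′)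
    l₁ = suc p * x + (a + 2) * Y
    l₂ = p * x + (s + 2) * Y
    k₁ = suc β′ + l₁
    e₁ = v + (f + (β′ + k₁))
    e₂ = v + (f + (β′ + l₂))
    m≤ : m ≤ 2 ^ v
    m≤ = 3n≤2^n v (≤-trans (≤-trans (m≤m+n 4 2) 6≤x) x≤v)
    B≤ : B ≤ 2 ^ f
    B≤ = *-2^-mono (v + β′) (v + β′) (*-2^-mono v β′ m≤ ≤-refl) (*-2^-mono v β′ m≤ ≤-refl)
    Y≤β : Y ≤ β
    Y≤β = ≤-trans (*-monoʳ-≤ 3 (m≤n*m p x)) (≤-trans m≤ (^-monoʳ-≤ 2 (m≤n*m v (2 * (suc h + 4)))))
    W₁≤ : W₁ ≤ 2 ^ e₁
    W₁≤ = *-2^-mono v (f + (β′ + k₁)) m≤ (*-2^-mono f (β′ + k₁) B≤ (*-2^-mono β′ k₁ ≤-refl (*-2^-mono (suc β′) l₁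
      (+-monoʳ-≤ β (≤-trans Y≤β (≤-reflexive (sym (ℕ.+-identityʳ β)))))
      (*-2^-mono (suc p * x) ((a + 2) * Y) (≤-reflexive (^-*-assoc 2 (suc p) x)) (≤-reflexive (^-*-assoc 2 (a + 2) Y))))))
    W₂≤ : W₂ ≤ 2 ^ e₂
    W₂≤ = *-2^-mono v (f + (β′ + l₂)) m≤ (*-2^-mono f (β′ + l₂) B≤ (*-2^-mono β′ l₂ ≤-refl
      (*-2^-mono (p * x) ((s + 2) * Y) (≤-reflexive (^-*-assoc 2 p x)) (≤-reflexive (^-*-assoc 2 (s + 2) Y)))))
    M≡ : 2 ^ (Λ₀ * v + p * (r * Y)) ≡ M
    M≡ = trans (^-distribˡ-+-* 2 (Λ₀ * v) (p * (r * Y))) (cong (L ℕ.*_) (sym (^-*-assoc 2 p (r * Y))))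
    -- Seven factors bounded by multiples of β occur in `W₁ * W₂`, contributing 14 (h+1) v + 56 v; m
    -- occurs six times with v bits each, and the powers of 2ᵖ give 2 v more. The main term p r Y is
    -- matched by the scaling factor in `M`. Three further multiples of v absorb 1, x and 6 (s+2) p,
    -- which explains the constants 14 and 67.
    exponents : e₁ + e₂ < Λ₀ * v + p * (r * Y)
    exponents = begin-strict
      e₁ + e₂ ≡⟨ cong (λ a → v + ((v + β′ + (v + β′)) + (β′ + (suc β′ + (suc p * x + (a + 2) * Y)))) + e₂) (sym a≡) ⟩
      _ ≡⟨ lem₁ h x p r s ⟩
      (14 * suc h + 64) * v + 1 + x + 6 * (s + 2) * p + p * (r * Y)
        <⟨ +-monoˡ-< (p * (r * Y)) (+-mono-<-≤ (+-mono-<-≤ (+-monoʳ-< ((14 * suc h + 64) * v) 1<v) x≤v) (*-monoˡ-≤ p 6s≤x)) ⟩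
      (14 * suc h + 64) * v + v + v + x * p + p * (r * Y)
        ≡⟨ cong (ℕ._+ p * (r * Y)) (lem₂ (14 * suc h) v) ⟩
      (14 * suc h + 67) * v + p * (r * Y)
        ≤⟨ +-monoˡ-≤ (p * (r * Y)) (*-monoˡ-≤ v Λ₀≥) ⟩
      Λ₀ * v + p * (r * Y) ∎
      where
      open ℕ.≤-Reasoning
      1<v : 1 < v
      1<v = ≤-trans (≤-trans (m≤m+n 2 4) 6≤x) x≤v
      lem₁ : ∀ h x p r s → let v = x * p ; β′ = 2 * (suc h + 4) * v ; Y = 3 * p in
        v + ((v + β′ + (v + β′)) + (β′ + (suc β′ + (suc p * x + (p * r + s + 2) * Y))))
          + (v + ((v + β′ + (v + β′)) + (β′ + (p * x + (s + 2) * Y))))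
        ≡ (14 * suc h + 64) * v + 1 + x + 6 * (s + 2) * p + p * (r * Y)
      lem₁ = ℕ-solve-∀
      lem₂ : ∀ c v → (c + 64) * v + v + v + v ≡ (c + 67) * v
      lem₂ = ℕ-solve-∀

  contradiction : ⊥
  contradiction = from-columns (nonsingular-columns (0 , 0) In search (2 * v + v) row rows-independent)
    where
    from-columns : (Σ (ℕ → ℕ × ℕ) λ c → (∀ i → i < 2 * v + v → In (c i)) ×
      Nonsingular (0 , 0) In search (2 * v + v) row c) → ⊥
    from-columns (c , c∈′ , nonsing) = from-siegel
        (siegel m (2 * v) β B (λ k i → height (c i) choose k) (λ k i k< i< → height-choose (c i) k (c∈ i i<) (<⇒≤ k<))
          (subst (λ e → suc e ^ (2 * v) < suc B ^ m) (lem m β) (siegel-count v (m * β) 1≤v (*-mono-≤ (≤-trans 1≤v (m≤n*m v 3)) (m^n>0 2 (2 * (suc h + 4) * v))))))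
      where
      lem : ∀ m β → m * β * (m * β * (m * β)) ≡ m * (m * β * (m * β) * β)
      lem = ℕ-solve-∀
      c∈ : ∀ i → i < m → In (c i)
      c∈ i i<m = c∈′ i (subst (i <_) m≡2v+v i<m)
      from-siegel : (Σ (ℕ → ℤφ) λ P → (∀ i → Bd (P i) (ι B)) × (∀ i → conj (P i) ≡ P i) ×
        (∀ k → k < 2 * v → ∑ m (λ i → P i *ᵣ ι (height (c i) choose k)) ≡ 0ᵣ) × ¬ (∀ i → i < m → P i ≡ 0ᵣ)) → ⊥
      from-siegel (P , P-Bd , conj-P , kernel , P≢0) = P≢0 λ i i<m → nonsing P annihilates i (subst (i <_) m≡2v+v i<m)
        where
        annihilates : ∀ k → k < 2 * v + v → ∑ (2 * v + v) (λ i → P i *ᵣ row k (c i)) ≡ 0ᵣ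
        annihilates k k< = subst (λ n → ∑ n (λ i → P i *ᵣ row k (c i)) ≡ 0ᵣ) m≡2v+v ([ low , high ]′ (<-≤-connex k (2 * v)))
          where
          low : k < 2 * v → ∑ m (λ i → P i *ᵣ row k (c i)) ≡ 0ᵣ
          low k<2v = trans (∑-cong m λ i _ → cong (λ f → P i *ᵣ f (c i)) (join-left (2 * v) left right k k<2v)) (kernel k k<2v)
          high : 2 * v ≤ k → ∑ m (λ i → P i *ᵣ row k (c i)) ≡ 0ᵣ
          high 2v≤k = trans (∑-cong m λ i _ → cong (λ f → P i *ᵣ f (c i))
              (trans (cong row (sym (m+[n∸m]≡n 2v≤k))) (join-right (2 * v) left right τ)))
              (liouville M W₁ W₂ ψ-Bd conj-ψ-Bd W₁W₂<M)
            where
            τ : ℕ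
            τ = k ∸ 2 * v
            open Functionals c c∈ P P-Bd conj-P kernel τ
              (ℕ.+-cancelˡ-< (2 * v) τ v (subst (_< 2 * v + v) (sym (m+[n∸m]≡n 2v≤k)) k<))

-- Interval arithmetic with binary exponents

-- A Euclidean algorithm: multiplication by φ sends (a, b) to (b, a + b). For coordinates of
-- opposite sign this either makes the signs agree or decreases ∣a∣ + ∣b∣.
Pos-total : ∀ x → Pos x ⊎ Pos (-ᵣ x)
Pos-total (mk a b) = go _ a b ≤-refl
  where
  φ-step : ∀ x → Pos (φ *ᵣ x) → Pos x
  φ-step x (k , p) = k + 1 , subst NN (trans (sym (*-assoc (φ ^ᵣ k) φ x))
    (cong (_*ᵣ x) (trans (cong (φ ^ᵣ k *ᵣ_) (sym (*-identityʳ φ))) (sym (^-homo-* φ k 1))))) p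
  rotate : ∀ a b → φ *ᵣ mk a b ≡ mk b (a ℤ.+ b)
  rotate a b = cong₂ mk (lem₁ a b) (lem₂ a b)
    where
    lem₁ : ∀ a b → 0ℤ ℤ.* a ℤ.+ 1ℤ ℤ.* b ≡ b
    lem₁ = solve-∀
    lem₂ : ∀ a b → 0ℤ ℤ.* b ℤ.+ 1ℤ ℤ.* a ℤ.+ 1ℤ ℤ.* b ≡ a ℤ.+ b
    lem₂ = solve-∀
  back : ∀ {a b} → Pos (mk b (a ℤ.+ b)) ⊎ Pos (-ᵣ mk b (a ℤ.+ b)) → Pos (mk a b) ⊎ Pos (-ᵣ mk a b)
  back {a} {b} (inj₁ p) = inj₁ (φ-step (mk a b) (subst Pos (sym (rotate a b)) p))
  back {a} {b} (inj₂ p) = inj₂ (φ-step (-ᵣ mk a b) (subst Pos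
    (trans (cong -ᵣ_ (sym (rotate a b))) (solve 2 (λ f x → (⊝ (f ⊗ x)) ⊜ (f ⊗ (⊝ x))) refl φ (mk a b))) p))
  nonneg : ∀ {a b} → 0ℤ ℤ.≤ a → 0ℤ ℤ.≤ b → Pos (mk a b) ⊎ Pos (-ᵣ mk a b)
  nonneg p q = inj₁ (NN⇒Pos (p , q))
  nonpos : ∀ {a b} → a ℤ.≤ 0ℤ → b ℤ.≤ 0ℤ → Pos (mk a b) ⊎ Pos (-ᵣ mk a b)
  nonpos p q = inj₂ (NN⇒Pos (ℤ.neg-mono-≤ p , ℤ.neg-mono-≤ q))
  go : ∀ n a b → ℤ.∣ a ∣ + ℤ.∣ b ∣ ≤ n → Pos (mk a b) ⊎ Pos (-ᵣ mk a b)
  go n (+ a) (+ b) _ = nonneg (ℤ.+≤+ z≤n) (ℤ.+≤+ z≤n)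
  go n -[1+ a ] -[1+ b ] _ = nonpos ℤ.-≤+ ℤ.-≤+
  go n (+ zero) -[1+ b ] _ = nonpos (ℤ.+≤+ z≤n) ℤ.-≤+
  go n -[1+ a ] (+ zero) _ = nonpos ℤ.-≤+ (ℤ.+≤+ z≤n)
  go (suc n) (+ suc a) -[1+ b ] (s≤s le) = back (opposite (≤-<-connex b a))
    where
    opposite : b ≤ a ⊎ a < b → Pos (mk -[1+ b ] (+ suc a ℤ.+ -[1+ b ])) ⊎ Pos (-ᵣ mk -[1+ b ] (+ suc a ℤ.+ -[1+ b ]))
    opposite (inj₁ b≤a) = subst (λ w → Pos (mk -[1+ b ] w) ⊎ Pos (-ᵣ mk -[1+ b ] w)) (sym (ℤ.⊖-≥ (s≤s b≤a)))
      (go n -[1+ b ] (+ (a ∸ b)) (≤-trans (≤-reflexive (trans (cong suc (m+[n∸m]≡n b≤a)) refl)) (≤-trans (m≤m+n (suc a) b) (≤-trans (≤-reflexive (sym (+-suc a b))) le))))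
    opposite (inj₂ a<b) = nonpos ℤ.-≤+ (ℤ.≤-trans (ℤ.≤-reflexive (ℤ.⊖-< (s≤s a<b))) (ℤ.neg-mono-≤ (ℤ.+≤+ z≤n)))
  go (suc n) -[1+ a ] (+ suc b) (s≤s le) = back (opposite (≤-<-connex b a))
    where
    opposite : b ≤ a ⊎ a < b → Pos (mk (+ suc b) (-[1+ a ] ℤ.+ + suc b)) ⊎ Pos (-ᵣ mk (+ suc b) (-[1+ a ] ℤ.+ + suc b))
    opposite (inj₂ a<b) = nonneg (ℤ.+≤+ z≤n) (subst (0ℤ ℤ.≤_) (sym (ℤ.⊖-≥ (s≤s (<⇒≤ a<b)))) (ℤ.+≤+ z≤n))
    opposite (inj₁ b≤a) = smaller (ℕ.m≤n⇒m<n∨m≡n b≤a)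
      where
      smaller : b < a ⊎ b ≡ a → _
      smaller (inj₂ refl) = nonneg (ℤ.+≤+ z≤n) (ℤ.≤-reflexive (sym (ℤ.n⊖n≡0 (suc b))))
      smaller (inj₁ b<a) = subst (λ w → Pos (mk (+ suc b) w) ⊎ Pos (-ᵣ mk (+ suc b) w)) (sym (ℤ.⊖-< (s≤s b<a)))
        (go n (+ suc b) (ℤ.- + (a ∸ b)) (≤-trans (≤-reflexive (cong (suc b ℕ.+_) (ℤ.∣-i∣≡∣i∣ (+ (a ∸ b)))))
          (≤-trans (≤-reflexive (cong suc (m+[n∸m]≡n b≤a))) (≤-trans (m≤m+n (suc a) b) (≤-trans (≤-reflexive (sym (+-suc a b))) le)))))

ι-< : ∀ {m n} → m < n → ¬ Pos (ι m -ᵣ ι n)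
ι-< m<n p = <⇒≱ m<n (ι-cancel-≼ (≼⁺ p))

-- c < X φ is decided by the sign of the quadratic form c² - c X - X².
c≼Xφ : ∀ X c → c * c < c * X + X * X → ι c ≼ ι X *ᵣ φ
c≼Xφ X c lt = decide (Pos-total (ι X *ᵣ φ -ᵣ ι c))
  where
  conjugate-Pos : Pos (ι c +ᵣ ι X *ᵣ mk -[1+ 0 ] 1ℤ)
  conjugate-Pos = Pos-+ (Pos-ι c) (Pos-* (Pos-ι X) (1 , ℤ.+≤+ z≤n , ℤ.+≤+ z≤n))
  factor : -ᵣ (ι X *ᵣ φ -ᵣ ι c) *ᵣ (ι c +ᵣ ι X *ᵣ mk -[1+ 0 ] 1ℤ) ≡ ι (c * c) -ᵣ ι (c * X + X * X)
  factor = trans (solve 2 (λ x c → (⊝ (x ⊗ Κ φ ⊕ ⊝ c) ⊗ (c ⊕ x ⊗ Κ (mk -[1+ 0 ] 1ℤ))) ⊜ (c ⊗ c ⊕ ⊝ (c ⊗ x ⊕ x ⊗ x))) refl (ι X) (ι c))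
    (cong₂ (λ s t → s -ᵣ t) (sym (ι-* c c)) (sym (cong₂ _+ᵣ_ (ι-* c X) (ι-* X X))))
  decide : Pos (ι X *ᵣ φ -ᵣ ι c) ⊎ Pos (-ᵣ (ι X *ᵣ φ -ᵣ ι c)) → ι c ≼ ι X *ᵣ φ
  decide (inj₁ p) = ≼⁺ p
  decide (inj₂ p) = ⊥-elim (ι-< lt (subst Pos factor (Pos-* p conjugate-Pos)))

Xφ≼c : ∀ X c → c * X + X * X < c * c → ι X *ᵣ φ ≼ ι c
Xφ≼c X c lt = decide (Pos-total (ι c -ᵣ ι X *ᵣ φ))
  where
  conjugate-Pos : Pos (ι c +ᵣ ι X *ᵣ mk -[1+ 0 ] 1ℤ)
  conjugate-Pos = Pos-+ (Pos-ι c) (Pos-* (Pos-ι X) (1 , ℤ.+≤+ z≤n , ℤ.+≤+ z≤n))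
  factor : -ᵣ (ι c -ᵣ ι X *ᵣ φ) *ᵣ (ι c +ᵣ ι X *ᵣ mk -[1+ 0 ] 1ℤ) ≡ ι (c * X + X * X) -ᵣ ι (c * c)
  factor = trans (solve 2 (λ x c → (⊝ (c ⊕ ⊝ (x ⊗ Κ φ)) ⊗ (c ⊕ x ⊗ Κ (mk -[1+ 0 ] 1ℤ))) ⊜ ((c ⊗ x ⊕ x ⊗ x) ⊕ ⊝ (c ⊗ c))) refl (ι X) (ι c))
    (cong₂ (λ s t → s -ᵣ t) (sym (cong₂ _+ᵣ_ (ι-* c X) (ι-* X X))) (sym (ι-* c c)))
  decide : Pos (ι c -ᵣ ι X *ᵣ φ) ⊎ Pos (-ᵣ (ι c -ᵣ ι X *ᵣ φ)) → ι X *ᵣ φ ≼ ι c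
  decide (inj₁ p) = ≼⁺ p
  decide (inj₂ p) = ⊥-elim (ι-< lt (subst Pos factor (Pos-* p conjugate-Pos)))

-- st k l h e f asserts l 2ᵉ ≤ 2ᶠ bᵏ ≤ h 2ᵉ.
data State : Set where
  st : (k l h e f : ℕ) → State

record Encloses (b : ℤφ) (k l h e f : ℕ) : Set where
  constructor enc
  field
    lower : ι (l * 2 ^ e) ≼ ι (2 ^ f) *ᵣ b ^ᵣ k
    upper : ι (2 ^ f) *ᵣ b ^ᵣ k ≼ ι (h * 2 ^ e)

Valid : ℤφ → State → Set
Valid b (st k l h e f) = Encloses b k l h e f

infixl 7 _⊙_

_⊙_ : State → State → State
st k l h e f ⊙ st k′ l′ h′ e′ f′ = st (k + k′) (l * l′) (h * h′) (e + e′) (f + f′)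

⊙-valid : ∀ {b} s s′ → Pos b → Valid b s → Valid b s′ → Valid b (s ⊙ s′)
⊙-valid {b} (st k l h e f) (st k′ l′ h′ e′ f′) b≥0 (enc p q) (enc p′ q′) = enc
    (≼-trans (≼-reflexive (regroup l l′)) (≼-trans (*-mono-≼ (Pos-ι _) (Pos-ι _) p p′) (≼-reflexive powers)))
    (≼-trans (≼-reflexive (sym powers)) (≼-trans (*-mono-≼ (Pos-* (Pos-ι _) (Pos-^ k b≥0)) (Pos-* (Pos-ι _) (Pos-^ k′ b≥0)) q q′) (≼-reflexive (sym (regroup h h′)))))
  where
  regroup : ∀ m m′ → ι (m * m′ * 2 ^ (e + e′)) ≡ ι (m * 2 ^ e) *ᵣ ι (m′ * 2 ^ e′)
  regroup m m′ = trans (cong ι (trans (cong (m * m′ ℕ.*_) (^-distribˡ-+-* 2 e e′)) (ℕ.[m*n]*[o*p]≡[m*o]*[n*p] m m′ (2 ^ e) (2 ^ e′))))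
    (ι-* (m * 2 ^ e) (m′ * 2 ^ e′))
  powers : ι (2 ^ f) *ᵣ b ^ᵣ k *ᵣ (ι (2 ^ f′) *ᵣ b ^ᵣ k′) ≡ ι (2 ^ (f + f′)) *ᵣ b ^ᵣ (k + k′)
  powers = trans (solve 4 (λ p x q y → (p ⊗ x ⊗ (q ⊗ y)) ⊜ ((p ⊗ q) ⊗ (x ⊗ y))) refl (ι (2 ^ f)) (b ^ᵣ k) (ι (2 ^ f′)) (b ^ᵣ k′))
    (cong₂ _*ᵣ_ (trans (sym (ι-* (2 ^ f) (2 ^ f′))) (cong ι (sym (^-distribˡ-+-* 2 f f′)))) (sym (^-homo-* b k k′)))

-- Discards t bits with outward rounding; `D` is the value of 2ᵗ, supplied already evaluated.
cut : (D t : ℕ) .{{_ : NonZero D}} → State → State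
cut D t (st k l h e f) = st k (l / D) (suc (h / D)) (t + e) f

cut-valid : ∀ {b} D t .{{_ : NonZero D}} s → D ≡ 2 ^ t → Valid b s → Valid b (cut D t s)
cut-valid D t (st k l h e f) D≡ (enc p q) = enc
  (≼-trans (ι-mono (≤-trans (≤-reflexive (regroup (l / D))) (*-monoˡ-≤ (2 ^ e) (m/n*n≤m l D)))) p)
  (≼-trans q (ι-mono (≤-trans (*-monoˡ-≤ (2 ^ e) (<⇒≤ h<)) (≤-reflexive (sym (regroup (suc (h / D))))))))
  where
  regroup : ∀ m → m * 2 ^ (t + e) ≡ m * D * 2 ^ e
  regroup m = trans (cong (m ℕ.*_) (trans (^-distribˡ-+-* 2 t e) (cong (ℕ._* 2 ^ e) (sym D≡)))) (sym (ℕ.*-assoc m D (2 ^ e)))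
  h< : h < suc (h / D) * D
  h< = ≤-trans (s≤s (≤-reflexive (m≡m%n+[m/n]*n h D))) (+-monoˡ-< (h / D * D) (m%n<n h D))

module Machine (D₀ D₁ thr t : ℕ) .{{_ : NonZero D₀}} .{{_ : NonZero D₁}} where

  -- The product of two mantissas of t + 1 bits has 2 t + 1 or 2 t + 2 bits. The threshold,
  -- instantiated with 2^(2t+1), tells the two cases apart, so that about t + 1 bits remain.
  renormalise : State → State
  renormalise (st k l h e f) = if h <ᵇ thr then cut D₀ t (st k l h e f) else cut D₁ (suc t) (st k l h e f)

  step : State → Bool → State → State
  step base true s = renormalise (renormalise (s ⊙ s) ⊙ base)
  step base false s = renormalise (s ⊙ s)

  run : State → List Bool → State → State
  run base [] s = s
  run base (b ∷ bs) s = run base bs (step base b s)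

  shrink : ℕ → State → State
  shrink zero s = s
  shrink (suc n) (st k l h e f) = if h <ᵇ D₁ then st k l h e f else shrink n (cut 2 1 (st k l h e f))

  module _ (D₀≡ : D₀ ≡ 2 ^ t) (D₁≡ : D₁ ≡ 2 ^ suc t) {b : ℤφ} (b≥0 : Pos b) where

    renormalise-valid : ∀ s → Valid b s → Valid b (renormalise s)
    renormalise-valid (st k l h e f) ok with h <ᵇ thr
    ... | true = cut-valid D₀ t (st k l h e f) D₀≡ ok
    ... | false = cut-valid D₁ (suc t) (st k l h e f) D₁≡ ok

    step-valid : ∀ base c s → Valid b base → Valid b s → Valid b (step base c s)
    step-valid base true s okb ok = renormalise-valid (renormalise (s ⊙ s) ⊙ base)
      (⊙-valid (renormalise (s ⊙ s)) base b≥0 (renormalise-valid (s ⊙ s) (⊙-valid s s b≥0 ok ok)) okb)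
    step-valid base false s okb ok = renormalise-valid (s ⊙ s) (⊙-valid s s b≥0 ok ok)

    run-valid : ∀ base bs s → Valid b base → Valid b s → Valid b (run base bs s)
    run-valid base [] s okb ok = ok
    run-valid base (c ∷ bs) s okb ok = run-valid base bs (step base c s) okb (step-valid base c s okb ok)

    shrink-valid : ∀ n s → Valid b s → Valid b (shrink n s)
    shrink-valid zero s ok = ok
    shrink-valid (suc n) (st k l h e f) ok with h <ᵇ D₁
    ... | true = ok
    ... | false = shrink-valid n (cut 2 1 (st k l h e f)) (cut-valid 2 1 (st k l h e f) refl ok)

-- The binary digits of n after the leading one, most significant first.
digits : ℕ → ℕ → List Bool → List Bool
digits zero n acc = acc
digits (suc fuel) n acc = if n ≤ᵇ 1 then acc else digits fuel (n / 2) ((n % 2 ≡ᵇ 1) ∷ acc)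

-- Started at (1 , 0), the result is (F (d - 1) , F d) with F (-1) = 1.
fib-pair : ℕ → ℕ → ℕ → ℕ × ℕ
fib-pair zero x y = x , y
fib-pair (suc d) x y = fib-pair d y (x + y)

fib-pair-φ : ∀ d x y → φ ^ᵣ d *ᵣ mk (+ x) (+ y) ≡ mk (+ proj₁ (fib-pair d x y)) (+ proj₂ (fib-pair d x y))
fib-pair-φ zero x y = *-identityˡ _
fib-pair-φ (suc d) x y = trans (solve 3 (λ f w z → (f ⊗ w ⊗ z) ⊜ (w ⊗ (f ⊗ z))) refl φ (φ ^ᵣ d) (mk (+ x) (+ y)))
  (trans (cong (φ ^ᵣ d *ᵣ_) (cong₂ mk (lem₁ (+ x) (+ y)) (lem₂ (+ x) (+ y)))) (fib-pair-φ d y (x + y)))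
  where
  lem₁ : ∀ a b → 0ℤ ℤ.* a ℤ.+ 1ℤ ℤ.* b ≡ b
  lem₁ = solve-∀
  lem₂ : ∀ a b → 0ℤ ℤ.* b ℤ.+ 1ℤ ℤ.* a ℤ.+ 1ℤ ℤ.* b ≡ a ℤ.+ b
  lem₂ = solve-∀

-- An enclosure of x + y φ scaled by X = 2ᶠ, where c < X φ < c + 1.
linear-state : ℕ → ℕ → ℕ × ℕ → ℕ → State
linear-state X c (x , y) f = st 1 (x * X + y * c) (x * X + y * suc c) 0 f

φ-bounded : ℕ → ℕ → Bool
φ-bounded X c = (c * c <ᵇ c * X + X * X) ∧ (suc c * X + X * X <ᵇ suc c * suc c)

∧-split : ∀ {x y} → x ∧ y ≡ true → x ≡ true × y ≡ true
∧-split {true} eq = refl , eq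

true⇒T : ∀ {b} → b ≡ true → IsTrue b
true⇒T refl = _

<ᵇ-sound : ∀ m n → (m <ᵇ n) ≡ true → m < n
<ᵇ-sound m n eq = ℕ.<ᵇ⇒< m n (true⇒T eq)

≤ᵇ-sound : ∀ m n → (m ≤ᵇ n) ≡ true → m ≤ n
≤ᵇ-sound m n eq = ℕ.≤ᵇ⇒≤ m n (true⇒T eq)

≡ᵇ-sound : ∀ m n → (m ≡ᵇ n) ≡ true → m ≡ n
≡ᵇ-sound m n eq = ℕ.≡ᵇ⇒≡ m n (true⇒T eq)

linear-valid : ∀ X c f u → X ≡ 2 ^ f → φ-bounded X c ≡ true →
  Valid (mk (+ proj₁ u) (+ proj₂ u)) (linear-state X c u f)
linear-valid X c f (x , y) X≡ ok = enc
    (≼-trans (≼-trans (≼-reflexive (expand c)) (+-mono-≼ {ι x *ᵣ ι X} ≼-refl (*-monoˡ-≼ (Pos-ι y) (c≼Xφ X c (<ᵇ-sound _ _ (proj₁ (∧-split ok))))))) (≼-reflexive value))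
    (≼-trans (≼-reflexive (sym value)) (≼-trans (+-mono-≼ {ι x *ᵣ ι X} ≼-refl (*-monoˡ-≼ (Pos-ι y) (Xφ≼c X (suc c) (<ᵇ-sound _ _ (proj₂ (∧-split {c * c <ᵇ c * X + X * X} ok)))))) (≼-reflexive (sym (expand (suc c))))))
  where
  expand : ∀ c → ι ((x * X + y * c) * 1) ≡ ι x *ᵣ ι X +ᵣ ι y *ᵣ ι c
  expand c = trans (cong ι (ℕ.*-identityʳ _)) (cong₂ _+ᵣ_ (ι-* x X) (ι-* y c))
  split : mk (+ x) (+ y) ≡ ι x +ᵣ ι y *ᵣ φ
  split = cong₂ mk (lem₁ (+ x) (+ y)) (lem₂ (+ y))
    where
    lem₁ : ∀ a b → a ≡ a ℤ.+ (b ℤ.* 0ℤ ℤ.+ 0ℤ ℤ.* 1ℤ)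
    lem₁ = solve-∀
    lem₂ : ∀ b → b ≡ 0ℤ ℤ.+ (b ℤ.* 1ℤ ℤ.+ 0ℤ ℤ.* 0ℤ ℤ.+ 0ℤ ℤ.* 1ℤ)
    lem₂ = solve-∀
  value : ι x *ᵣ ι X +ᵣ ι y *ᵣ (ι X *ᵣ φ) ≡ ι (2 ^ f) *ᵣ (mk (+ x) (+ y) *ᵣ 1ᵣ)
  value = trans (solve 4 (λ x X y p → (x ⊗ X ⊕ y ⊗ (X ⊗ p)) ⊜ (X ⊗ ((x ⊕ y ⊗ p) ⊗ Κ 1ᵣ))) refl (ι x) (ι X) (ι y) φ)
    (cong₂ _*ᵣ_ (cong ι X≡) (cong (_*ᵣ 1ᵣ) (sym split)))

-- 2ᵖ ≤ φ^q ≤ 2ᵖ (1 + 2^-Λ)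
record Close (q p Λ₀ : ℕ) : Set where
  constructor close
  field
    close-lower : ι (2 ^ p) ≼ φ ^ᵣ q
    close-upper : ι (2 ^ Λ₀) *ᵣ (φ ^ᵣ q -ᵣ ι (2 ^ p)) ≼ ι (2 ^ p)

ι-cancelˡ : ∀ m {x y} → 1 ≤ m → ι m *ᵣ x ≼ ι m *ᵣ y → x ≼ y
ι-cancelˡ (suc m) _ p = ι*-cancel-≼ m p

-- On the scale of the mantissas, 2ᵖ becomes 2ʷ. The test `e + w ≡ᵇ f + p` ensures that the
-- subtraction defining w was not truncated.
close-verify : State → ℕ → ℕ → ℕ → Bool
close-verify (st k l h e f) q p Λ₀ = let w = f + p ∸ e in
  (k ≡ᵇ q) ∧ (e + w ≡ᵇ f + p) ∧ (2 ^ w ≤ᵇ l) ∧ (2 ^ Λ₀ * h ≤ᵇ suc (2 ^ Λ₀) * 2 ^ w)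

close-sound : ∀ s q p Λ₀ → Valid φ s → close-verify s q p Λ₀ ≡ true → Close q p Λ₀
close-sound (st k l h e f) q p Λ₀ (enc lower upper) ok = assemble (∧-split ok)
  where
  w : ℕ
  w = f + p ∸ e
  power : e + w ≡ f + p → 2 ^ w * 2 ^ e ≡ 2 ^ f * 2 ^ p
  power eq = trans (ℕ.*-comm (2 ^ w) (2 ^ e)) (trans (sym (^-distribˡ-+-* 2 e w)) (trans (cong (2 ℕ.^_) eq) (^-distribˡ-+-* 2 f p)))
  build : k ≡ q → e + w ≡ f + p → 2 ^ w ≤ l → 2 ^ Λ₀ * h ≤ suc (2 ^ Λ₀) * 2 ^ w → Close q p Λ₀
  build refl eq w≤l h≤ = close
    (ι-cancelˡ (2 ^ f) (m^n>0 2 f) (≼-trans (≼-reflexive (trans (sym (ι-* (2 ^ f) (2 ^ p))) (cong ι (sym (power eq)))))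
      (≼-trans (ι-mono (*-monoˡ-≤ (2 ^ e) w≤l)) lower)))
    (ι-cancelˡ (2 ^ f) (m^n>0 2 f) (≼⁺ (subst Pos
      (solve 4 (λ f L x p → ((Κ 1ᵣ ⊕ L) ⊗ (f ⊗ p) ⊕ ⊝ (L ⊗ (f ⊗ x))) ⊜ (f ⊗ p ⊕ ⊝ (f ⊗ (L ⊗ (x ⊕ ⊝ p))))) refl (ι (2 ^ f)) (ι (2 ^ Λ₀)) (φ ^ᵣ k) (ι (2 ^ p)))
      (_≼_.≼⁻ upper′))))
    where
    upper′ : ι (2 ^ Λ₀) *ᵣ (ι (2 ^ f) *ᵣ φ ^ᵣ k) ≼ ι (suc (2 ^ Λ₀)) *ᵣ (ι (2 ^ f) *ᵣ ι (2 ^ p))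
    upper′ = ≼-trans (*-monoˡ-≼ (Pos-ι (2 ^ Λ₀)) upper)
      (≼-trans (≼-reflexive (trans (sym (ι-* (2 ^ Λ₀) (h * 2 ^ e))) (cong ι (sym (ℕ.*-assoc (2 ^ Λ₀) h (2 ^ e))))))
      (≼-trans (ι-mono (*-monoˡ-≤ (2 ^ e) h≤))
        (≼-reflexive (trans (cong ι (trans (ℕ.*-assoc (suc (2 ^ Λ₀)) (2 ^ w) (2 ^ e)) (cong (suc (2 ^ Λ₀) ℕ.*_) (power eq))))
          (trans (ι-* (suc (2 ^ Λ₀)) (2 ^ f * 2 ^ p)) (cong (ι (suc (2 ^ Λ₀)) *ᵣ_) (ι-* (2 ^ f) (2 ^ p))))))))
  assemble : (k ≡ᵇ q) ≡ true × ((e + w ≡ᵇ f + p) ∧ (2 ^ w ≤ᵇ l) ∧ (2 ^ Λ₀ * h ≤ᵇ suc (2 ^ Λ₀) * 2 ^ w)) ≡ true → Close q p Λ₀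
  assemble (k≡ , rest) =
    let e≡ , rest′ = ∧-split {e + w ≡ᵇ f + p} rest
        w≤ , h≤ = ∧-split {2 ^ w ≤ᵇ l} rest′
    in build (≡ᵇ-sound k q k≡) (≡ᵇ-sound (e + w) (f + p) e≡) (≤ᵇ-sound (2 ^ w) l w≤) (≤ᵇ-sound (2 ^ Λ₀ * h) _ h≤)

-- G^Q / √5^Q differs from every power of 2 by a factor at least 1 + 4/2ᶜ.
record Separated (G : ℤφ) (Q′ c : ℕ) : Set where
  constructor separated
  field
    A B : ℕ
    above : ι (2 ^ A * (2 ^ c + 4)) *ᵣ ι 5 ^ᵣ Q′ ≼ ι (2 ^ B * 2 ^ c) *ᵣ G ^ᵣ (Q′ + Q′)
    below : ι (2 ^ B * (2 ^ c + 4)) *ᵣ G ^ᵣ (Q′ + Q′) ≼ ι (2 ^ suc A * 2 ^ c) *ᵣ ι 5 ^ᵣ Q′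

-- The quotient of two normalised mantissas lies between 1/2 and 2. With b = 1 or b = 2 it is moved
-- into the interval from 1 to 2, and it must stay away from both ends by the factor 1 + 4/C.
sep-mantissas : (C b l h l₅ h₅ : ℕ) → Bool
sep-mantissas C b l h l₅ h₅ = (h₅ * (C + 4) ≤ᵇ b * C * l) ∧ (b * (C + 4) * h ≤ᵇ 2 * C * l₅)

sep-verify : State → State → ℕ → ℕ → Bool
sep-verify (st k l h e f) (st k₅ l₅ h₅ e₅ f₅) Q′ c = (k ≡ᵇ Q′ + Q′) ∧ (k₅ ≡ᵇ Q′) ∧
  (sep-mantissas (2 ^ c) 1 l h l₅ h₅ ∨ sep-mantissas (2 ^ c) 2 l h l₅ h₅)

∨-split : ∀ {x y} → x ∨ y ≡ true → x ≡ true ⊎ y ≡ true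
∨-split {true} _ = inj₁ refl
∨-split {false} eq = inj₂ eq

ι-*₂ : ∀ m n x → ι (m * n) *ᵣ x ≡ ι m *ᵣ (ι n *ᵣ x)
ι-*₂ m n x = trans (cong (_*ᵣ x) (ι-* m n)) (*-assoc (ι m) (ι n) x)

sep-sound : ∀ {G} s s₅ Q′ c → Pos G → Valid G s → Valid (ι 5) s₅ → sep-verify s s₅ Q′ c ≡ true → Separated G Q′ c
sep-sound {G} (st k l h e f) (st k₅ l₅ h₅ e₅ f₅) Q′ c G≥0 (enc lower upper) (enc lower₅ upper₅) ok = assemble (∧-split ok)
  where
  C : ℕ
  C = 2 ^ c
  build : k ≡ Q′ + Q′ → k₅ ≡ Q′ → ∀ β → sep-mantissas C (2 ^ β) l h l₅ h₅ ≡ true → Separated G Q′ c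
  build refl refl β ok = separated (e + f₅) (e₅ + f + β) above below
    where
    b : ℕ
    b = 2 ^ β
    ineqs : (h₅ * (C + 4) ≤ᵇ b * C * l) ≡ true × (b * (C + 4) * h ≤ᵇ 2 * C * l₅) ≡ true
    ineqs = ∧-split ok
    2^B : ∀ n → 2 ^ (e₅ + f + β) * n ≡ 2 ^ e₅ * (b * n) * 2 ^ f
    2^B n = trans (cong (ℕ._* n) (trans (^-distribˡ-+-* 2 (e₅ + f) β) (cong (ℕ._* b) (^-distribˡ-+-* 2 e₅ f))))
      (lem (2 ^ e₅) (2 ^ f) b n)
      where
      lem : ∀ x y b n → x * y * b * n ≡ x * (b * n) * y
      lem = ℕ-solve-∀
    2^A : ∀ n → 2 ^ (e + f₅) * n ≡ 2 ^ e * n * 2 ^ f₅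
    2^A n = trans (cong (ℕ._* n) (^-distribˡ-+-* 2 e f₅)) (lem (2 ^ e) (2 ^ f₅) n)
      where
      lem : ∀ x y n → x * y * n ≡ x * n * y
      lem = ℕ-solve-∀
    reorder : ∀ x n y z m → n * y ≤ m * z → ∀ w → x * n * (y * w) ≤ w * m * (z * x)
    reorder x n y z m le w = ≤-trans (≤-reflexive (lem₁ x n y w)) (≤-trans (*-monoʳ-≤ (x * w) le) (≤-reflexive (lem₂ x z m w)))
      where
      lem₁ : ∀ x n y w → x * n * (y * w) ≡ x * w * (n * y)
      lem₁ = ℕ-solve-∀
      lem₂ : ∀ x z m w → x * w * (m * z) ≡ w * m * (z * x)
      lem₂ = ℕ-solve-∀
    above : ι (2 ^ (e + f₅) * (C + 4)) *ᵣ ι 5 ^ᵣ k₅ ≼ ι (2 ^ (e₅ + f + β) * C) *ᵣ G ^ᵣ k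
    above = ≼-trans (≼-reflexive (trans (cong (λ n → ι n *ᵣ ι 5 ^ᵣ k₅) (2^A (C + 4))) (ι-*₂ (2 ^ e * (C + 4)) (2 ^ f₅) (ι 5 ^ᵣ k₅))))
      (≼-trans (*-monoˡ-≼ (Pos-ι _) upper₅)
      (≼-trans (≼-reflexive (sym (ι-* (2 ^ e * (C + 4)) (h₅ * 2 ^ e₅))))
      (≼-trans (ι-mono (reorder (2 ^ e) (C + 4) h₅ l (b * C)
          (≤-trans (≤-reflexive (ℕ.*-comm (C + 4) h₅)) (≤ᵇ-sound _ _ (proj₁ ineqs))) (2 ^ e₅)))
      (≼-trans (≼-reflexive (ι-* (2 ^ e₅ * (b * C)) (l * 2 ^ e)))
      (≼-trans (*-monoˡ-≼ (Pos-ι _) lower)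
        (≼-reflexive (trans (sym (ι-*₂ (2 ^ e₅ * (b * C)) (2 ^ f) (G ^ᵣ k))) (cong (λ n → ι n *ᵣ G ^ᵣ k) (sym (2^B C))))))))))
    below : ι (2 ^ (e₅ + f + β) * (C + 4)) *ᵣ G ^ᵣ k ≼ ι (2 ^ suc (e + f₅) * C) *ᵣ ι 5 ^ᵣ k₅
    below = ≼-trans (≼-reflexive (trans (cong (λ n → ι n *ᵣ G ^ᵣ k) (2^B (C + 4))) (ι-*₂ (2 ^ e₅ * (b * (C + 4))) (2 ^ f) (G ^ᵣ k))))
      (≼-trans (*-monoˡ-≼ (Pos-ι _) upper)
      (≼-trans (≼-reflexive (sym (ι-* (2 ^ e₅ * (b * (C + 4))) (h * 2 ^ e))))
      (≼-trans (ι-mono (reorder (2 ^ e₅) (b * (C + 4)) h l₅ (2 * C) (≤ᵇ-sound _ _ (proj₂ ineqs)) (2 ^ e)))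
      (≼-trans (≼-reflexive (ι-* (2 ^ e * (2 * C)) (l₅ * 2 ^ e₅)))
      (≼-trans (*-monoˡ-≼ (Pos-ι _) lower₅)
        (≼-reflexive (trans (sym (ι-*₂ (2 ^ e * (2 * C)) (2 ^ f₅) (ι 5 ^ᵣ k₅)))
          (cong (λ n → ι n *ᵣ ι 5 ^ᵣ k₅) (trans (sym (2^A (2 * C))) (lem (2 ^ (e + f₅)) C))))))))))
      where
      lem : ∀ x C → x * (2 * C) ≡ 2 * x * C
      lem = ℕ-solve-∀
  assemble : (k ≡ᵇ Q′ + Q′) ≡ true × ((k₅ ≡ᵇ Q′) ∧ (sep-mantissas C 1 l h l₅ h₅ ∨ sep-mantissas C 2 l h l₅ h₅)) ≡ true → Separated G Q′ c
  assemble (k≡ , rest) =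
    let k₅≡ , rest′ = ∧-split {k₅ ≡ᵇ Q′} rest
        k≡′ = ≡ᵇ-sound k (Q′ + Q′) k≡
        k₅≡′ = ≡ᵇ-sound k₅ Q′ k₅≡
    in [ build k≡′ k₅≡′ 0 , build k≡′ k₅≡′ 1 ]′ (∨-split rest′)

-- Reduction by raising to a power

-- (1 + 1/M)ⁿ ≤ 1 + 1/K, by Bernoulli's inequality in the form with d = M + 1 - n.
power-ratio : ∀ M K n → 2 * n * K ≤ M → 1 ≤ K → suc M ^ n * K ≤ M ^ n * suc K
power-ratio M K n le 1≤K = *-cancelʳ-≤ _ _ d {{ℕ.>-nonZero d>0}} (begin
  suc M ^ n * K * d ≡⟨ lem₁ (suc M ^ n) K d ⟩
  suc M ^ n * d * K ≤⟨ *-monoˡ-≤ K (bernoulli M n d n+d≡) ⟩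
  M ^ n * suc M * K ≡⟨ ℕ.*-assoc (M ^ n) (suc M) K ⟩
  M ^ n * (suc M * K) ≤⟨ *-monoʳ-≤ (M ^ n) weights ⟩
  M ^ n * (suc K * d) ≡⟨ sym (ℕ.*-assoc (M ^ n) (suc K) d) ⟩
  M ^ n * suc K * d ∎)
  where
  open ℕ.≤-Reasoning
  d : ℕ
  d = suc M ∸ n
  lem₁ : ∀ x K d → x * K * d ≡ x * d * K
  lem₁ = ℕ-solve-∀
  nK+n≤M : n * K + n ≤ M
  nK+n≤M = ≤-trans (+-monoʳ-≤ (n * K) (m≤m*n n K {{ℕ.>-nonZero 1≤K}})) (≤-trans (≤-reflexive (lem n K)) le)
    where
    lem : ∀ n K → n * K + n * K ≡ 2 * n * K
    lem = ℕ-solve-∀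
  n≤M : n ≤ M
  n≤M = ≤-trans (m≤n+m n (n * K)) nK+n≤M
  d>0 : 0 < d
  d>0 = ℕ.m<n⇒0<n∸m (s≤s n≤M)
  n+d≡ : n + d ≡ suc M
  n+d≡ = m+[n∸m]≡n (ℕ.m≤n⇒m≤1+n n≤M)
  weights : suc M * K ≤ suc K * d
  weights = +-cancelˡ-≤ (suc K * n) _ _ (≤-trans (≤-reflexive (cong (ℕ._+ suc M * K) (lem₂ K n)))
      (≤-trans (+-monoˡ-≤ (suc M * K) (≤-trans nK+n≤M (n≤1+n M)))
        (≤-reflexive (trans (lem₃ M K) (trans (cong (suc K ℕ.*_) (sym n+d≡)) (*-distribˡ-+ (suc K) n d))))))
    where
    lem₂ : ∀ K n → suc K * n ≡ n * K + n
    lem₂ = ℕ-solve-∀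
    lem₃ : ∀ M K → suc M + suc M * K ≡ suc K * suc M
    lem₃ = ℕ-solve-∀

power-≼ : ∀ {x y} M K n → Pos x → Pos y → 1 ≤ M → 1 ≤ K → 2 * n * K ≤ M →
  ι M *ᵣ x ≼ ι (suc M) *ᵣ y → ι K *ᵣ x ^ᵣ n ≼ ι (suc K) *ᵣ y ^ᵣ n
power-≼ {x} {y} M K n x≥0 y≥0 1≤M 1≤K le p = ι-cancelˡ (M ^ n) (m^n>0 M {{ℕ.>-nonZero 1≤M}} n)
  (≼-trans (≼-reflexive (trans (solve 3 (λ m k x → (m ⊗ (k ⊗ x)) ⊜ (k ⊗ (m ⊗ x))) refl (ι (M ^ n)) (ι K) (x ^ᵣ n)) (cong (ι K *ᵣ_) (merge M x))))
  (≼-trans (*-monoˡ-≼ (Pos-ι K) (^-mono-≼ n (Pos-* (Pos-ι M) x≥0) p))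
  (≼-trans (≼-reflexive (trans (cong (ι K *ᵣ_) (sym (merge (suc M) y))) (trans (solve 3 (λ k m y → (k ⊗ (m ⊗ y)) ⊜ (m ⊗ k ⊗ y)) refl (ι K) (ι (suc M ^ n)) (y ^ᵣ n))
      (cong (_*ᵣ y ^ᵣ n) (sym (ι-* (suc M ^ n) K))))))
  (≼-trans (*-monoʳ-≼ (Pos-^ n y≥0) (ι-mono (power-ratio M K n le 1≤K)))
    (≼-reflexive (ι-*₂ (M ^ n) (suc K) (y ^ᵣ n)))))))
  where
  merge : ∀ M x → ι (M ^ n) *ᵣ x ^ᵣ n ≡ (ι M *ᵣ x) ^ᵣ n
  merge M x = trans (cong (_*ᵣ x ^ᵣ n) (ι-^ M n)) (sym (^-distrib-* (ι M) x n))

2≼√5 : ι 2 ≼ √5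
2≼√5 = ≼⁺ (3 , ℤ.+≤+ z≤n , ℤ.+≤+ z≤n)

Approx : ℕ → ℕ → ℤφ → Set
Approx w a X = Bd (ι (2 ^ w) *ᵣ (√5 *ᵣ ι (2 ^ a) -ᵣ X)) (ι (2 ^ a))

module PowerReduction {w a X} (approx : Approx w a X) where

  M W : ℕ
  M = 2 ^ w
  W = 2 ^ a
  Z : ℤφ
  Z = √5 *ᵣ ι W

  Z-Pos : Pos Z
  Z-Pos = Pos-* √5-Pos (Pos-ι W)

  2W≼Z : ι 2 *ᵣ ι W ≼ Z
  2W≼Z = *-monoʳ-≼ (Pos-ι W) 2≼√5

  W≼Z : ι W ≼ Z
  W≼Z = ≼-trans (≼-trans (ι-mono (m≤n*m W 2)) (≼-reflexive (ι-* 2 W))) 2W≼Z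

  X≼ : ι M *ᵣ X ≼ ι (suc M) *ᵣ Z
  X≼ = ≼-trans (≼⁺ (subst Pos (solve 4 (λ m z x w → (w ⊕ (m ⊗ (z ⊕ ⊝ x))) ⊜ ((m ⊗ z ⊕ w) ⊕ ⊝ (m ⊗ x))) refl (ι M) Z X (ι W)) (Bd.above approx)))
    (≼-trans (+-mono-≼ {ι M *ᵣ Z} ≼-refl W≼Z) (≼-reflexive (solve 2 (λ m z → (m ⊗ z ⊕ z) ⊜ ((Κ 1ᵣ ⊕ m) ⊗ z)) refl (ι M) Z)))

  MZ≼ : ι M *ᵣ Z ≼ ι M *ᵣ X +ᵣ ι W
  MZ≼ = ≼⁺ (subst Pos (solve 4 (λ m z x w → (w ⊕ ⊝ (m ⊗ (z ⊕ ⊝ x))) ⊜ ((m ⊗ x ⊕ w) ⊕ ⊝ (m ⊗ z))) refl (ι M) Z X (ι W)) (Bd.below approx))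

  W≼X : ι W ≼ X
  W≼X = ι-cancelˡ M (m^n>0 2 w) (≼⁺ (subst Pos
    (solve 4 (λ m z x w → (((m ⊗ x ⊕ w) ⊕ ⊝ (m ⊗ z)) ⊕ (m ⊗ (z ⊕ ⊝ (Κ (ι 2) ⊗ w)) ⊕ (m ⊕ ⊝ Κ 1ᵣ) ⊗ w)) ⊜ (m ⊗ x ⊕ ⊝ (m ⊗ w))) refl (ι M) Z X (ι W))
    (Pos-+ (_≼_.≼⁻ MZ≼) (Pos-+ (Pos-* (Pos-ι M) (_≼_.≼⁻ 2W≼Z)) (Pos-* (_≼_.≼⁻ (ι-mono (m^n>0 2 w))) (Pos-ι W))))))

  X-Pos : Pos X
  X-Pos = Pos-mono (Pos-ι W) W≼X

  Z≼ : ι M *ᵣ Z ≼ ι (suc M) *ᵣ X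
  Z≼ = ≼-trans MZ≼ (≼-trans (+-mono-≼ {ι M *ᵣ X} ≼-refl W≼X) (≼-reflexive (solve 2 (λ m z → (m ⊗ z ⊕ z) ⊜ ((Κ 1ᵣ ⊕ m) ⊗ z)) refl (ι M) X)))

  module _ (Q′ K : ℕ) (1≤K : 1 ≤ K) (large : 2 * (Q′ + Q′) * K ≤ M) where

    Q : ℕ
    Q = Q′ + Q′

    -- The exponent Q is even so that √5 disappears; this is why the constants are stored as halves.
    Z^Q : Z ^ᵣ Q ≡ ι 5 ^ᵣ Q′ *ᵣ ι (2 ^ (a * Q))
    Z^Q = trans (^-distrib-* √5 (ι W) Q) (cong₂ _*ᵣ_ (trans (^-homo-* √5 Q′ Q′) (sym (^-distrib-* √5 √5 Q′)))
      (trans (sym (ι-^ W Q)) (cong ι (^-*-assoc 2 a Q))))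

    X^Q≼ : ι K *ᵣ X ^ᵣ Q ≼ ι (suc K) *ᵣ (ι 5 ^ᵣ Q′ *ᵣ ι (2 ^ (a * Q)))
    X^Q≼ = subst (λ z → ι K *ᵣ X ^ᵣ Q ≼ ι (suc K) *ᵣ z) Z^Q (power-≼ M K Q X-Pos Z-Pos (m^n>0 2 w) 1≤K large X≼)

    Z^Q≼ : ι K *ᵣ (ι 5 ^ᵣ Q′ *ᵣ ι (2 ^ (a * Q))) ≼ ι (suc K) *ᵣ X ^ᵣ Q
    Z^Q≼ = subst (λ z → ι K *ᵣ z ≼ ι (suc K) *ᵣ X ^ᵣ Q) Z^Q (power-≼ M K Q Z-Pos X-Pos (m^n>0 2 w) 1≤K large Z≼)

close-power-lower : ∀ {q p Λ₀} → Close q p Λ₀ → ∀ N → ι (2 ^ (p * N)) ≼ (φ ^ᵣ q) ^ᵣ N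
close-power-lower {q} {p} c N = ≼-trans (≼-reflexive (trans (cong ι (sym (^-*-assoc 2 p N))) (ι-^ (2 ^ p) N)))
  (^-mono-≼ N (Pos-ι (2 ^ p)) (Close.close-lower c))

close-power-upper : ∀ {q p Λ₀} → Close q p Λ₀ → ∀ N K → 1 ≤ K → 2 * N * K ≤ 2 ^ Λ₀ →
  ι K *ᵣ (φ ^ᵣ q) ^ᵣ N ≼ ι (suc K) *ᵣ ι (2 ^ (p * N))
close-power-upper {q} {p} {Λ₀} c N K 1≤K le = ≼-trans
  (power-≼ (2 ^ Λ₀) K N (Pos-^ q Pos-φ) (Pos-ι (2 ^ p)) (m^n>0 2 Λ₀) 1≤K le
    (≼⁺ (subst Pos (solve 3 (λ l x p → (p ⊕ ⊝ (l ⊗ (x ⊕ ⊝ p))) ⊜ ((Κ 1ᵣ ⊕ l) ⊗ p ⊕ ⊝ (l ⊗ x))) refl (ι (2 ^ Λ₀)) (φ ^ᵣ q) (ι (2 ^ p)))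
      (_≼_.≼⁻ (Close.close-upper c)))))
  (≼-reflexive (cong (ι (suc K) *ᵣ_) (trans (sym (ι-^ (2 ^ p) N)) (cong ι (^-*-assoc 2 p N)))))

φ^-swap : ∀ Q N → (φ ^ᵣ N) ^ᵣ Q ≡ (φ ^ᵣ Q) ^ᵣ N
φ^-swap Q N = trans (^-assocʳ φ N Q) (trans (cong (φ ^ᵣ_) (ℕ.*-comm N Q)) (sym (^-assocʳ φ Q N)))

2^-double : ∀ {m n} → m < n → 2 * 2 ^ m ≤ 2 ^ n
2^-double = ^-monoʳ-≤ 2

module Reduction {w a N G Q′ P λ₀ c} (approx : Approx w a (φ ^ᵣ N *ᵣ G)) (Q-close : Close (Q′ + Q′) P λ₀)
  (large : 2 * (Q′ + Q′) * 2 ^ c ≤ 2 ^ w) where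

  open PowerReduction {w} {a} {φ ^ᵣ N *ᵣ G} approx using (X^Q≼; Z^Q≼)

  Q K s H : ℕ
  Q = Q′ + Q′
  K = 2 ^ c
  s = 2 ^ (a * Q)
  H = 5 ^ Q′

  1≤K : 1 ≤ K
  1≤K = m^n>0 2 c

  f g : ℤφ
  f = (φ ^ᵣ Q) ^ᵣ N
  g = G ^ᵣ Q

  X^Q : (φ ^ᵣ N *ᵣ G) ^ᵣ Q ≡ f *ᵣ g
  X^Q = trans (^-distrib-* (φ ^ᵣ N) G Q) (cong (_*ᵣ g) (φ^-swap Q N))

  fg≼ : ι K *ᵣ (f *ᵣ g) ≼ ι (suc K) *ᵣ (ι H *ᵣ ι s)
  fg≼ = subst₂ (λ x h → ι K *ᵣ x ≼ ι (suc K) *ᵣ (h *ᵣ ι s)) X^Q (sym (ι-^ 5 Q′)) (X^Q≼ Q′ K 1≤K large)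

  ≼fg : ι K *ᵣ (ι H *ᵣ ι s) ≼ ι (suc K) *ᵣ (f *ᵣ g)
  ≼fg = subst₂ (λ x h → ι K *ᵣ (h *ᵣ ι s) ≼ ι (suc K) *ᵣ x) X^Q (sym (ι-^ 5 Q′)) (Z^Q≼ Q′ K 1≤K large)

  -- Both φ^(Q N) ≈ 2^(P N) and the Q-th power of the approximation are accurate up to the factor 1
  -- + 1/K. Comparing exponents, either s 2ᴮ ≤ t 2ᴬ, against `above`, or already 2 t 2ᴬ ≤ s 2ᴮ,
  -- against `below`. At most (1 + 1/K)² is lost, which is less than the margin 1 + 4/K.
  not-separated : Pos G → 2 * N * K ≤ 2 ^ λ₀ → ¬ Separated G Q′ c
  not-separated G≥0 N-small (separated A B above below) =
      [ case₁ , case₂ ]′ (≤-<-connex (a * Q + B) (P * N + A))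
    where
    t 2ᴬ 2ᴮ : ℕ
    t = 2 ^ (P * N)
    2ᴬ = 2 ^ A
    2ᴮ = 2 ^ B
    g-Pos : Pos g
    g-Pos = Pos-^ Q G≥0
    above′ : ι (2ᴬ * (K + 4)) *ᵣ ι H ≼ ι 2ᴮ *ᵣ ι K *ᵣ g
    above′ = subst₂ (λ h b → ι (2ᴬ * (K + 4)) *ᵣ h ≼ b *ᵣ g) (sym (ι-^ 5 Q′)) (ι-* 2ᴮ K) above
    below′ : ι (2ᴮ * (K + 4)) *ᵣ g ≼ ι (2 * 2ᴬ * K) *ᵣ ι H
    below′ = subst (λ h → ι (2ᴮ * (K + 4)) *ᵣ g ≼ ι (2 * 2ᴬ * K) *ᵣ h) (sym (ι-^ 5 Q′)) below
    t≼f : ι t ≼ f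
    t≼f = close-power-lower Q-close N
    f≼t : ι K *ᵣ f ≼ ι (suc K) *ᵣ ι t
    f≼t = close-power-upper Q-close N K 1≤K N-small
    tg≼ : ι K *ᵣ (ι t *ᵣ g) ≼ ι (suc K) *ᵣ (ι H *ᵣ ι s)
    tg≼ = ≼-trans (*-monoˡ-≼ (Pos-ι K) (*-monoʳ-≼ g-Pos t≼f)) fg≼
    ≼tg : ι K *ᵣ (ι K *ᵣ (ι H *ᵣ ι s)) ≼ ι (suc K) *ᵣ (ι (suc K) *ᵣ ι t *ᵣ g)
    ≼tg = ≼-trans (*-monoˡ-≼ (Pos-ι K) ≼fg)
      (≼-trans (≼-reflexive (solve 4 (λ k l f g → (k ⊗ (l ⊗ (f ⊗ g))) ⊜ (l ⊗ (k ⊗ f ⊗ g))) refl (ι K) (ι (suc K)) f g))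
        (*-monoˡ-≼ (Pos-ι (suc K)) (*-monoʳ-≼ g-Pos f≼t)))
    case₁ : a * Q + B ≤ P * N + A → ⊥
    case₁ le = <⇒≱ (+-monoʳ-< K {1} {4} (s≤s (s≤s z≤n)))
        (≤-trans (*-cancelˡ-≤ (t * 2ᴬ * H) {{m*n≢0 (t * 2ᴬ) H {{m*n≢0 t 2ᴬ {{m^n≢0 2 (P * N)}} {{m^n≢0 2 A}}}} {{m^n≢0 5 Q′}}}} (ι-cancel-≼ chain)) (≤-reflexive (ℕ.+-comm 1 K)))
      where
      s2ᴮ≤t2ᴬ : s * 2ᴮ ≤ t * 2ᴬ
      s2ᴮ≤t2ᴬ = subst₂ _≤_ (^-distribˡ-+-* 2 (a * Q) B) (^-distribˡ-+-* 2 (P * N) A) (^-monoʳ-≤ 2 le)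
      chain : ι (t * 2ᴬ * H * (K + 4)) ≼ ι (t * 2ᴬ * H * suc K)
      chain = ≼-trans (≼-reflexive (trans (cong ι (lem₁ t 2ᴬ H (K + 4))) (trans (ι-* t (2ᴬ * (K + 4) * H)) (cong (ι t *ᵣ_) (ι-* (2ᴬ * (K + 4)) H)))))
        (≼-trans (*-monoˡ-≼ (Pos-ι t) above′)
        (≼-trans (≼-reflexive (solve 4 (λ t b k g → (t ⊗ (b ⊗ k ⊗ g)) ⊜ (b ⊗ (k ⊗ (t ⊗ g)))) refl (ι t) (ι 2ᴮ) (ι K) g))
        (≼-trans (*-monoˡ-≼ (Pos-ι 2ᴮ) tg≼)
        (≼-trans (≼-reflexive (trans (cong (λ e → ι 2ᴮ *ᵣ (ι (suc K) *ᵣ e)) (sym (ι-* H s))) (trans (cong (ι 2ᴮ *ᵣ_) (sym (ι-* (suc K) (H * s)))) (sym (ι-* 2ᴮ (suc K * (H * s)))))))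
          (ι-mono (≤-trans (≤-reflexive (lem₂ s 2ᴮ H (suc K))) (*-monoˡ-≤ (suc K) (*-monoˡ-≤ H s2ᴮ≤t2ᴬ))))))))
        where
        lem₁ : ∀ t A H k → t * A * H * k ≡ t * (A * k * H)
        lem₁ = ℕ-solve-∀
        lem₂ : ∀ s B H k → B * (k * (H * s)) ≡ s * B * H * k
        lem₂ = ℕ-solve-∀
    case₂ : P * N + A < a * Q + B → ⊥
    case₂ lt = <⇒≱ strict (*-cancelˡ-≤ (s * 2ᴮ * H) {{m*n≢0 (s * 2ᴮ) H {{m*n≢0 s 2ᴮ {{m^n≢0 2 (a * Q)}} {{m^n≢0 2 B}}}} {{m^n≢0 5 Q′}}}} (ι-cancel-≼ chain))
      where
      strict : suc K * suc K * K < K * K * (K + 4)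
      strict = begin-strict
          suc K * suc K * K ≡⟨ lem K ⟩
          K * K * K + 2 * (K * K) + K <⟨ +-monoʳ-< (K * K * K + 2 * (K * K)) (≤-<-trans (m≤m*n K K {{ℕ.>-nonZero 1≤K}}) (ℕ.m<m+n (K * K) (*-mono-≤ 1≤K 1≤K))) ⟩
          K * K * K + 2 * (K * K) + (K * K + K * K) ≡⟨ lem′ K ⟩
          K * K * (K + 4) ∎
        where
        open ℕ.≤-Reasoning
        lem : ∀ K → suc K * suc K * K ≡ K * K * K + 2 * (K * K) + K
        lem = ℕ-solve-∀
        lem′ : ∀ K → K * K * K + 2 * (K * K) + (K * K + K * K) ≡ K * K * (K + 4)
        lem′ = ℕ-solve-∀
      2t2ᴬ≤s2ᴮ : 2 * (t * 2ᴬ) ≤ s * 2ᴮ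
      2t2ᴬ≤s2ᴮ = subst₂ (λ x y → 2 * x ≤ y) (^-distribˡ-+-* 2 (P * N) A) (^-distribˡ-+-* 2 (a * Q) B) (2^-double lt)
      chain : ι (s * 2ᴮ * H * (K * K * (K + 4))) ≼ ι (s * 2ᴮ * H * (suc K * suc K * K))
      chain = ≼-trans (≼-reflexive (trans (cong ι (lem₂ s 2ᴮ H K (K + 4))) (trans (ι-* (2ᴮ * (K + 4)) (K * (K * (H * s))))
            (cong (ι (2ᴮ * (K + 4)) *ᵣ_) (trans (ι-* K (K * (H * s))) (cong (ι K *ᵣ_) (trans (ι-* K (H * s)) (cong (ι K *ᵣ_) (ι-* H s)))))))))
        (≼-trans (*-monoˡ-≼ (Pos-ι (2ᴮ * (K + 4))) ≼tg)
        (≼-trans (≼-reflexive (solve 4 (λ b k t g → (b ⊗ (k ⊗ (k ⊗ t ⊗ g))) ⊜ (k ⊗ k ⊗ t ⊗ (b ⊗ g))) refl (ι (2ᴮ * (K + 4))) (ι (suc K)) (ι t) g))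
        (≼-trans (*-monoˡ-≼ (Pos-* (Pos-* (Pos-ι (suc K)) (Pos-ι (suc K))) (Pos-ι t)) below′)
        (≼-trans (≼-reflexive (trans (cong₂ _*ᵣ_ (trans (cong (_*ᵣ ι t) (sym (ι-* (suc K) (suc K)))) (sym (ι-* (suc K * suc K) t))) (sym (ι-* (2 * 2ᴬ * K) H))) (sym (ι-* (suc K * suc K * t) (2 * 2ᴬ * K * H)))))
          (ι-mono (≤-trans (≤-reflexive (lem₃ (suc K) t 2ᴬ K H)) (≤-trans (*-monoˡ-≤ (H * (suc K * suc K * K)) 2t2ᴬ≤s2ᴮ) (≤-reflexive (sym (ℕ.*-assoc (s * 2ᴮ) H _))))))))))
        where
        lem₂ : ∀ s B H K k → s * B * H * (K * K * k) ≡ B * k * (K * (K * (H * s)))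
        lem₂ = ℕ-solve-∀
        lem₃ : ∀ l t A K H → l * l * t * (2 * A * K * H) ≡ 2 * (t * A) * (H * (l * l * K))
        lem₃ = ℕ-solve-∀

  -- For G = √5 2^μ φ^κ the inhomogeneous term cancels and the exponents of 2 must agree exactly.
  module _ (μ κ : ℕ) (G≡ : G ≡ √5 *ᵣ ι (2 ^ μ) *ᵣ φ ^ᵣ κ) (4≤K : 4 ≤ K) (N-small : 2 * (N + κ) * K ≤ 2 ^ λ₀) where

    e₁ e₂ 2ᵘ : ℕ
    e₁ = μ * Q + P * (N + κ)
    e₂ = a * Q
    2ᵘ = 2 ^ (μ * Q)

    f′ : ℤφ
    f′ = (φ ^ᵣ Q) ^ᵣ (N + κ)

    fg≡ : f *ᵣ g ≡ ι H *ᵣ (ι 2ᵘ *ᵣ f′)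
    fg≡ = trans (cong (f *ᵣ_) g≡) (trans (solve 4 (λ f h u k → (f ⊗ (h ⊗ u ⊗ k)) ⊜ (h ⊗ (u ⊗ (f ⊗ k)))) refl f (ι H) (ι 2ᵘ) ((φ ^ᵣ Q) ^ᵣ κ))
        (cong (λ w → ι H *ᵣ (ι 2ᵘ *ᵣ w)) (sym (^-homo-* (φ ^ᵣ Q) N κ))))
      where
      g≡ : g ≡ ι H *ᵣ ι 2ᵘ *ᵣ (φ ^ᵣ Q) ^ᵣ κ
      g≡ = trans (cong (_^ᵣ Q) G≡) (trans (^-distrib-* (√5 *ᵣ ι (2 ^ μ)) (φ ^ᵣ κ) Q) (cong₂ _*ᵣ_
        (trans (^-distrib-* √5 (ι (2 ^ μ)) Q) (cong₂ _*ᵣ_ (trans (^-homo-* √5 Q′ Q′) (trans (sym (^-distrib-* √5 √5 Q′)) (sym (ι-^ 5 Q′))))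
          (trans (sym (ι-^ (2 ^ μ) Q)) (cong ι (^-*-assoc 2 μ Q)))))
        (φ^-swap Q κ)))

    H>0 : 1 ≤ H
    H>0 = m^n>0 5 Q′

    uf≼ : ι K *ᵣ (ι 2ᵘ *ᵣ f′) ≼ ι (suc K) *ᵣ ι s
    uf≼ = ι-cancelˡ H H>0 (≼-trans (≼-reflexive (trans (solve 3 (λ h k x → (h ⊗ (k ⊗ x)) ⊜ (k ⊗ (h ⊗ x))) refl (ι H) (ι K) (ι 2ᵘ *ᵣ f′)) (cong (ι K *ᵣ_) (sym fg≡))))
      (≼-trans fg≼ (≼-reflexive (solve 3 (λ h k x → (k ⊗ (h ⊗ x)) ⊜ (h ⊗ (k ⊗ x))) refl (ι H) (ι (suc K)) (ι s)))))

    ≼uf : ι K *ᵣ ι s ≼ ι (suc K) *ᵣ (ι 2ᵘ *ᵣ f′)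
    ≼uf = ι-cancelˡ H H>0 (≼-trans (≼-reflexive (solve 3 (λ h k x → (h ⊗ (k ⊗ x)) ⊜ (k ⊗ (h ⊗ x))) refl (ι H) (ι K) (ι s)))
      (≼-trans ≼fg (≼-reflexive (trans (cong (ι (suc K) *ᵣ_) fg≡) (solve 3 (λ h k x → (k ⊗ (h ⊗ x)) ⊜ (h ⊗ (k ⊗ x))) refl (ι H) (ι (suc K)) (ι 2ᵘ *ᵣ f′))))))

    2^e₁ : ι 2ᵘ *ᵣ ι (2 ^ (P * (N + κ))) ≡ ι (2 ^ e₁)
    2^e₁ = trans (sym (ι-* 2ᵘ _)) (cong ι (sym (^-distribˡ-+-* 2 (μ * Q) (P * (N + κ)))))

    e₁-bound : K * 2 ^ e₁ ≤ suc K * 2 ^ e₂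
    e₁-bound = ι-cancel-≼ (≼-trans (≼-reflexive (trans (ι-* K (2 ^ e₁)) (cong (ι K *ᵣ_) (sym 2^e₁))))
      (≼-trans (*-monoˡ-≼ (Pos-ι K) (*-monoˡ-≼ (Pos-ι 2ᵘ) (close-power-lower Q-close (N + κ))))
      (≼-trans uf≼ (≼-reflexive (sym (ι-* (suc K) s))))))

    e₂-bound : K * (K * 2 ^ e₂) ≤ suc K * (suc K * 2 ^ e₁)
    e₂-bound = ι-cancel-≼ (≼-trans (≼-reflexive (trans (ι-* K (K * s)) (cong (ι K *ᵣ_) (ι-* K s))))
      (≼-trans (*-monoˡ-≼ (Pos-ι K) ≼uf)
      (≼-trans (≼-reflexive (solve 4 (λ k l u f → (k ⊗ (l ⊗ (u ⊗ f))) ⊜ (l ⊗ (u ⊗ (k ⊗ f)))) refl (ι K) (ι (suc K)) (ι 2ᵘ) f′))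
      (≼-trans (*-monoˡ-≼ (Pos-ι (suc K)) (*-monoˡ-≼ (Pos-ι 2ᵘ) (close-power-upper Q-close (N + κ) K 1≤K N-small)))
        (≼-reflexive (trans (cong (ι (suc K) *ᵣ_) (solve 3 (λ u l t → (u ⊗ (l ⊗ t)) ⊜ (l ⊗ (u ⊗ t))) refl (ι 2ᵘ) (ι (suc K)) (ι (2 ^ (P * (N + κ))))))
          (trans (cong (λ w → ι (suc K) *ᵣ (ι (suc K) *ᵣ w)) 2^e₁) (trans (cong (ι (suc K) *ᵣ_) (sym (ι-* (suc K) (2 ^ e₁)))) (sym (ι-* (suc K) (suc K * 2 ^ e₁)))))))))))

    e₁≤e₂ : e₁ ≤ e₂
    e₁≤e₂ = ≮⇒≥ λ e₂<e₁ → <⇒≱ {suc K} {K * 2}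
      (≤-trans (≤-reflexive (lem K)) (≤-trans (+-monoʳ-≤ K (≤-trans (s≤s (s≤s z≤n)) 4≤K)) (≤-reflexive (lem′ K))))
      (*-cancelʳ-≤ (K * 2) (suc K) (2 ^ e₂) {{m^n≢0 2 e₂}}
        (≤-trans (≤-reflexive (ℕ.*-assoc K 2 (2 ^ e₂))) (≤-trans (*-monoʳ-≤ K (2^-double e₂<e₁)) e₁-bound)))
      where
      lem : ∀ K → suc (suc K) ≡ K + 2
      lem = ℕ-solve-∀
      lem′ : ∀ K → K + K ≡ K * 2
      lem′ = ℕ-solve-∀

    e₂≤e₁ : e₂ ≤ e₁
    e₂≤e₁ = ≮⇒≥ λ e₁<e₂ → <⇒≱ {suc K * suc K} {K * (K * 2)} strict
      (*-cancelʳ-≤ (K * (K * 2)) (suc K * suc K) (2 ^ e₁) {{m^n≢0 2 e₁}}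
        (≤-trans (≤-reflexive (lem₁ K (2 ^ e₁))) (≤-trans (*-monoʳ-≤ K (*-monoʳ-≤ K (2^-double e₁<e₂)))
          (≤-trans e₂-bound (≤-reflexive (sym (ℕ.*-assoc (suc K) (suc K) (2 ^ e₁))))))))
      where
      lem₁ : ∀ K x → K * (K * 2) * x ≡ K * (K * (2 * x))
      lem₁ = ℕ-solve-∀
      lem₂ : ∀ K → suc (suc K * suc K) ≡ K * K + (2 * K + 2)
      lem₂ = ℕ-solve-∀
      lem₃ : ∀ K → 2 * K + 2 * K ≡ 4 * K
      lem₃ = ℕ-solve-∀
      lem₄ : ∀ K → K * K + K * K ≡ K * (K * 2)
      lem₄ = ℕ-solve-∀
      strict : suc K * suc K < K * (K * 2)
      strict = ≤-trans (≤-reflexive (lem₂ K)) (≤-trans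
        (+-monoʳ-≤ (K * K) (≤-trans (+-monoʳ-≤ (2 * K) (*-monoʳ-≤ 2 1≤K)) (≤-trans (≤-reflexive (lem₃ K)) (*-monoˡ-≤ K 4≤K))))
        (≤-reflexive (lem₄ K)))

    -- Equality of the exponents gives Q ∣ P (N + κ), and Bézout's relation gives Q ∣ N + κ. The
    -- condition 1 ≤ κ makes N + κ positive, so it is at least Q.
    not-degenerate : ∀ x y → x * P ≡ suc (y * Q) → 1 ≤ κ → ¬ (N + κ < Q)
    not-degenerate x y bezout 1≤κ lt = <⇒≱ lt (∣⇒≤ {{ℕ.>-nonZero (≤-trans 1≤κ (m≤n+m κ N))}} Q∣N+κ)
      where
      Q∣P*[N+κ] : Q ∣ P * (N + κ)
      Q∣P*[N+κ] = ∣m+n∣m⇒∣n (subst (Q ∣_) (sym (ℕ.≤-antisym e₁≤e₂ e₂≤e₁)) (n∣m*n a)) (n∣m*n μ)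
      Q∣N+κ : Q ∣ N + κ
      Q∣N+κ = ∣m+n∣m⇒∣n (subst (Q ∣_) (trans (sym (ℕ.*-assoc x P (N + κ))) (trans (cong (ℕ._* (N + κ)) bezout) (lem (N + κ) (y * Q))))
          (∣n⇒∣m*n x Q∣P*[N+κ])) (∣m⇒∣m*n (N + κ) (n∣m*n y))
        where
        lem : ∀ n z → suc z * n ≡ z * n + n
        lem = ℕ-solve-∀

-- Applying the interpolation argument

[1+1/M]^r≤4^w : ∀ n r w → let M = n + n in 1 ≤ n → r ≤ M * w → suc M ^ r ≤ 2 ^ (2 * w) * M ^ r
[1+1/M]^r≤4^w n r w 1≤n r≤ = *-cancelʳ-≤ _ _ (M ^ e) {{m^n≢0 M e {{M≢0}}}} (begin
  suc M ^ r * M ^ e ≤⟨ *-monoʳ-≤ (suc M ^ r) (^-monoˡ-≤ e (n≤1+n M)) ⟩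
  suc M ^ r * suc M ^ e ≡⟨ trans (sym (^-distribˡ-+-* (suc M) r e)) (cong (suc M ℕ.^_) r+e) ⟩
  suc M ^ (M * w) ≡⟨ sym (^-*-assoc (suc M) M w) ⟩
  (suc M ^ M) ^ w ≤⟨ ^-monoˡ-≤ w ([1+1/M]^M≤4 n) ⟩
  (4 * M ^ M) ^ w ≡⟨ ^-distribʳ-* w 4 (M ^ M) ⟩
  4 ^ w * (M ^ M) ^ w ≡⟨ cong₂ ℕ._*_ (^-*-assoc 2 2 w) (trans (^-*-assoc M M w) (trans (cong (M ℕ.^_) (sym r+e)) (^-distribˡ-+-* M r e))) ⟩
  2 ^ (2 * w) * (M ^ r * M ^ e) ≡⟨ sym (ℕ.*-assoc (2 ^ (2 * w)) (M ^ r) (M ^ e)) ⟩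
  2 ^ (2 * w) * M ^ r * M ^ e ∎)
  where
  open ℕ.≤-Reasoning
  M e : ℕ
  M = n + n
  e = M * w ∸ r
  r+e : r + e ≡ M * w
  r+e = m+[n∸m]≡n r≤
  M≢0 : NonZero M
  M≢0 = ℕ.>-nonZero (≤-trans 1≤n (m≤m+n n n))

φ≼2 : φ ≼ ι 2
φ≼2 = ≼⁺ (2 , ℤ.+≤+ z≤n , ℤ.+≤+ z≤n)

φ^≼2^ : ∀ n → φ ^ᵣ n ≼ ι (2 ^ n)
φ^≼2^ n = ≼-trans (^-mono-≼ n Pos-φ φ≼2) (≼-reflexive (sym (ι-^ 2 n)))

1≼φ : 1ᵣ ≼ φ
1≼φ = ≼⁺ (1 , ℤ.+≤+ z≤n , ℤ.+≤+ z≤n)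

1≼φ^ : ∀ n → 1ᵣ ≼ φ ^ᵣ n
1≼φ^ n = ≼-trans (≼-reflexive (sym (^-1ᵣ n))) (^-mono-≼ n (Pos-ι 1) 1≼φ)

Approx-weaken : ∀ {w′ w a X} → w′ ≤ w → Approx w a X → Approx w′ a X
Approx-weaken {w′} {w} {a} {X} le p = Bd-ι*-cancel (pred (2 ^ (w ∸ w′))) (subst (λ y → Bd y (ι (2 ^ a))) eq p)
  where
  y : ℤφ
  y = √5 *ᵣ ι (2 ^ a) -ᵣ X
  eq : ι (2 ^ w) *ᵣ y ≡ ι (suc (pred (2 ^ (w ∸ w′)))) *ᵣ (ι (2 ^ w′) *ᵣ y)
  eq = trans (cong (λ e → ι e *ᵣ y) (trans (cong (2 ℕ.^_) (sym (m∸n+n≡m le))) (^-distribˡ-+-* 2 (w ∸ w′) w′)))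
    (trans (ι-*₂ (2 ^ (w ∸ w′)) (2 ^ w′) y) (cong (λ e → ι e *ᵣ (ι (2 ^ w′) *ᵣ y)) (sym (suc-pred (2 ^ (w ∸ w′)) {{m^n≢0 2 (w ∸ w′)}}))))

module CoreApplication {q p Λ₀ h} (q-close : Close q p Λ₀) (1≤p : 1 ≤ p) (Λ₀≥ : 14 * suc h + 67 ≤ Λ₀)
  {G δ} (G-Pos : Pos G) (1≼G : 1ᵣ ≼ G) (G≼ : G ≼ ι (2 ^ δ)) (conj-G : Bd (conj G) (ι 2))
  {N a w} (approx : Approx w a (φ ^ᵣ N *ᵣ G))
  (r n₀ x : ℕ) (N≡ : q * r + n₀ ≡ N) (2≤n₀ : 2 ≤ n₀) (n₀≤ : n₀ ≤ suc q)
  (x≤ : x * 2 ^ suc h ≤ r) (r< : r < suc x * 2 ^ suc h)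
  (x-large : 12 * (q + δ + 8) ≤ x) (w-large : Λ₀ * (x * p) ≤ w) where

  open Close q-close
  open PowerReduction {w} {a} {φ ^ᵣ N *ᵣ G} approx using (W≼X; Z; W)

  α D X : ℤφ
  α = φ ^ᵣ q
  D = φ ^ᵣ n₀ *ᵣ G
  X = φ ^ᵣ N *ᵣ G

  X≡ : X ≡ α ^ᵣ r *ᵣ D
  X≡ = trans (cong (_*ᵣ G) (trans (cong (φ ^ᵣ_) (sym N≡)) (trans (^-homo-* φ (q * r) n₀) (cong (_*ᵣ φ ^ᵣ n₀) (sym (^-assocʳ φ q r))))))
    (*-assoc (α ^ᵣ r) (φ ^ᵣ n₀) G)

  D-Pos : Pos D
  D-Pos = Pos-* (Pos-^ n₀ Pos-φ) G-Pos

  D≢0 : D ≢ 0ᵣ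
  D≢0 = *ᵣ-≢0 (^ᵣ-≢0 n₀ φ≢0) λ G≡0 → <⇒≱ {0} {1} (s≤s z≤n) (ι-cancel-≼ (subst (1ᵣ ≼_) G≡0 1≼G))
    where
    φ≢0 : φ ≢ 0ᵣ
    φ≢0 ()

  conj-D : Bd (conj D) (ι 2)
  conj-D = subst₂ Bd (sym (conj-* (φ ^ᵣ n₀) G)) (*-identityˡ (ι 2)) (Bd-* (conj-φ^-Bd n₀) conj-G)

  x≤r : x ≤ r
  x≤r = ≤-trans (m≤m*n x (2 ^ suc h) {{m^n≢0 2 (suc h)}}) x≤

  r≤ : r ≤ (x + 2) * 2 ^ suc h
  r≤ = ≤-trans (<⇒≤ r<) (*-monoˡ-≤ (2 ^ suc h) (≤-trans (n≤1+n (suc x)) (≤-reflexive (ℕ.+-comm 2 x))))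

  X≼4W : X ≼ ι 4 *ᵣ ι W
  X≼4W = ι-cancelˡ (2 ^ w) (m^n>0 2 w) (≼⁺ (subst Pos
    (solve 4 (λ m s x w → ((m ⊗ (s ⊗ w ⊕ ⊝ x) ⊕ w) ⊕ (m ⊗ ((Κ (ι 3) ⊕ ⊝ s) ⊗ w) ⊕ (m ⊕ ⊝ Κ 1ᵣ) ⊗ w)) ⊜ (m ⊗ (Κ (ι 4) ⊗ w) ⊕ ⊝ (m ⊗ x))) refl (ι (2 ^ w)) √5 X (ι W))
    (Pos-+ (subst Pos (+-comm (ι W) _) (Bd.above approx)) (Pos-+ (Pos-* (Pos-ι (2 ^ w)) (Pos-* (Bd.below √5-Bd) (Pos-ι W))) (Pos-* (_≼_.≼⁻ (ι-mono (m^n>0 2 w))) (Pos-ι W))))))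

  2^pr≼ : ι (2 ^ (p * r)) ≼ α ^ᵣ r
  2^pr≼ = close-power-lower q-close r

  φ²≼φ^n₀ : φ ^ᵣ 2 ≼ φ ^ᵣ n₀
  φ²≼φ^n₀ = ≼-trans (≼-reflexive (sym (*-identityʳ (φ ^ᵣ 2)))) (≼-trans (*-monoˡ-≼ (Pos-^ 2 Pos-φ) (1≼φ^ (n₀ ∸ 2))) (≼-reflexive (^ᵣ-∸ φ 2≤n₀)))

  φ²≼D : φ ^ᵣ 2 ≼ D
  φ²≼D = ≼-trans (≼-reflexive (sym (*-identityʳ (φ ^ᵣ 2)))) (*-mono-≼ (Pos-^ 2 Pos-φ) (Pos-ι 1) φ²≼φ^n₀ 1≼G)

  -- Here n₀ ≥ 2 is needed: a < p r would give 2 · 2ᵃ φ² ≤ αʳ D = X ≤ 4 · 2ᵃ, although 2 φ² ≥ 5.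
  -- Hence s = a - p r is a genuine difference.
  pr≤a : p * r ≤ a
  pr≤a = ≮⇒≥ λ a<pr → <⇒≱ {4} {5} ≤-refl (ι-cancel-≼ (≼-trans 5≼ (ι-cancelˡ W (m^n>0 2 a)
      (≼-trans (≼-reflexive (solve 2 (λ w f → (w ⊗ (Κ (ι 2) ⊗ f)) ⊜ (Κ (ι 2) ⊗ w ⊗ f)) refl (ι W) (φ ^ᵣ 2)))
      (≼-trans (*-mono-≼ (Pos-* (Pos-ι 2) (Pos-ι W)) (Pos-^ 2 Pos-φ)
          (≼-trans (≼-reflexive (sym (ι-* 2 W))) (≼-trans (ι-mono (2^-double a<pr)) 2^pr≼)) φ²≼D)
      (≼-trans (≼-reflexive (sym X≡)) (≼-trans X≼4W (≼-reflexive (*-comm (ι 4) (ι W))))))))))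
    where
    5≼ : ι 5 ≼ ι 2 *ᵣ φ ^ᵣ 2
    5≼ = ≼⁺ (3 , ℤ.+≤+ z≤n , ℤ.+≤+ z≤n)

  s ρ M₀ : ℕ
  s = a ∸ p * r
  M₀ = 2 ^ pred-Λ
    where
    pred-Λ : ℕ
    pred-Λ = pred Λ₀
  ρ = r / 2 ^ Λ₀
    where
    instance
      nz : NonZero (2 ^ Λ₀)
      nz = m^n≢0 2 Λ₀

  pr+s≡a : p * r + s ≡ a
  pr+s≡a = m+[n∸m]≡n pr≤a

  1≤Λ₀ : 1 ≤ Λ₀
  1≤Λ₀ = ≤-trans (≤-trans (s≤s z≤n) (m≤n+m 67 (14 * suc h))) Λ₀≥

  2^Λ₀≡ : 2 ^ Λ₀ ≡ M₀ + M₀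
  2^Λ₀≡ = trans (cong (2 ℕ.^_) (sym (suc-pred Λ₀ {{ℕ.>-nonZero 1≤Λ₀}}))) (cong (M₀ ℕ.+_) (ℕ.+-identityʳ M₀))

  r≤Λ[ρ+1] : r ≤ 2 ^ Λ₀ * suc ρ
  r≤Λ[ρ+1] = ≤-trans (≤-reflexive (m≡m%n+[m/n]*n r (2 ^ Λ₀) {{nz}})) (≤-trans (+-monoˡ-≤ (ρ * 2 ^ Λ₀) (<⇒≤ (m%n<n r (2 ^ Λ₀) {{nz}}))) (≤-reflexive (ℕ.*-comm (suc ρ) (2 ^ Λ₀))))
    where
    nz : NonZero (2 ^ Λ₀)
    nz = m^n≢0 2 Λ₀

  α^r≼ : α ^ᵣ r ≼ ι (2 ^ (2 * suc ρ)) *ᵣ ι (2 ^ (p * r))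
  α^r≼ = ι-cancelˡ (2^Λ₀ ^ r) (m^n>0 2^Λ₀ {{m^n≢0 2 Λ₀}} r)
      (≼-trans (≼-reflexive (merge 2^Λ₀ α))
      (≼-trans (^-mono-≼ r (Pos-* (Pos-ι 2^Λ₀) (Pos-^ q Pos-φ)) upper)
      (≼-trans (≼-reflexive (trans (sym (merge (suc 2^Λ₀) (ι (2 ^ p)))) (cong (ι (suc 2^Λ₀ ^ r) *ᵣ_) (trans (sym (ι-^ (2 ^ p) r)) (cong ι (^-*-assoc 2 p r))))))
      (≼-trans (*-monoʳ-≼ (Pos-ι _) (ι-mono bound))
        (≼-reflexive (trans (cong (_*ᵣ ι (2 ^ (p * r))) (ι-* (2 ^ (2 * suc ρ)) (2^Λ₀ ^ r)))
          (solve 3 (λ e l t → (e ⊗ l ⊗ t) ⊜ (l ⊗ (e ⊗ t))) refl (ι (2 ^ (2 * suc ρ))) (ι (2^Λ₀ ^ r)) (ι (2 ^ (p * r))))))))))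
    where
    2^Λ₀ : ℕ
    2^Λ₀ = 2 ^ Λ₀
    merge : ∀ M x → ι (M ^ r) *ᵣ x ^ᵣ r ≡ (ι M *ᵣ x) ^ᵣ r
    merge M x = trans (cong (_*ᵣ x ^ᵣ r) (ι-^ M r)) (sym (^-distrib-* (ι M) x r))
    upper : ι 2^Λ₀ *ᵣ α ≼ ι (suc 2^Λ₀) *ᵣ ι (2 ^ p)
    upper = ≼⁺ (subst Pos (solve 3 (λ l x p → (p ⊕ ⊝ (l ⊗ (x ⊕ ⊝ p))) ⊜ ((Κ 1ᵣ ⊕ l) ⊗ p ⊕ ⊝ (l ⊗ x))) refl (ι 2^Λ₀) α (ι (2 ^ p)))
      (_≼_.≼⁻ close-upper))
    bound : suc 2^Λ₀ ^ r ≤ 2 ^ (2 * suc ρ) * 2^Λ₀ ^ r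
    bound = subst (λ M → suc M ^ r ≤ 2 ^ (2 * suc ρ) * M ^ r) (sym 2^Λ₀≡)
      ([1+1/M]^r≤4^w M₀ r (suc ρ) (m^n>0 2 (pred Λ₀)) (subst (λ M → r ≤ M * suc ρ) 2^Λ₀≡ r≤Λ[ρ+1]))

  -- From 2ᵃ ≤ X = αʳ D and αʳ ≤ 4^(ρ+1) 2^(p r): the number λʳ drifts away from 1 by two bits for
  -- every 2^Λ₀ steps at most.
  s≤ : s ≤ 2 * suc ρ + (n₀ + δ)
  s≤ = +-cancelˡ-≤ (p * r) _ _ (≤-trans (≤-reflexive pr+s≡a) (≮⇒≥ λ e<a → <⇒≱ (^-monoʳ-< 2 (s≤s (s≤s z≤n)) e<a) (ι-cancel-≼
    (≼-trans W≼X (≼-trans (≼-reflexive X≡) (≼-trans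
      (*-mono-≼ (Pos-^ r (Pos-^ q Pos-φ)) D-Pos α^r≼ (*-mono-≼ (Pos-^ n₀ Pos-φ) G-Pos (φ^≼2^ n₀) G≼))
      (≼-reflexive (trans (cong₂ _*ᵣ_ (sym (ι-* (2 ^ (2 * suc ρ)) (2 ^ (p * r)))) (sym (ι-* (2 ^ n₀) (2 ^ δ))))
        (trans (sym (ι-* (2 ^ (2 * suc ρ) * 2 ^ (p * r)) (2 ^ n₀ * 2 ^ δ))) (cong ι exponents))))))))))
    where
    exponents : 2 ^ (2 * suc ρ) * 2 ^ (p * r) * (2 ^ n₀ * 2 ^ δ) ≡ 2 ^ (p * r + (2 * suc ρ + (n₀ + δ)))
    exponents = trans (cong₂ ℕ._*_ (sym (^-distribˡ-+-* 2 (2 * suc ρ) (p * r))) (sym (^-distribˡ-+-* 2 n₀ δ)))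
      (trans (sym (^-distribˡ-+-* 2 (2 * suc ρ + p * r) (n₀ + δ))) (cong (2 ℕ.^_) (lem (2 * suc ρ) (p * r) (n₀ + δ))))
      where
      lem : ∀ x y z → x + y + z ≡ y + (x + z)
      lem = ℕ-solve-∀

  1≤x : 1 ≤ x
  1≤x = ≤-trans (≤-trans (s≤s z≤n) (*-monoʳ-≤ 12 (m≤n+m 8 (q + δ)))) x-large

  -- x is about r / 2^(h+1), while ρ is about r / 2^Λ₀ and Λ₀ ≥ 6 + (h+1). So the drift stays
  -- negligible against x however large r is.
  32ρ≤x : 32 * ρ ≤ x
  32ρ≤x = *-cancelʳ-≤ _ _ (2 * 2 ^ suc h) {{m*n≢0 2 (2 ^ suc h) {{_}} {{m^n≢0 2 (suc h)}}}} (begin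
    32 * ρ * (2 * 2 ^ suc h) ≡⟨ lem₁ ρ (2 ^ suc h) ⟩
    ρ * (64 * 2 ^ suc h) ≤⟨ *-monoʳ-≤ ρ 64*2^g≤ ⟩
    ρ * 2 ^ Λ₀ ≤⟨ m/n*n≤m r (2 ^ Λ₀) {{m^n≢0 2 Λ₀}} ⟩
    r ≤⟨ <⇒≤ r< ⟩
    suc x * 2 ^ suc h ≤⟨ *-monoˡ-≤ (2 ^ suc h) (≤-trans (+-monoˡ-≤ x 1≤x) (≤-reflexive (lem₂ x))) ⟩
    x * 2 * 2 ^ suc h ≡⟨ ℕ.*-assoc x 2 (2 ^ suc h) ⟩
    x * (2 * 2 ^ suc h) ∎)
    where
    open ℕ.≤-Reasoning
    lem₁ : ∀ ρ w → 32 * ρ * (2 * w) ≡ ρ * (64 * w)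
    lem₁ = ℕ-solve-∀
    lem₂ : ∀ x → x + x ≡ x * 2
    lem₂ = ℕ-solve-∀
    64*2^g≤ : 64 * 2 ^ suc h ≤ 2 ^ Λ₀
    64*2^g≤ = ≤-trans (≤-reflexive (sym (^-distribˡ-+-* 2 6 (suc h)))) (^-monoʳ-≤ 2 (≤-trans
      (≤-trans (≤-reflexive (ℕ.+-comm 6 (suc h))) (+-mono-≤ (m≤n*m (suc h) 14) (m≤m+n 6 61))) Λ₀≥))

  6s≤x : 6 * (s + 2) ≤ x
  6s≤x = *-cancelˡ-≤ 2 (begin
    2 * (6 * (s + 2)) ≤⟨ *-monoʳ-≤ 2 (*-monoʳ-≤ 6 (+-monoˡ-≤ 2 (≤-trans s≤ (+-monoʳ-≤ (2 * suc ρ) (+-monoˡ-≤ δ n₀≤))))) ⟩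
    2 * (6 * (2 * suc ρ + (suc q + δ) + 2)) ≤⟨ m≤m+n _ (8 * ρ + 36) ⟩
    2 * (6 * (2 * suc ρ + (suc q + δ) + 2)) + (8 * ρ + 36) ≡⟨ lem ρ q δ ⟩
    32 * ρ + 12 * (q + δ + 8) ≤⟨ +-mono-≤ 32ρ≤x x-large ⟩
    x + x ≡⟨ cong (x ℕ.+_) (sym (ℕ.+-identityʳ x)) ⟩
    2 * x ∎)
    where
    open ℕ.≤-Reasoning
    lem : ∀ ρ q δ → 2 * (6 * (2 * suc ρ + (suc q + δ) + 2)) + (8 * ρ + 36) ≡ 32 * ρ + 12 * (q + δ + 8)
    lem = ℕ-solve-∀

  6≤x : 6 ≤ x
  6≤x = ≤-trans (*-mono-≤ {6} {12} {1} (m≤m+n 6 6) (≤-trans (s≤s z≤n) (m≤n+m 8 (q + δ)))) x-large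

  impossible : ⊥
  impossible = Interpolation.contradiction q p Λ₀ h x r s a D 1≤p 6≤x 6s≤x Λ₀≥ x≤r r≤ pr+s≡a close-lower close-upper D-Pos D≢0 conj-D
    (subst (λ X → Bd (ι (2 ^ (Λ₀ * (x * p))) *ᵣ (√5 *ᵣ ι (2 ^ a) -ᵣ X)) (ι (2 ^ a))) X≡ (Approx-weaken {Λ₀ * (x * p)} {w} {a} {X} w-large approx))

-- Estimates for a solution

binet : ∀ k → √5 *ᵣ ι (F k) ≡ φ ^ᵣ k -ᵣ conj φ ^ᵣ k
binet k = proj₁ (go k)
  where
  step : ∀ x y → √5 *ᵣ (x +ᵣ y) ≡ √5 *ᵣ x +ᵣ √5 *ᵣ y
  step = distribˡ √5
  go : ∀ k → √5 *ᵣ ι (F k) ≡ φ ^ᵣ k -ᵣ conj φ ^ᵣ k × √5 *ᵣ ι (F (suc k)) ≡ φ ^ᵣ suc k -ᵣ conj φ ^ᵣ suc k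
  go zero = refl , refl
  go (suc k) = proj₂ (go k) , trans (step (ι (F (suc k))) (ι (F k))) (trans (cong₂ _+ᵣ_ (proj₂ (go k)) (proj₁ (go k)))
    (solve 2 (λ x y → ((Κ φ ⊗ x ⊕ ⊝ (Κ (conj φ) ⊗ y)) ⊕ (x ⊕ ⊝ y)) ⊜ (Κ φ ⊗ (Κ φ ⊗ x) ⊕ ⊝ (Κ (conj φ) ⊗ (Κ (conj φ) ⊗ y)))) refl (φ ^ᵣ k) (conj φ ^ᵣ k)))

∣-∣-Bd : ∀ m n → Bd (ι m -ᵣ ι n) (ι ℕ.∣ m - n ∣)
∣-∣-Bd m n = [ below , above ]′ (ℕ.≤-total m n)
  where
  below : m ≤ n → Bd (ι m -ᵣ ι n) (ι ℕ.∣ m - n ∣)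
  below m≤n = subst₂ Bd (solve 2 (λ m n → (⊝ (n ⊕ ⊝ m)) ⊜ (m ⊕ ⊝ n)) refl (ι m) (ι n)) eq (Bd-neg (Pos⇒Bd (_≼_.≼⁻ (ι-mono m≤n))))
    where
    eq : ι n -ᵣ ι m ≡ ι ℕ.∣ m - n ∣
    eq = trans (cong (λ k → ι k -ᵣ ι m) (sym (trans (cong (m ℕ.+_) (ℕ.m≤n⇒∣m-n∣≡n∸m m≤n)) (m+[n∸m]≡n m≤n))))
      (solve 2 (λ m k → ((m ⊕ k) ⊕ ⊝ m) ⊜ k) refl (ι m) (ι ℕ.∣ m - n ∣))
  above : n ≤ m → Bd (ι m -ᵣ ι n) (ι ℕ.∣ m - n ∣)
  above n≤m = subst (Bd (ι m -ᵣ ι n)) eq (Pos⇒Bd (_≼_.≼⁻ (ι-mono n≤m)))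
    where
    eq : ι m -ᵣ ι n ≡ ι ℕ.∣ m - n ∣
    eq = trans (cong (λ k → ι k -ᵣ ι n) (sym (trans (cong (n ℕ.+_) (ℕ.m≤n⇒∣n-m∣≡n∸m n≤m)) (m+[n∸m]≡n n≤m))))
      (solve 2 (λ m k → ((m ⊕ k) ⊕ ⊝ m) ⊜ k) refl (ι n) (ι ℕ.∣ m - n ∣))

Gap : ℕ → ℤφ
Gap d = φ ^ᵣ d +ᵣ 1ᵣ

Gap-Pos : ∀ d → Pos (Gap d)
Gap-Pos d = Pos-+ (Pos-^ d Pos-φ) (Pos-ι 1)

module Solution {d m a} (ineq : Ineq (d + m) m a) where

  n e : ℕ
  n = d + m
  e = ℕ.∣ F n + F m - 2 ^ a ∣

  X : ℤφ
  X = φ ^ᵣ m *ᵣ Gap d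

  φ^n : φ ^ᵣ n ≡ φ ^ᵣ m *ᵣ φ ^ᵣ d
  φ^n = trans (^-homo-* φ d m) (*-comm (φ ^ᵣ d) (φ ^ᵣ m))

  module _ (h : ℕ) (a≤2h : a ≤ h + h) where

    e≤2^h : e ≤ 2 ^ h
    e≤2^h = ≮⇒≥ λ lt → <⇒≱ ineq (≤-trans (^-monoʳ-≤ 2 a≤2h) (≤-trans (≤-reflexive (^-distribˡ-+-* 2 h h)) (*-mono-≤ (<⇒≤ lt) (<⇒≤ lt))))

    -- By Binet's formula X = φⁿ + φᵐ differs from √5 (F n + F m) by two conjugate powers of
    -- absolute value at most 1, and 3 · 2ʰ + 2 ≤ 5 · 2ʰ.
    X-Bd : Bd (√5 *ᵣ ι (2 ^ a) -ᵣ X) (ι (5 * 2 ^ h))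
    X-Bd = Bd-mono (subst (λ y → Bd y (ι 3 *ᵣ ι (2 ^ h) +ᵣ (1ᵣ +ᵣ 1ᵣ))) (sym eq)
        (Bd-neg (Bd-+ (Bd-* √5-Bd (Bd-mono (∣-∣-Bd (F n + F m) (2 ^ a)) (ι-mono e≤2^h)))
          (Bd-+ (conj-φ-power n) (conj-φ-power m)))))
        (≼-trans (≼-reflexive (cong (_+ᵣ ι 2) (sym (ι-* 3 (2 ^ h))))) (ι-mono (≤-trans (+-monoʳ-≤ (3 * 2 ^ h) (*-monoʳ-≤ 2 (m^n>0 2 h))) (≤-reflexive (sym (*-distribʳ-+ (2 ^ h) 3 2))))))
      where
      conj-φ-power : ∀ k → Bd (conj φ ^ᵣ k) 1ᵣ
      conj-φ-power k = subst (Bd (conj φ ^ᵣ k)) (^-1ᵣ k) (Bd-^ k conj-φ-Bd)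
      eq : √5 *ᵣ ι (2 ^ a) -ᵣ X ≡ -ᵣ (√5 *ᵣ (ι (F n + F m) -ᵣ ι (2 ^ a)) +ᵣ (conj φ ^ᵣ n +ᵣ conj φ ^ᵣ m))
      eq = begin
        √5 *ᵣ ι (2 ^ a) -ᵣ φ ^ᵣ m *ᵣ (φ ^ᵣ d +ᵣ 1ᵣ)
          ≡⟨ solve 4 (λ s w x y → (s ⊗ w ⊕ ⊝ (y ⊗ (x ⊕ Κ 1ᵣ))) ⊜ (s ⊗ w ⊕ ⊝ (y ⊗ x ⊕ y))) refl √5 (ι (2 ^ a)) (φ ^ᵣ d) (φ ^ᵣ m) ⟩
        √5 *ᵣ ι (2 ^ a) -ᵣ (φ ^ᵣ m *ᵣ φ ^ᵣ d +ᵣ φ ^ᵣ m)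
          ≡⟨ cong (λ x → √5 *ᵣ ι (2 ^ a) -ᵣ (x +ᵣ φ ^ᵣ m)) (sym φ^n) ⟩
        √5 *ᵣ ι (2 ^ a) -ᵣ (φ ^ᵣ n +ᵣ φ ^ᵣ m)
          ≡⟨ cong₂ (λ x y → √5 *ᵣ ι (2 ^ a) -ᵣ (x +ᵣ y)) (isolate n) (isolate m) ⟩
        √5 *ᵣ ι (2 ^ a) -ᵣ (√5 *ᵣ ι (F n) +ᵣ conj φ ^ᵣ n +ᵣ (√5 *ᵣ ι (F m) +ᵣ conj φ ^ᵣ m))
          ≡⟨ solve 6 (λ s w x y u v → (s ⊗ w ⊕ ⊝ (s ⊗ x ⊕ u ⊕ (s ⊗ y ⊕ v))) ⊜ (⊝ (s ⊗ ((x ⊕ y) ⊕ ⊝ w) ⊕ (u ⊕ v)))) refl √5 (ι (2 ^ a)) (ι (F n)) (ι (F m)) (conj φ ^ᵣ n) (conj φ ^ᵣ m) ⟩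
        -ᵣ (√5 *ᵣ (ι (F n + F m) -ᵣ ι (2 ^ a)) +ᵣ (conj φ ^ᵣ n +ᵣ conj φ ^ᵣ m)) ∎
        where
        open ≡-Reasoning
        isolate : ∀ k → φ ^ᵣ k ≡ √5 *ᵣ ι (F k) +ᵣ conj φ ^ᵣ k
        isolate k = trans (solve 2 (λ x y → x ⊜ ((x ⊕ ⊝ y) ⊕ y)) refl (φ ^ᵣ k) (conj φ ^ᵣ k)) (cong (_+ᵣ conj φ ^ᵣ k) (sym (binet k)))

  φ^n≼ : φ ^ᵣ n ≼ ι (2 ^ (3 + a))
  φ^n≼ = ≼-trans (≼-trans (≼-reflexive φ^n) (*-monoˡ-≼ (Pos-^ m Pos-φ) (≼⁺ (subst Pos (solve 1 (λ x → Κ 1ᵣ ⊜ ((x ⊕ Κ 1ᵣ) ⊕ ⊝ x)) refl (φ ^ᵣ d)) (Pos-ι 1)))))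
    (≼⁺ (subst Pos (trans (solve 4 (λ s w x f → (((Κ (ι 3) ⊕ ⊝ s) ⊗ w) ⊕ (f ⊕ (s ⊗ w ⊕ ⊝ x))) ⊜ ((Κ (ι 3) ⊗ w ⊕ f) ⊕ ⊝ x)) refl √5 (ι (2 ^ a)) X (ι (5 * 2 ^ a)))
        (cong (_-ᵣ X) (trans (cong (_+ᵣ ι (5 * 2 ^ a)) (sym (ι-* 3 (2 ^ a)))) (cong ι (trans (sym (*-distribʳ-+ (2 ^ a) 3 5)) (sym (^-distribˡ-+-* 2 3 a)))))))
      (Pos-+ (Pos-* (Bd.below √5-Bd) (Pos-ι (2 ^ a))) (Bd.above (X-Bd a (m≤m+n a a))))))

  2≼φ² : ι 2 ≼ φ ^ᵣ 2
  2≼φ² = ≼⁺ (1 , ℤ.+≤+ z≤n , ℤ.+≤+ z≤n)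

  2^≼φ^ : ∀ k → ι (2 ^ k) ≼ φ ^ᵣ (k + k)
  2^≼φ^ k = ≼-trans (≼-reflexive (ι-^ 2 k)) (≼-trans (^-mono-≼ k (Pos-ι 2) 2≼φ²)
    (≼-reflexive (trans (^-assocʳ φ 2 k) (cong (λ e → φ ^ᵣ (k + e)) (ℕ.+-identityʳ k)))))

  φ^-mono : ∀ {k l} → k ≤ l → φ ^ᵣ k ≼ φ ^ᵣ l
  φ^-mono {k} {l} le = ≼-trans (≼-reflexive (sym (*-identityʳ (φ ^ᵣ k)))) (≼-trans (*-monoˡ-≼ (Pos-^ k Pos-φ) (1≼φ^ (l ∸ k))) (≼-reflexive (^ᵣ-∸ φ le)))

  -- Otherwise 2^(a+4) ≤ φ^(2(a+4)) ≤ φⁿ ≤ 2^(a+3), by 2 ≤ φ².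
  n≤2a+7 : n ≤ 2 * a + 7
  n≤2a+7 = ≮⇒≥ λ lt → <⇒≱ (^-monoʳ-< 2 (s≤s (s≤s z≤n)) (n<1+n (3 + a)))
    (ι-cancel-≼ (≼-trans (2^≼φ^ (4 + a)) (≼-trans (φ^-mono (≤-trans (≤-reflexive (lem a)) lt)) φ^n≼)))
    where
    lem : ∀ a → 4 + a + (4 + a) ≡ suc (2 * a + 7)
    lem = ℕ-solve-∀

  module _ (w : ℕ) (2w+8≤a : 2 * w + 8 ≤ a) where

    h : ℕ
    -- The four extra bits cover 2 · 5 ≤ 16, so that the error scaled by 2ʷ is at most half of 2ᵃ; a
    -- ≥ 2 w + 8 guarantees a ≤ 2 h.
    h = a ∸ (w + 4)

    w+4≤a : w + 4 ≤ a
    w+4≤a = ≤-trans (+-mono-≤ (m≤n*m w 2) (m≤m+n 4 4)) 2w+8≤a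

    w+4+h : w + 4 + h ≡ a
    w+4+h = m+[n∸m]≡n w+4≤a

    a≤h+h : a ≤ h + h
    a≤h+h = +-cancelˡ-≤ (w + 4 + (w + 4)) _ _ (≤-trans (≤-trans (≤-reflexive (cong (ℕ._+ a) (lem₁ w))) (+-monoˡ-≤ a 2w+8≤a))
      (≤-reflexive (trans (cong₂ ℕ._+_ (sym w+4+h) (sym w+4+h)) (lem₂ (w + 4) h))))
      where
      lem₁ : ∀ w → w + 4 + (w + 4) ≡ 2 * w + 8
      lem₁ = ℕ-solve-∀
      lem₂ : ∀ u h → u + h + (u + h) ≡ u + u + (h + h)
      lem₂ = ℕ-solve-∀

    2^w*5*2^h : 2 * (2 ^ w * (5 * 2 ^ h)) ≤ 2 ^ a
    2^w*5*2^h = ≤-trans (≤-trans (≤-reflexive (lem (2 ^ w) (2 ^ h))) (*-monoˡ-≤ (2 ^ h) (*-monoʳ-≤ (2 ^ w) (m≤m+n 10 6))))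
      (≤-reflexive (trans (cong (ℕ._* 2 ^ h) (sym (^-distribˡ-+-* 2 w 4))) (trans (sym (^-distribˡ-+-* 2 (w + 4) h)) (cong (2 ℕ.^_) w+4+h))))
      where
      lem : ∀ x y → 2 * (x * (5 * y)) ≡ x * 10 * y
      lem = ℕ-solve-∀

    scaled-X-Bd : Bd (ι (2 ^ w) *ᵣ (√5 *ᵣ ι (2 ^ a) -ᵣ X)) (ι (2 ^ w * (5 * 2 ^ h)))
    scaled-X-Bd = subst (Bd (ι (2 ^ w) *ᵣ (√5 *ᵣ ι (2 ^ a) -ᵣ X))) (sym (ι-* (2 ^ w) (5 * 2 ^ h))) (Bd-* (Pos⇒Bd (Pos-ι (2 ^ w))) (X-Bd h a≤h+h))

    approx-gap : Approx w a X
    approx-gap = Bd-mono scaled-X-Bd (ι-mono (≤-trans (m≤n*m _ 2) 2^w*5*2^h))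

    -- When d is large, φᵐ itself counts as an error: 2^(w+4) φᵐ ≤ φᵈ φᵐ = φⁿ ≤ 2^(a+3) makes it at
    -- most half of 2ᵃ after scaling, and the error of `approx-gap` takes the other half.
    approx-one : 2 * w + 8 ≤ d → Approx w a (φ ^ᵣ n *ᵣ 1ᵣ)
    approx-one 2w+8≤d = subst₂ Bd eq refl (Bd-mono (Bd-+ scaled-X-Bd (Pos⇒Bd (Pos-* (Pos-ι (2 ^ w)) (Pos-^ m Pos-φ)))) total)
      where
      eq : ι (2 ^ w) *ᵣ (√5 *ᵣ ι (2 ^ a) -ᵣ X) +ᵣ ι (2 ^ w) *ᵣ φ ^ᵣ m ≡ ι (2 ^ w) *ᵣ (√5 *ᵣ ι (2 ^ a) -ᵣ φ ^ᵣ n *ᵣ 1ᵣ)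
      eq = trans (solve 4 (λ w z x y → (w ⊗ (z ⊕ ⊝ (y ⊗ (x ⊕ Κ 1ᵣ))) ⊕ w ⊗ y) ⊜ (w ⊗ (z ⊕ ⊝ (y ⊗ x ⊗ Κ 1ᵣ)))) refl (ι (2 ^ w)) (√5 *ᵣ ι (2 ^ a)) (φ ^ᵣ d) (φ ^ᵣ m))
        (cong (λ x → ι (2 ^ w) *ᵣ (√5 *ᵣ ι (2 ^ a) -ᵣ x *ᵣ 1ᵣ)) (sym φ^n))
      k : ℕ
      k = w + 4
      2^kφ^m≼ : ι (2 ^ k) *ᵣ φ ^ᵣ m ≼ ι (2 ^ (3 + a))
      2^kφ^m≼ = ≼-trans (*-monoʳ-≼ (Pos-^ m Pos-φ) (≼-trans (2^≼φ^ k) (φ^-mono (≤-trans (≤-reflexive (lem w)) 2w+8≤d))))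
        (≼-trans (≼-reflexive (sym (^-homo-* φ d m))) φ^n≼)
        where
        lem : ∀ w → w + 4 + (w + 4) ≡ 2 * w + 8
        lem = ℕ-solve-∀
      16φ^m≼ : ι 8 *ᵣ (ι 2 *ᵣ (ι (2 ^ w) *ᵣ φ ^ᵣ m)) ≼ ι 8 *ᵣ ι (2 ^ a)
      16φ^m≼ = ≼-trans (≼-reflexive (trans (solve 2 (λ w x → (Κ (ι 8) ⊗ (Κ (ι 2) ⊗ (w ⊗ x))) ⊜ (w ⊗ Κ (ι 16) ⊗ x)) refl (ι (2 ^ w)) (φ ^ᵣ m))
          (cong (_*ᵣ φ ^ᵣ m) (trans (sym (ι-* (2 ^ w) 16)) (cong ι (sym (^-distribˡ-+-* 2 w 4)))))))
        (≼-trans 2^kφ^m≼ (≼-reflexive (trans (cong ι (^-distribˡ-+-* 2 3 a)) (ι-* 8 (2 ^ a)))))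
      total : ι (2 ^ w * (5 * 2 ^ h)) +ᵣ ι (2 ^ w) *ᵣ φ ^ᵣ m ≼ ι (2 ^ a)
      total = ι-cancelˡ 2 (s≤s z≤n) (≼-trans (≼-reflexive (distribˡ (ι 2) (ι (2 ^ w * (5 * 2 ^ h))) (ι (2 ^ w) *ᵣ φ ^ᵣ m)))
        (≼-trans (+-mono-≼ (≼-trans (≼-reflexive (sym (ι-* 2 (2 ^ w * (5 * 2 ^ h))))) (ι-mono 2^w*5*2^h)) (ι-cancelˡ 8 {ι 2 *ᵣ (ι (2 ^ w) *ᵣ φ ^ᵣ m)} {ι (2 ^ a)} (s≤s z≤n) 16φ^m≼))
          (≼-reflexive (solve 1 (λ a → (a ⊕ a) ⊜ (Κ (ι 2) ⊗ a)) refl (ι (2 ^ a))))))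

-- Evaluation

-- The approximation X F(t+1) / F(t) to X φ, whose ratio is off by about φ^(-2t), less than 2^-t for
-- large t. It is only a candidate: `φ-bounded` checks that it is the integer part. The divisor is
-- written `suc (pred x)` to be visibly nonzero.
mantissa : ℕ → ℕ → ℕ
mantissa t X = ratio (fib-pair t 0 1)
  where
  ratio : ℕ × ℕ → ℕ
  ratio (x , y) = (y * X) / suc (pred x)

-- Intermediate results are passed as arguments so that they are computed only once.
module Evaluator (t : ℕ) (X X′ : ℕ) .{{_ : NonZero X}} .{{_ : NonZero X′}} (thr c : ℕ) where

  open Machine X X′ thr t

  power : State → ℕ → State
  power base k = run base (digits t k []) base

  φ-state : State
  φ-state = linear-state X c (0 , 1) t

  five-state : State
  five-state = st 1 (5 * 2 ^ (t ∸ 2)) (5 * 2 ^ (t ∸ 2)) 0 (t ∸ 2)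

  one-state : ℕ → State
  one-state k = st k X X 0 t

  gap-state : ℕ → ℕ → ℕ → State
  gap-state d x y = shrink d (linear-state X c (x + 1 , y) t)

  check-close : ℕ → ℕ → ℕ → Bool
  check-close q p Λ₀ = φ-bounded X c ∧ close-verify (power φ-state q) q p Λ₀

  check-one : ℕ → ℕ → State → Bool
  check-one Q′ s s₅ = sep-verify (one-state (Q′ + Q′)) s₅ Q′ s

  check-gaps : ℕ → ℕ → State → ℕ → ℕ → ℕ → ℕ → Bool
  check-gaps Q′ s s₅ zero d x y = true
  check-gaps Q′ s s₅ (suc fuel) d x y =
    ((d ≡ᵇ 2) ∨ (d ≡ᵇ 6) ∨ sep-verify (power (gap-state d x y) (Q′ + Q′)) s₅ Q′ s) ∧ check-gaps Q′ s s₅ fuel (suc d) y (x + y)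

  module _ (X≡ : X ≡ 2 ^ t) (X′≡ : X′ ≡ 2 ^ suc t) where

    power-valid : ∀ {b} → Pos b → ∀ base k → Valid b base → Valid b (power base k)
    power-valid b≥0 base k ok = run-valid X≡ X′≡ b≥0 base (digits t k []) base ok ok

    check-close-sound : ∀ q p Λ₀ → check-close q p Λ₀ ≡ true → Close q p Λ₀
    check-close-sound q p Λ₀ ok = close-sound (power φ-state q) q p Λ₀
      (power-valid Pos-φ φ-state q (linear-valid X c t (0 , 1) X≡ (proj₁ (∧-split ok)))) (proj₂ (∧-split {φ-bounded X c} ok))

    five-valid : Valid (ι 5) five-state
    five-valid = enc (≼-reflexive eq) (≼-reflexive (sym eq))
      where
      k : ℕ
      k = t ∸ 2
      eq : ι (5 * 2 ^ k * 1) ≡ ι (2 ^ k) *ᵣ (ι 5 *ᵣ 1ᵣ)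
      eq = trans (cong ι (trans (ℕ.*-identityʳ _) (ℕ.*-comm 5 (2 ^ k)))) (ι-* (2 ^ k) 5)

    one-valid : ∀ k → Valid 1ᵣ (one-state k)
    one-valid k = enc (≼-reflexive eq) (≼-reflexive (sym eq))
      where
      eq : ι (X * 1) ≡ ι (2 ^ t) *ᵣ 1ᵣ ^ᵣ k
      eq = trans (cong ι (trans (ℕ.*-identityʳ X) X≡)) (sym (trans (cong (ι (2 ^ t) *ᵣ_) (^-1ᵣ k)) (*-identityʳ _)))

    check-one-sound : ∀ Q′ s s₅ → Valid (ι 5) s₅ → check-one Q′ s s₅ ≡ true → Separated 1ᵣ Q′ s
    check-one-sound Q′ s s₅ ok₅ = sep-sound (one-state (Q′ + Q′)) s₅ Q′ s (Pos-ι 1) (one-valid (Q′ + Q′)) ok₅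

    check-gaps-sound : φ-bounded X c ≡ true → ∀ Q′ s s₅ → Valid (ι 5) s₅ → ∀ fuel d x y → φ ^ᵣ d ≡ mk (+ x) (+ y) →
      check-gaps Q′ s s₅ fuel d x y ≡ true → ∀ k → k < fuel → (d + k ≡ 2 ⊎ d + k ≡ 6) ⊎ Separated (Gap (d + k)) Q′ s
    check-gaps-sound bounded Q′ s s₅ ok₅ (suc fuel) d x y φ^d≡ ok = go (∧-split ok)
      where
      test : Bool
      test = sep-verify (power (gap-state d x y) (Q′ + Q′)) s₅ Q′ s
      gap≡ : mk (+ (x + 1)) (+ y) ≡ Gap d
      gap≡ = trans (cong (λ z → mk (+ (x + 1)) (+ z)) (sym (ℕ.+-identityʳ y))) (cong (_+ᵣ 1ᵣ) (sym φ^d≡))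
      state-valid : Valid (Gap d) (gap-state d x y)
      state-valid = shrink-valid X≡ X′≡ (Gap-Pos d) d (linear-state X c (x + 1 , y) t)
        (subst (λ g → Valid g (linear-state X c (x + 1 , y) t)) gap≡ (linear-valid X c t (x + 1 , y) X≡ bounded))
      first : ((d ≡ᵇ 2) ∨ (d ≡ᵇ 6) ∨ test) ≡ true → (d ≡ 2 ⊎ d ≡ 6) ⊎ Separated (Gap d) Q′ s
      first eq = [ (λ e → inj₁ (inj₁ (≡ᵇ-sound d 2 e))) , (λ eq′ → [ (λ e → inj₁ (inj₂ (≡ᵇ-sound d 6 e))) ,
          (λ e → inj₂ (sep-sound (power (gap-state d x y) (Q′ + Q′)) s₅ Q′ s (Gap-Pos d) (power-valid (Gap-Pos d) (gap-state d x y) (Q′ + Q′) state-valid) ok₅ e)) ]′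
          (∨-split {d ≡ᵇ 6} eq′)) ]′ (∨-split {d ≡ᵇ 2} eq)
      φ^1+d≡ : φ ^ᵣ suc d ≡ mk (+ y) (+ (x + y))
      φ^1+d≡ = trans (cong (φ *ᵣ_) φ^d≡) (trans (cong (_*ᵣ mk (+ x) (+ y)) (sym (*-identityʳ φ))) (fib-pair-φ 1 x y))
      go : ((d ≡ᵇ 2) ∨ (d ≡ᵇ 6) ∨ test) ≡ true × check-gaps Q′ s s₅ fuel (suc d) y (x + y) ≡ true →
        ∀ k → k < suc fuel → (d + k ≡ 2 ⊎ d + k ≡ 6) ⊎ Separated (Gap (d + k)) Q′ s
      go (p , _) zero _ = subst (λ e → (e ≡ 2 ⊎ e ≡ 6) ⊎ Separated (Gap e) Q′ s) (sym (ℕ.+-identityʳ d)) (first p)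
      go (_ , q) (suc k) (s≤s lt) = subst (λ e → (e ≡ 2 ⊎ e ≡ 6) ⊎ Separated (Gap e) Q′ s) (sym (+-suc d k))
        (check-gaps-sound bounded Q′ s s₅ ok₅ fuel (suc d) y (x + y) φ^1+d≡ q k lt)

close-check : ℕ → ℕ → ℕ → ℕ → Bool
close-check t q p Λ₀ = with-powers (2 ^ t) (2 ^ suc t) {{m^n≢0 2 t}} {{m^n≢0 2 (suc t)}}
  where
  with-powers : (X X′ : ℕ) .{{_ : NonZero X}} .{{_ : NonZero X′}} → Bool
  with-powers X X′ = Evaluator.check-close t X X′ (X * X′) (mantissa t X) q p Λ₀

close-check-sound : ∀ t q p Λ₀ → close-check t q p Λ₀ ≡ true → Close q p Λ₀
close-check-sound t q p Λ₀ = Evaluator.check-close-sound t (2 ^ t) (2 ^ suc t) {{m^n≢0 2 t}} {{m^n≢0 2 (suc t)}} _ (mantissa t (2 ^ t)) refl refl q p Λ₀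

one-check : ℕ → ℕ → ℕ → Bool
one-check t Q′ s = with-powers (2 ^ t) (2 ^ suc t) {{m^n≢0 2 t}} {{m^n≢0 2 (suc t)}}
  where
  with-powers : (X X′ : ℕ) .{{_ : NonZero X}} .{{_ : NonZero X′}} → Bool
  with-powers X X′ = check-one Q′ s (power five-state Q′)
    where open Evaluator t X X′ (X * X′) 0

one-check-sound : ∀ t Q′ s → one-check t Q′ s ≡ true → Separated 1ᵣ Q′ s
one-check-sound t Q′ s = check-one-sound refl refl Q′ s (power five-state Q′) (power-valid refl refl (Pos-ι 5) five-state Q′ (five-valid refl refl))
  where open Evaluator t (2 ^ t) (2 ^ suc t) {{m^n≢0 2 t}} {{m^n≢0 2 (suc t)}} (2 ^ t * 2 ^ suc t) 0

gaps-check : ℕ → ℕ → ℕ → ℕ → Bool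
gaps-check t Q′ s D = with-powers (2 ^ t) (2 ^ suc t) {{m^n≢0 2 t}} {{m^n≢0 2 (suc t)}}
  where
  with-powers : (X X′ : ℕ) .{{_ : NonZero X}} .{{_ : NonZero X′}} → Bool
  with-powers X X′ = with-mantissa (mantissa t X) (X * X′)
    where
    with-mantissa : ℕ → ℕ → Bool
    with-mantissa c thr = φ-bounded X c ∧ check-gaps Q′ s (power five-state Q′) D 0 1 0
      where open Evaluator t X X′ thr c

gaps-check-sound : ∀ t Q′ s D → gaps-check t Q′ s D ≡ true → ∀ d → d < D → (d ≡ 2 ⊎ d ≡ 6) ⊎ Separated (Gap d) Q′ s
gaps-check-sound t Q′ s D ok = check-gaps-sound refl refl (proj₁ split) Q′ s (power five-state Q′)
    (power-valid refl refl (Pos-ι 5) five-state Q′ (five-valid refl refl)) D 0 1 0 refl (proj₂ split)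
  where
  open Evaluator t (2 ^ t) (2 ^ suc t) {{m^n≢0 2 t}} {{m^n≢0 2 (suc t)}} (2 ^ t * 2 ^ suc t) (mantissa t (2 ^ t))
  split : φ-bounded (2 ^ t) (mantissa t (2 ^ t)) ≡ true × check-gaps Q′ s (power five-state Q′) D 0 1 0 ≡ true
  split = ∧-split ok

-- Constants

-- A certificate that turns n ≤ 2ᵏ with k + 17 ≤ λ₀ into d < 2 w + 8, provided that a ≥ 2 w + 8. The
-- tolerance is 2^-16 throughout, and `level-weight` says that w bits of accuracy survive the Q-th
-- power to this extent.
record Stage (Q′ P λ₀ w : ℕ) : Set where
  field
    level-close : Close (Q′ + Q′) P λ₀
    level-one : Separated 1ᵣ Q′ 16
    level-weight : 2 * (Q′ + Q′) * 2 ^ 16 ≤ 2 ^ w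

-- Adds certificates for the remaining d, so that a ≥ 2 w + 8 is refuted altogether. Bézout's
-- relation serves the two degenerate gaps.
record GapStage (Q′ P λ₀ w : ℕ) : Set where
  field
    level : Stage Q′ P λ₀ w
    level-gaps : ∀ d → d < 2 * w + 8 → (d ≡ 2 ⊎ d ≡ 6) ⊎ Separated (Gap d) Q′ 16
    {bezout-x bezout-y} : ℕ
    bezout : bezout-x * P ≡ suc (bezout-y * (Q′ + Q′))
  open Stage level public

-- The q's and the doubled halves are denominators of convergents of log φ / log 2, the p's and P's their numerators.
-- They are abstract so that powers with these exponents are never evaluated.
abstract

  q₂ p₂ q₁ p₁ A-half A-P B-half B-P C-half C-P : ℕ
  q₂ = 233138689661584686228290984507641658685479693534412982529975449
  p₂ = 161854650051993166583939220776926151991722872709714744895526566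
  q₁ = 327940702099733408414556270566330912736544834939927049234061488718517748883627001267647545283873735984576073416190348323301348287223674929149858298115877114518320249842291964971552170415358074411194834348973496584098485165623980277910424036808725439280564303554589120691331289497164629162424581105152357604971548607206206738764507891042038005732880491586281106141870312710677871320955660431560732139803686485560079358308065941519693722421083826617149540555133058201836341059384172129287136480550492891677344428947955536660942778243409960684448920734928660440025566784335713534704893434559675133824341449869379981544520471604450750762887371110653564100344414227371316455774845493562840220025764799446715614722872762850927519732888778744990569196227248538792668667556309569128910372273857986197373347419942597337057696384639676750190198018924102006495202295057074539771371192026293442196590305032238055944296278070161773116225773244342069616084233270948477913846909973030230973977330670222547208460518690993194046213538538395620189996872191568943298556320026911466137587527352228544444782618081853189986
  p₁ = 227670180583087118936190155989208082524206049648098770565313396002582074732696382822535972043868120476501394626876778095553508872398649724556237170555807257681828188940024391565680288225202755652910270194617227937873063692305244253754865623230521754526217857580159778801775006936530559518405885208466607807937546365591208133606734708571139109774378859193746356645920519727645219600301302489116758964869158988745352830720255449807536115322654588114210283598029027947868711722217106341121952697053358576689195429821004231203615847562491646987507899340268722646505788363412536708645417583658305104537618679673226800902406078069336970970993786831936307871863193527579496221212086451575496761921832959395172832852580360076174833676248290326726071615947044700966104782511978405389933086833684605158524197084818645949526969979199050454348039479602969848346856621481573821947845569404712054319708634579698746726398248213869636270463892574718608773524904931427790128428499372886304250799603785863540568682492584191897839509503681029733066913414918233308455490393035535538500313976198320056675132105852753041755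
  A-half = 713869733639963290151064319981214160058937585435484716606092932998707983840587438361724268877666588095262497921858600451776975700620437938713041249636959595468237146868965500240818603215694415807139394127695590502970763665856819423658049156011605928288951799262094529500767414544743896796244839238051848039035916550591359529418004224894833281701518342160977388972074453740491773055812911481075019030546076308301292059713041309627839697238226128636069403123148232798038281959380304165655780690364978712355859714155337304197024981779746857716593006657645747178857943595443910178213099499359100496089192819724643702127163076697946900520763568899584585418975993735881876228812396900789306659344065359857179041579791969464464702085259127882782663631496308737980253628624170746934687159364811838480136486306600791736180645794518456601379780516478754608918077057026863317291523049212965117344933423149450007702712127791586440341804906046582528932891463692171399262651793280640422409959114686544592086028748906245476210337019839388159644956573366642561432806502802704629948218890428394959424574958417539517579260901622345445376729942587707743765667531436379521847022608189533838141653740460037081467928596238934346616958542375904889375996019345735132949715544169326970963860660283455896795130045805051971329125673937272876801495134929822940017457119685233614463539277224872465960901039896174848941780291072170505602748772391151203713444099601097258179458389088018245097169686659753482661244660243113857708908279703234023645290202527302586103833685195714410495713819402770139488271028363884780938429884599950444762585799427407042383082181720112331024855558295017039010340260690231824619125852207688680396388540105684062303213395226292565665232592518574869641586691216342833189196824185642720902105295774073702445468913604289943527009096242077080640700371761898901680874032473291589621658762073985868577652775125869199513419363829086633803226592786967154353545446262647223442992848397017056657764275567448929581315141218861733528158237264613956033571185441847651556621154209649450222329809807551968358200409868202153929844996952963251540246633089313576647701070808596174139186538646970763084136561822100543083040202926085638844349937227696511871813756395793372953001688739245983545460309659073696971285823135853567040166205968306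
  A-P = 991196579930374346050543038621287732941957448752225438342993102743677909704388448943664291657872970474808919520645180139810192778209807120004514135054917812989616568977219949639590037067188348460682996659018787219456679016673396558169199353051660724843016732891063286309100354789879808301695874185111880815669919734870641682044953999724217448481332713800611126324281244098272013826320701263706043338996505324278694731281222656671150751363197336870547629248762401399845631016021506058076295966466503286061856091184074310605281464380346271657908722883449383646358522038620421440662029097463613951464199899761903680259701777896969074766090993393978573314490724917730025147428959417142496339346930460547640422683806848599741893174894581321797575878579821676046387690593905528168518459042310361529347946867497087312462680784689927135810364416356240857169729074162899081023181447080689771454984931543429342045360589220067776297653811920799984990641378624098602647598713468643771058669265270575223989132233771331308181314541331703400883617501397345629014478153537049937532507279447413629186969819858993636122129856623245578806439785278517501277236224600088882881870809054558182514866961452116812266043032118747243999115279111720146634227937888443292025074162550166164783243765522985527876750391506020613826915545441736127425429875785978059725901923607400833749848179843830545530416813482588131549937183678937638469788051144061684575795447886734577777858748157077386478605472494573616389553103302648962246691296821994242381134484743496746310225684587736933425591472640893761596481201100504121105412982945751230752465859632823533655424522678832562601768124790450828465850400542420089151016619780497985592616362284515328421717518525471171649420969624512623311395178986142736204942784139607381204375681456779555209073522414267353948414613898185053622684357435700062149995611761375543624593588932791276285523651162438080212439540527605850284795301249316879504837787711472204827257977157829277781285189552120528791689645229952721996610384157219691337405819068466770262956129141871856338784991057406335918435281751805083625078716678692793288015669121878649471798681423740689781441827296137614260068236920142490680135144480759059200741714485982338888431876942572344869681236360012124342760550343527491239087544344283860425905762703681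
  B-half = 4104949414963446064134816258642126040505639436406718472154000357425998627362968543918232819969104804004125046075615402176902745931648019135987915119518
  B-P = 5699655874402211488951499147626119457496195261814125540055444211811206733194853425274145045709023944614355531953833514253894027656684088569725357810547
  C-half = 615314737
  C-P = 854354561

  h₂ Λ₂ h₁ Λ₁ slack₂ slack₁ u e₁ : ℕ
  h₂ = 9
  Λ₂ = 207
  h₁ = 255
  Λ₁ = 3651
  slack₂ = 196
  slack₁ = 2 ^ 255
  u = 2 ^ 208
  e₁ = 7580

  close₂ : Close q₂ p₂ Λ₂
  close₂ = close-check-sound 480 q₂ p₂ Λ₂ refl

  q₂≤u : q₂ ≤ u
  q₂≤u = ≤ᵇ-sound q₂ u refl

  1≤p₂ : 1 ≤ p₂
  1≤p₂ = ≤ᵇ-sound 1 p₂ refl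

  p₂≤q₂ : p₂ ≤ q₂
  p₂≤q₂ = ≤ᵇ-sound p₂ q₂ refl

  Λ₂-large : 14 * suc h₂ + 67 ≤ Λ₂
  Λ₂-large = ≤ᵇ-sound (14 * suc h₂ + 67) Λ₂ refl

  2^h₂ : 2 ^ suc h₂ ≡ 1024
  2^h₂ = refl

  slack₂≤ : 2 * (2 * Λ₂) + slack₂ ≤ 2 ^ suc h₂
  slack₂≤ = ≤ᵇ-sound (2 * (2 * Λ₂) + slack₂) (2 ^ suc h₂) refl

  -- 57 is the least lower bound on a with which `weight-bound` applies to these parameters.
  slack₂≥ : 7 * (2 * Λ₂) + 8 * 2 ^ suc h₂ ≤ slack₂ * 57
  slack₂≥ = ≤ᵇ-sound (7 * (2 * Λ₂) + 8 * 2 ^ suc h₂) (slack₂ * 57) refl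

  9≤u : 9 ≤ u
  9≤u = ≤ᵇ-sound 9 u refl

  close₁ : Close q₁ p₁ Λ₁
  close₁ = close-check-sound 7400 q₁ p₁ Λ₁ refl

  core-bound₁ : q₁ * (12 * (q₁ + 0 + 8) * 2 ^ suc h₁) + suc q₁ < 2 ^ e₁
  core-bound₁ = <ᵇ-sound (q₁ * (12 * (q₁ + 0 + 8) * 2 ^ suc h₁) + suc q₁) (2 ^ e₁) refl

  1≤p₁ : 1 ≤ p₁
  1≤p₁ = ≤ᵇ-sound 1 p₁ refl

  p₁≤q₁ : p₁ ≤ q₁
  p₁≤q₁ = ≤ᵇ-sound p₁ q₁ refl

  Λ₁-large : 14 * suc h₁ + 67 ≤ Λ₁
  Λ₁-large = ≤ᵇ-sound (14 * suc h₁ + 67) Λ₁ refl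

  slack₁≤ : 2 * (2 * Λ₁) + slack₁ ≤ 2 ^ suc h₁
  slack₁≤ = ≤ᵇ-sound (2 * (2 * Λ₁) + slack₁) (2 ^ suc h₁) refl

  slack₁≥ : 7 * (2 * Λ₁) + 8 * 2 ^ suc h₁ ≤ slack₁ * 57
  slack₁≥ = ≤ᵇ-sound (7 * (2 * Λ₁) + 8 * 2 ^ suc h₁) (slack₁ * 57) refl

  -- This dictates the size of `h₁`: the first application bounds d by about 2 Λ₁ n / 2^(h₁+1), the
  -- linear bound multiplies d by 131072 u, and the product must not exceed n / 2.
  uΛ₁≤ : 2 * (131072 * u) * (2 * Λ₁) ≤ 2 ^ suc h₁
  uΛ₁≤ = ≤ᵇ-sound (2 * (131072 * u) * (2 * Λ₁)) (2 ^ suc h₁) refl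

  u≤e₁ : 2 * (131072 * u) * (4 * u + 8) < 2 ^ e₁
  u≤e₁ = <ᵇ-sound (2 * (131072 * u) * (4 * u + 8)) (2 ^ e₁) refl

  2≤e₁ : 2 ≤ 2 ^ e₁
  2≤e₁ = ≤ᵇ-sound 2 (2 ^ e₁) refl

  e₁+17≤ : e₁ + 17 ≤ 7700
  e₁+17≤ = ≤ᵇ-sound (e₁ + 17) 7700 refl

  e₂ : ℕ
  e₂ = 437

  e₂+17≤ : e₂ + 17 ≤ 500
  e₂+17≤ = ≤ᵇ-sound (e₂ + 17) 500 refl

  e₂≥₁ : 30914 ≤ 2 ^ e₂
  e₂≥₁ = ≤ᵇ-sound 30914 (2 ^ e₂) refl

  e₂≥₂ : 131072 * u * (4 * u + 15452) + 3 ≤ 2 ^ e₂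
  e₂≥₂ = ≤ᵇ-sound (131072 * u * (4 * u + 15452) + 3) (2 ^ e₂) refl

  level-A : Stage A-half A-P 7700 7722
  level-A = record
    { level-close = close-check-sound 15500 (A-half + A-half) A-P 7700 refl
    ; level-one = one-check-sound 7800 A-half 16 refl
    ; level-weight = ≤ᵇ-sound (2 * (A-half + A-half) * 2 ^ 16) (2 ^ 7722) refl }

  level-B : GapStage B-half B-P 500 519
  level-B = record
    { level = record
      { level-close = close-check-sound 1100 (B-half + B-half) B-P 500 refl
      ; level-one = one-check-sound 560 B-half 16 refl
      ; level-weight = ≤ᵇ-sound (2 * (B-half + B-half) * 2 ^ 16) (2 ^ 519) refl }
    ; level-gaps = gaps-check-sound 560 B-half 16 1046 refl
    ; bezout-x = 7354287483960794648370141116620986824903053996746019495633069229945186141756586563695382725265563345291110452850953069681200775143790899693932859577035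
    ; bezout-y = 5105654616254639823031362224977726246126964493755069117715001923514792135278431478874010799972017279203873841024694941272223864669657403096597242862004
    ; bezout = refl }

  level-C : GapStage C-half C-P 30 48
  level-C = record
    { level = record
      { level-close = close-check-sound 100 (C-half + C-half) C-P 30 refl
      ; level-one = one-check-sound 80 C-half 16 refl
      ; level-weight = ≤ᵇ-sound (2 * (C-half + C-half) * 2 ^ 16) (2 ^ 48) refl }
    ; level-gaps = gaps-check-sound 80 C-half 16 104 refl
    ; bezout-x = 1221481209
    ; bezout-y = 848003452
    ; bezout = refl }

  B-large : 2 ^ e₂ < B-half + B-half
  B-large = <ᵇ-sound (2 ^ e₂) (B-half + B-half) refl

  C-large : 2 ^ 12 < C-half + C-half
  C-large = <ᵇ-sound (2 ^ 12) (C-half + C-half) refl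

-- Bounding the solutions

record Quotients (N q h : ℕ) : Set where
  field
    r n₀ x : ℕ
    N≡ : q * r + n₀ ≡ N
    2≤n₀ : 2 ≤ n₀
    n₀≤ : n₀ ≤ suc q
    x≤ : x * 2 ^ suc h ≤ r
    r< : r < suc x * 2 ^ suc h

-- N - 2 is divided instead of N, so that the remainder n₀ is at least 2.
quotients : ∀ N q h → 1 ≤ q → 2 ≤ N → Quotients N q h
quotients N q h 1≤q 2≤N = record
  { r = r ; n₀ = N′ % q + 2 ; x = r / g
  ; N≡ = trans (lem q r (N′ % q)) (trans (cong (ℕ._+ 2) (sym (m≡m%n+[m/n]*n N′ q))) (m∸n+n≡m 2≤N))
  ; 2≤n₀ = m≤n+m 2 (N′ % q)
  ; n₀≤ = ≤-trans (≤-reflexive (ℕ.+-comm (N′ % q) 2)) (s≤s (m%n<n N′ q))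
  ; x≤ = m/n*n≤m r g
  ; r< = ≤-trans (s≤s (≤-reflexive (m≡m%n+[m/n]*n r g))) (+-monoˡ-< (r / g * g) (m%n<n r g)) }
  where
  instance
    q≢0 : NonZero q
    q≢0 = ℕ.>-nonZero 1≤q
    g≢0 : NonZero (2 ^ suc h)
    g≢0 = m^n≢0 2 (suc h)
  N′ r g : ℕ
  N′ = N ∸ 2
  g = 2 ^ suc h
  r = N′ / q
  lem : ∀ q r y → q * r + (y + 2) ≡ y + r * q + 2
  lem = ℕ-solve-∀

quotients-weight : ∀ {N q h} p (Q : Quotients N q h) → p ≤ q → 2 ^ suc h * (Quotients.x Q * p) ≤ N
quotients-weight {N} {q} {h} p Q p≤q = begin
  2 ^ suc h * (x * p) ≡⟨ lem (2 ^ suc h) x p ⟩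
  p * (x * 2 ^ suc h) ≤⟨ *-mono-≤ p≤q x≤ ⟩
  q * r ≤⟨ m≤m+n (q * r) n₀ ⟩
  q * r + n₀ ≡⟨ N≡ ⟩
  N ∎
  where
  open ℕ.≤-Reasoning
  open Quotients Q
  lem : ∀ g x p → g * (x * p) ≡ p * (x * g)
  lem = ℕ-solve-∀

-- The interpolation argument refutes every x ≥ 12 (q + δ + 8); a smaller x bounds r and with it N.
core-bound : ∀ {q p Λ₀ h} → Close q p Λ₀ → 1 ≤ p → 14 * suc h + 67 ≤ Λ₀ →
  ∀ {G} δ → Pos G → 1ᵣ ≼ G → G ≼ ι (2 ^ δ) → Bd (conj G) (ι 2) →
  ∀ {N} a (Q : Quotients N q h) → Approx (Λ₀ * (Quotients.x Q * p)) a (φ ^ᵣ N *ᵣ G) →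
  N ≤ q * (12 * (q + δ + 8) * 2 ^ suc h) + suc q
core-bound {q} {p} {Λ₀} {h} q-close 1≤p Λ₀≥ {G} δ G-Pos 1≼G G≼ conj-G {N} a Q approx =
    [ small , (λ y≤x → ⊥-elim (CoreApplication.impossible {q} {p} {Λ₀} {h} q-close 1≤p Λ₀≥ {G} {δ} G-Pos 1≼G G≼ conj-G {N} {a}
        {Λ₀ * (x * p)} approx r n₀ x N≡ 2≤n₀ n₀≤ x≤ r< y≤x ≤-refl)) ]′ (<-≤-connex x (12 * (q + δ + 8)))
  where
  open Quotients Q
  small : x < 12 * (q + δ + 8) → N ≤ q * (12 * (q + δ + 8) * 2 ^ suc h) + suc q
  small x<y = ≤-trans (≤-reflexive (sym N≡)) (+-mono-≤ (*-monoʳ-≤ q (≤-trans (<⇒≤ r<) (*-monoˡ-≤ (2 ^ suc h) x<y))) n₀≤)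

Gap-≼ : ∀ d → Gap d ≼ ι (2 ^ suc d)
Gap-≼ d = ≼-trans (+-mono-≼ (φ^≼2^ d) (ι-mono (m^n>0 2 d))) (≼-reflexive (cong (λ k → ι (2 ^ d + k)) (sym (ℕ.+-identityʳ (2 ^ d)))))

1≼Gap : ∀ d → 1ᵣ ≼ Gap d
1≼Gap d = ≼⁺ (subst Pos (solve 1 (λ x → x ⊜ ((x ⊕ Κ 1ᵣ) ⊕ ⊝ Κ 1ᵣ)) refl (φ ^ᵣ d)) (Pos-^ d Pos-φ))

conj-Gap : ∀ d → Bd (conj (Gap d)) (ι 2)
conj-Gap d = subst (λ y → Bd y (ι 2)) (sym (conj-+ (φ ^ᵣ d) 1ᵣ)) (Bd-+ (conj-φ^-Bd d) (Pos⇒Bd (Pos-ι 1)))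

-- Used with M = 2^(h+1), k = 2 Λ₀ and y = x p: the accuracy that the interpolation argument
-- requires is available as soon as 4 Λ₀ is less than M by some c, and a ≥ a₀ lets c a absorb the
-- constants.
weight-bound : ∀ M k c a₀ y a → M * y ≤ 2 * a + 7 → a₀ ≤ a → 1 ≤ M → 2 * k + c ≤ M → 7 * k + 8 * M ≤ c * a₀ → k * y + 8 ≤ a
weight-bound M k c a₀ y a My≤ a₀≤a 1≤M 2k+c≤M const≤ = *-cancelˡ-≤ M {{ℕ.>-nonZero 1≤M}} (begin
  M * (k * y + 8) ≡⟨ lem₁ M k y ⟩
  k * (M * y) + 8 * M ≤⟨ +-monoˡ-≤ (8 * M) (*-monoʳ-≤ k My≤) ⟩
  k * (2 * a + 7) + 8 * M ≡⟨ lem₂ k a (8 * M) ⟩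
  2 * k * a + (7 * k + 8 * M) ≤⟨ +-monoʳ-≤ (2 * k * a) (≤-trans const≤ (*-monoʳ-≤ c a₀≤a)) ⟩
  2 * k * a + c * a ≡⟨ sym (*-distribʳ-+ a (2 * k) c) ⟩
  (2 * k + c) * a ≤⟨ *-monoˡ-≤ a 2k+c≤M ⟩
  M * a ∎)
  where
  open ℕ.≤-Reasoning
  lem₁ : ∀ M k y → M * (k * y + 8) ≡ k * (M * y) + 8 * M
  lem₁ = ℕ-solve-∀
  lem₂ : ∀ k a e → k * (2 * a + 7) + e ≡ 2 * k * a + (7 * k + e)
  lem₂ = ℕ-solve-∀

module Chain {d m a} (ineq : Ineq (d + m) m a) where

  open Solution {d} {m} {a} ineq

  m≤n : m ≤ n
  m≤n = m≤n+m m d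

  1≤u : 1 ≤ u
  1≤u = ≤-trans (s≤s z≤n) 9≤u

  -- The interpolation argument for N = m and G = φᵈ + 1. Since G ≤ 2^(d+1), d enters `core-bound`
  -- linearly through δ; the rest is rounding, with 65536 = 64 · 2^10.
  m-bound : 57 ≤ a → m ≤ 65536 * u * (4 * u + d)
  m-bound 57≤a = [ (λ m<2 → ≤-trans (≤-pred m<2) (positive u 1≤u)) , large ]′ (<-≤-connex m 2)
    where
    positive : ∀ u → 1 ≤ u → 1 ≤ 65536 * u * (4 * u + d)
    positive u 1≤u = *-mono-≤ {1} {65536 * u} {1} (≤-trans 1≤u (m≤n*m u 65536)) (≤-trans (≤-trans 1≤u (m≤n*m u 4)) (m≤m+n (4 * u) d))
    arithmetic : ∀ c q u → 1 ≤ c → q ≤ u → 9 ≤ u → q * (12 * (q + suc d + 8) * c) + suc q ≤ 64 * c * u * (4 * u + d)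
    arithmetic c q u 1≤c q≤u 9≤u = begin
      q * (12 * (q + suc d + 8) * c) + suc q
        ≡⟨ cong (λ z → q * (12 * z * c) + suc q) (lem₁ q d) ⟩
      q * (12 * (q + d + 9) * c) + suc q
        ≤⟨ +-mono-≤ (*-mono-≤ q≤u (*-monoˡ-≤ c (*-monoʳ-≤ 12 (+-mono-≤ (+-monoˡ-≤ d q≤u) 9≤u)))) (+-mono-≤ {1} {u} (≤-trans (s≤s z≤n) 9≤u) q≤u) ⟩
      u * (12 * (u + d + u) * c) + (u + u)
        ≤⟨ +-monoʳ-≤ (u * (12 * (u + d + u) * c)) (+-mono-≤ u≤cuu u≤cuu) ⟩
      u * (12 * (u + d + u) * c) + (c * (u * u) + c * (u * u))
        ≤⟨ m≤m+n _ (230 * (c * (u * u)) + 52 * (c * (u * d))) ⟩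
      u * (12 * (u + d + u) * c) + (c * (u * u) + c * (u * u)) + (230 * (c * (u * u)) + 52 * (c * (u * d)))
        ≡⟨ lem₂ c u d ⟩
      64 * c * u * (4 * u + d) ∎
      where
      open ℕ.≤-Reasoning
      u≤cuu : u ≤ c * (u * u)
      u≤cuu = ≤-trans (m≤m*n u u {{ℕ.>-nonZero (≤-trans (s≤s z≤n) 9≤u)}}) (m≤n*m (u * u) c {{ℕ.>-nonZero 1≤c}})
      lem₁ : ∀ q d → q + suc d + 8 ≡ q + d + 9
      lem₁ = ℕ-solve-∀
      lem₂ : ∀ c u d → u * (12 * (u + d + u) * c) + (c * (u * u) + c * (u * u)) + (230 * (c * (u * u)) + 52 * (c * (u * d)))
        ≡ 64 * c * u * (4 * u + d)
      lem₂ = ℕ-solve-∀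
    large : 2 ≤ m → m ≤ 65536 * u * (4 * u + d)
    large 2≤m = ≤-trans (subst (λ g → m ≤ q₂ * (12 * (q₂ + suc d + 8) * g) + suc q₂) 2^h₂
        (core-bound {q₂} {p₂} {Λ₂} {h₂} close₂ 1≤p₂ Λ₂-large {Gap d} (suc d) (Gap-Pos d) (1≼Gap d) (Gap-≼ d) (conj-Gap d) {m} a Q
          (approx-gap (Λ₂ * y) weight)))
        (arithmetic 1024 q₂ u (s≤s z≤n) q₂≤u 9≤u)
      where
      Q : Quotients m q₂ h₂
      Q = quotients m q₂ h₂ (≤-trans 1≤p₂ p₂≤q₂) 2≤m
      y : ℕ
      y = Quotients.x Q * p₂
      weight : 2 * (Λ₂ * y) + 8 ≤ a
      weight = ≤-trans (≤-reflexive (cong (ℕ._+ 8) (sym (ℕ.*-assoc 2 Λ₂ y))))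
        (weight-bound (2 ^ suc h₂) (2 * Λ₂) slack₂ 57 y a (≤-trans (quotients-weight p₂ Q p₂≤q₂) (≤-trans m≤n n≤2a+7)) 57≤a
          (m^n>0 2 (suc h₂)) slack₂≤ slack₂≥)

  n-bound : 57 ≤ a → n ≤ 131072 * u * (4 * u + d)
  n-bound 57≤a = ≤-trans (+-mono-≤ (d≤ u 1≤u) (m-bound 57≤a)) (≤-reflexive (lem u (4 * u + d)))
    where
    d≤ : ∀ u → 1 ≤ u → d ≤ 65536 * u * (4 * u + d)
    d≤ u 1≤u = ≤-trans (m≤n+m d (4 * u)) (m≤n*m (4 * u + d) (65536 * u) {{ℕ.>-nonZero (≤-trans 1≤u (m≤n*m u 65536))}})
    lem : ∀ u v → 65536 * u * v + 65536 * u * v ≡ 131072 * u * v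
    lem = ℕ-solve-∀

  -- For huge n, the first application of the interpolation argument bounds d by a tiny multiple of n.
  n<2^e₁ : 57 ≤ a → n < 2 ^ e₁
  n<2^e₁ 57≤a = ≰⇒> huge
    where
    huge : ¬ (2 ^ e₁ ≤ n)
    huge n≥ = [ far , near ]′ (<-≤-connex d (2 * (Λ₁ * y) + 8))
      where
      Q : Quotients n q₁ h₁
      Q = quotients n q₁ h₁ (≤-trans 1≤p₁ p₁≤q₁) (≤-trans 2≤e₁ n≥)
      y : ℕ
      y = Quotients.x Q * p₁
      y≤ : 2 ^ suc h₁ * y ≤ n
      y≤ = quotients-weight p₁ Q p₁≤q₁
      weight : 2 * (Λ₁ * y) + 8 ≤ a
      weight = ≤-trans (≤-reflexive (cong (ℕ._+ 8) (sym (ℕ.*-assoc 2 Λ₁ y))))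
        (weight-bound (2 ^ suc h₁) (2 * Λ₁) slack₁ 57 y a (≤-trans y≤ n≤2a+7) 57≤a (m^n>0 2 (suc h₁)) slack₁≤ slack₁≥)
      near : 2 * (Λ₁ * y) + 8 ≤ d → ⊥
      near le = <⇒≱ core-bound₁ (≤-trans n≥ (core-bound {q₁} {p₁} {Λ₁} {h₁} close₁ 1≤p₁ Λ₁-large {1ᵣ} 0 (Pos-ι 1) ≼-refl ≼-refl
          (Bd-mono (Pos⇒Bd (Pos-ι 1)) (ι-mono {1} {2} (s≤s z≤n))) {n} a Q (approx-one (Λ₁ * y) weight le)))
      far : d < 2 * (Λ₁ * y) + 8 → ⊥
      far lt = <⇒≱ u≤e₁ (≤-trans n≥ (+-cancelˡ-≤ n _ _ (begin
          n + n ≡⟨ cong (n ℕ.+_) (sym (ℕ.+-identityʳ n)) ⟩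
          2 * n ≤⟨ *-monoʳ-≤ 2 (≤-trans (n-bound 57≤a) (*-monoʳ-≤ (131072 * u) (+-monoʳ-≤ (4 * u) (<⇒≤ lt)))) ⟩
          2 * (131072 * u * (4 * u + (2 * (Λ₁ * y) + 8)))
            ≡⟨ lem (131072 * u) u Λ₁ y ⟩
          2 * (131072 * u) * (2 * Λ₁) * y + 2 * (131072 * u) * (4 * u + 8)
            ≤⟨ +-monoˡ-≤ (2 * (131072 * u) * (4 * u + 8)) (≤-trans (*-monoˡ-≤ y uΛ₁≤) y≤) ⟩
          n + 2 * (131072 * u) * (4 * u + 8) ∎)))
        where
        open ℕ.≤-Reasoning
        lem : ∀ k u Λ₁ y → 2 * (k * (4 * u + (2 * (Λ₁ * y) + 8))) ≡ 2 * k * (2 * Λ₁) * y + 2 * k * (4 * u + 8)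
        lem = ℕ-solve-∀

  small-N : ∀ N λ₀ k → N ≤ 2 ^ k → k + 17 ≤ λ₀ → 2 * N * 2 ^ 16 ≤ 2 ^ λ₀
  small-N N λ₀ k N≤ k+17≤ = ≤-trans (*-monoˡ-≤ (2 ^ 16) (*-monoʳ-≤ 2 N≤))
    (≤-trans (≤-reflexive (sym (^-distribˡ-+-* 2 (suc k) 16))) (^-monoʳ-≤ 2 (≤-trans (≤-reflexive (sym (+-suc k 16))) k+17≤)))

  -- If d were larger, φⁿ alone would approximate √5 2ᵃ to w bits, and a power of 5 would be close
  -- to a power of 2.
  stage-one : ∀ {Q′ P λ₀ w} → Stage Q′ P λ₀ w → ∀ k → n ≤ 2 ^ k → k + 17 ≤ λ₀ → 2 * w + 8 ≤ a → d < 2 * w + 8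
  stage-one {Q′} {P} {λ₀} {w} S k n≤ k+17≤ w≤a = ≰⇒> λ w≤d →
    Reduction.not-separated {w} {a} {n} {1ᵣ} {Q′} {P} {λ₀} {16} (approx-one w w≤a w≤d) level-close level-weight (Pos-ι 1) (small-N n λ₀ k n≤ k+17≤) level-one
    where open Stage S

  stage-gap : ∀ {Q′ P λ₀ w} → GapStage Q′ P λ₀ w → ∀ k → n + 3 ≤ 2 ^ k → k + 17 ≤ λ₀ → 2 ^ k < Q′ + Q′ → a < 2 * w + 8
  stage-gap {Q′} {P} {λ₀} {w} S k n+3≤ k+17≤ 2^k<Q = ≰⇒> λ w≤a →
      go w≤a (level-gaps d (stage-one level k (≤-trans (m≤m+n n 3) n+3≤) k+17≤ w≤a))
    where
    open GapStage S
    module _ (w≤a : 2 * w + 8 ≤ a) where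
      open Reduction {w} {a} {m} {Gap d} {Q′} {P} {λ₀} {16} (approx-gap w w≤a) level-close level-weight
      m+κ≤ : ∀ κ → κ ≤ 3 → m + κ ≤ 2 ^ k
      m+κ≤ κ κ≤3 = ≤-trans (+-mono-≤ m≤n κ≤3) n+3≤
      special : ∀ μ κ → 1 ≤ κ → κ ≤ 3 → Gap d ≡ √5 *ᵣ ι (2 ^ μ) *ᵣ φ ^ᵣ κ → ⊥
      special μ κ 1≤κ κ≤3 G≡ = not-degenerate μ κ G≡ (m≤m+n 4 65532) (small-N (m + κ) λ₀ k (m+κ≤ κ κ≤3) k+17≤) bezout-x bezout-y bezout 1≤κ
        (≤-<-trans (m+κ≤ κ κ≤3) 2^k<Q)
      go : (d ≡ 2 ⊎ d ≡ 6) ⊎ Separated (Gap d) Q′ 16 → ⊥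
      -- For odd k, φ²ᵏ + 1 = √5 F(k) φᵏ. Here k = 1 and k = 3, with F 1 = 2⁰ and F 3 = 2¹.
      go (inj₁ (inj₁ d≡2)) = special 0 1 (s≤s z≤n) (s≤s z≤n) (cong Gap d≡2)
      go (inj₁ (inj₂ d≡6)) = special 1 3 (s≤s z≤n) (s≤s (s≤s (s≤s z≤n))) (cong Gap d≡6)
      go (inj₂ sep) = not-separated (Gap-Pos d) (small-N m λ₀ k (≤-trans (m≤m+n m 0) (m+κ≤ 0 z≤n)) k+17≤) sep

  -- The stage needs a ≥ 15452 = 2 · 7722 + 8; below that n ≤ 2 a + 7 suffices. The resulting d <
  -- 15452 turns the linear bound for n into an absolute one. The summand 3 leaves room for κ ≤ 3.
  n+3≤2^e₂ : n + 3 ≤ 2 ^ e₂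
  n+3≤2^e₂ = [ a-small , a-large ]′ (<-≤-connex a 15452)
    where
    a-small : a < 15452 → n + 3 ≤ 2 ^ e₂
    a-small lt = ≤-trans (+-monoˡ-≤ 3 (≤-trans n≤2a+7 (+-monoˡ-≤ 7 (*-monoʳ-≤ 2 (<⇒≤ lt))))) e₂≥₁
    a-large : 15452 ≤ a → n + 3 ≤ 2 ^ e₂
    a-large le = ≤-trans (+-monoˡ-≤ 3 (≤-trans (n-bound 57≤a) (*-monoʳ-≤ (131072 * u) (+-monoʳ-≤ (4 * u) (<⇒≤ d<))))) e₂≥₂
      where
      57≤a : 57 ≤ a
      57≤a = ≤-trans (m≤m+n 57 15395) le
      d< : d < 15452
      d< = stage-one level-A e₁ (<⇒≤ (n<2^e₁ 57≤a)) e₁+17≤ le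

  a<1046 : a < 1046
  a<1046 = stage-gap level-B e₂ n+3≤2^e₂ e₂+17≤ B-large

  a<104 : a < 104
  -- 2 · 1046 + 7 + 3 = 2102 is at most 2^12, and 12 + 17 ≤ 30.
  a<104 = stage-gap level-C 12 (≤-trans (+-monoˡ-≤ 3 (≤-trans n≤2a+7 (+-monoˡ-≤ 7 (*-monoʳ-≤ 2 (<⇒≤ a<1046))))) (m≤m+n 2102 1994))
    (m≤m+n 29 1) C-large

  n<216 : n < 216
  n<216 = ≤-<-trans n≤2a+7 (≤-<-trans (+-monoˡ-≤ 7 (*-monoʳ-≤ 2 (≤-pred a<104))) (s≤s (m≤m+n 213 2)))

-- The remaining finite search

fib-pair-F : ∀ k n → fib-pair n (F k) (F (suc k)) ≡ (F (n + k) , F (suc (n + k)))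
fib-pair-F k zero = refl
fib-pair-F k (suc n) = trans (cong (fib-pair n (F (suc k))) (ℕ.+-comm (F k) (F (suc k))))
  (trans (fib-pair-F (suc k) n) (cong (λ l → F l , F (suc l)) (+-suc n k)))

-- ∣_-_∣ recurses in unary, unlike ∸.
distance : ℕ → ℕ → ℕ
distance x y = (x ∸ y) + (y ∸ x)

distance-correct : ∀ x y → ℕ.∣ x - y ∣ ≡ distance x y
distance-correct zero zero = refl
distance-correct zero (suc y) = refl
distance-correct (suc x) zero = sym (ℕ.+-identityʳ (suc x))
distance-correct (suc x) (suc y) = distance-correct x y

within : ℕ → ℕ → Bool
within s p = distance s p * distance s p <ᵇ p

_≟³_ : (x y : ℕ × ℕ × ℕ) → Dec (x ≡ y)
_≟³_ = ≡-dec ℕ._≟_ (≡-dec ℕ._≟_ ℕ._≟_)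

open import Data.List.Membership.DecPropositional _≟³_ using (_∈?_)
open import Data.List.Relation.Unary.Unique.DecPropositional _≟³_ using (unique?)

test : (f g n m a p : ℕ) → Bool
test f g n m a p = if within (f + g) p then does ((n , m , a) ∈? solutions) else true

search-a : ℕ → (f g n m a p : ℕ) → Bool
search-a zero f g n m a p = true
search-a (suc k) f g n m a p = test f g n m a p ∧ search-a k f g n m (suc a) (2 * p)

search-m : ℕ → (f n m x y : ℕ) → Bool
search-m zero f n m x y = true
search-m (suc k) f n m x y = search-a 103 f x n m 1 2 ∧ search-m k f n (suc m) y (x + y)

-- For each n the search takes m = 1, ..., n and a = 1, ..., 103. Consecutive Fibonacci numbers and
-- the powers of 2 are carried along and never recomputed.
search-n : ℕ → (n x y : ℕ) → Bool
search-n zero n x y = true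
search-n (suc k) n x y = search-m n x n 1 1 1 ∧ search-n k (suc n) y (x + y)

test-sound : ∀ n m a → test (F n) (F m) n m a (2 ^ a) ≡ true → Ineq n m a → (n , m , a) ∈ solutions
test-sound n m a ok ineq = conclude (ℕ.<⇒<ᵇ (subst (λ e → e * e < 2 ^ a) (distance-correct (F n + F m) (2 ^ a)) ineq)) ok
  where
  member : (dec : Dec ((n , m , a) ∈ solutions)) → does dec ≡ true → (n , m , a) ∈ solutions
  member (yes p) _ = p
  conclude : ∀ {b} → IsTrue b → (if b then does ((n , m , a) ∈? solutions) else true) ≡ true → (n , m , a) ∈ solutions
  conclude {true} _ eq = member ((n , m , a) ∈? solutions) eq

F-step : ∀ k → F k + F (suc k) ≡ F (suc (suc k))
F-step k = ℕ.+-comm (F k) (F (suc k))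

search-a-sound : ∀ k n m a₀ → search-a k (F n) (F m) n m a₀ (2 ^ a₀) ≡ true → ∀ i → i < k → Ineq n m (i + a₀) → (n , m , i + a₀) ∈ solutions
search-a-sound (suc k) n m a₀ ok zero _ ineq = test-sound n m a₀ (proj₁ (∧-split ok)) ineq
search-a-sound (suc k) n m a₀ ok (suc i) (s≤s lt) ineq = subst (λ a → (n , m , a) ∈ solutions) (+-suc i a₀)
  (search-a-sound k n m (suc a₀) (proj₂ (∧-split {test (F n) (F m) n m a₀ (2 ^ a₀)} ok)) i lt (subst (Ineq n m) (sym (+-suc i a₀)) ineq))

search-m-sound : ∀ k n m₀ → search-m k (F n) n m₀ (F m₀) (F (suc m₀)) ≡ true → ∀ i → i < k → ∀ a → a < 103 → Ineq n (i + m₀) (a + 1) → (n , i + m₀ , a + 1) ∈ solutions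
search-m-sound (suc k) n m₀ ok zero _ a lt ineq = search-a-sound 103 n m₀ 1 (proj₁ (∧-split ok)) a lt ineq
search-m-sound (suc k) n m₀ ok (suc i) (s≤s i<k) a lt ineq = subst (λ m → (n , m , a + 1) ∈ solutions) (+-suc i m₀)
  (search-m-sound k n (suc m₀)
    (subst (λ z → search-m k (F n) n (suc m₀) (F (suc m₀)) z ≡ true) (F-step m₀) (proj₂ (∧-split {search-a 103 (F n) (F m₀) n m₀ 1 2} ok)))
    i i<k a lt (subst (λ m → Ineq n m (a + 1)) (sym (+-suc i m₀)) ineq))

search-n-sound : ∀ k n₀ → search-n k n₀ (F n₀) (F (suc n₀)) ≡ true → ∀ j → j < k → ∀ i → i < j + n₀ → ∀ a → a < 103 →
  Ineq (j + n₀) (i + 1) (a + 1) → (j + n₀ , i + 1 , a + 1) ∈ solutions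
search-n-sound (suc k) n₀ ok zero _ i i< a lt ineq = search-m-sound n₀ n₀ 1 (proj₁ (∧-split ok)) i i< a lt ineq
search-n-sound (suc k) n₀ ok (suc j) (s≤s j<k) i i< a lt ineq = subst (λ n → (n , i + 1 , a + 1) ∈ solutions) (+-suc j n₀)
  (search-n-sound k (suc n₀)
    (subst (λ z → search-n k (suc n₀) (F (suc n₀)) z ≡ true) (F-step n₀) (proj₂ (∧-split {search-m n₀ (F n₀) n₀ 1 1 1} ok)))
    j j<k i (subst (i <_) (sym (+-suc j n₀)) i<) a lt (subst (λ n → Ineq n (i + 1) (a + 1)) (sym (+-suc j n₀)) ineq))

abstract
  search-succeeds : search-n 216 0 0 1 ≡ true
  search-succeeds = refl

complete : ∀ n m a → 1 ≤ m → 1 ≤ a → m ≤ n → Ineq n m a → (n , m , a) ∈ solutions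
complete n (suc m) (suc a) _ _ m<n ineq = subst₂ (λ x y → (n , x , y) ∈ solutions) (ℕ.+-comm m 1) (ℕ.+-comm a 1)
    (subst (λ l → (l , m + 1 , a + 1) ∈ solutions) (ℕ.+-identityʳ n)
      (search-n-sound 216 0 search-succeeds n (subst (_< 216) split n<216) m (subst (m <_) (sym (ℕ.+-identityʳ n)) m<n) a (≤-pred a<104)
        (subst (λ l → Ineq l (m + 1) (a + 1)) (sym (ℕ.+-identityʳ n)) (subst₂ (Ineq n) (ℕ.+-comm 1 m) (ℕ.+-comm 1 a) ineq))))
  where
  split : n ∸ suc m + suc m ≡ n
  split = m∸n+n≡m m<n
  open Chain {n ∸ suc m} {suc m} {suc a} (subst (λ l → Ineq l (suc m) (suc a)) (sym split) ineq) using (a<104; n<216)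

within-solution : ℕ × ℕ × ℕ → Bool
within-solution (n , m , a) = within (proj₁ (fib-pair n 0 1) + proj₁ (fib-pair m 0 1)) (2 ^ a)

within-solution-sound : ∀ n m a → within-solution (n , m , a) ≡ true → Ineq n m a
within-solution-sound n m a ok = subst (λ e → e * e < 2 ^ a) (sym (distance-correct (F n + F m) (2 ^ a)))
  (<ᵇ-sound _ (2 ^ a) (subst₂ (λ x y → within (x + y) (2 ^ a) ≡ true) (F≡ n) (F≡ m) ok))
  where
  F≡ : ∀ n → proj₁ (fib-pair n 0 1) ≡ F n
  F≡ n = trans (cong proj₁ (fib-pair-F 0 n)) (cong F (ℕ.+-identityʳ n))

abstract
  all-within : All (λ s → within-solution s ≡ true) solutions
  all-within = All.tabulate λ {s} s∈ → lookup-true solutions refl s∈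
    where
    lookup-true : ∀ xs → foldr (λ s b → within-solution s ∧ b) true xs ≡ true → ∀ {s} → s ∈ xs → within-solution s ≡ true
    lookup-true (x ∷ xs) ok (here refl) = proj₁ (∧-split ok)
    lookup-true (x ∷ xs) ok (there s∈) = lookup-true xs (proj₂ (∧-split {within-solution x} ok)) s∈

theorem1p1 : (length solutions ≡ 52) × Unique solutions
    × ((n m a : ℕ) → 1 ≤ n → 1 ≤ m → 1 ≤ a → m ≤ n →
        (Ineq n m a ⇔ (n , m , a) ∈ solutions))
theorem1p1 = refl , toWitness {a? = unique? solutions} _ , λ n m a _ 1≤m 1≤a m≤n →
  mk⇔ (complete n m a 1≤m 1≤a m≤n) (λ s∈ → within-solution-sound n m a (All.lookup all-within s∈))
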